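{- Let $V$ be a group-like set. Then the category $\mathcal{F}_V$ is countable, directed, and has amalgamation. In particular, there exists a maximal and ultrahomogeneous (full) measure on $2^{\mathbb{N}}$ with clopen values set equal to $V$.
   Context: All measures are Borel probability measures; $2^{\mathbb{N}}$ is the Cantor space. A set $V$ is group-like if it is countably infinite, $\{0,1\}\subseteq V\subseteq[0,1]$, and $V+\mathbb{Z}$ is an additive subgroup of $\mathbb{R}$. A clopen partition is a finite partition of $2^{\mathbb{N}}$ into nonempty clopen sets. The category $\mathcal{F}_V$: objects are pairs $(P,\mu)$ where $P$ is a clopen partition of $2^{\mathbb{N}}$ and $\mu$ is a probability distribution on the finite set $P$ with $\mu(x)\in V$ and $\mu(x)>0$ for every $x\in P$. A morphism from $(Q,\nu)$ to $(P,\mu)$ is a surjection $p\colon Q\to P$ such that $\mu(x)=\sum_{y\in p^{ -1}(\{x\})}\nu(y)$ for every $x\in P$. A category is directed if for any two objects $A_0,A_1$ there are an object $B$ and morphisms $B\to A_0$, $B\to A_1$. It has amalgamation if for any object $A$ and morphisms $r_i\colon B_i\to A$ ($i=0,1$) there are an object $C$ and morphisms $s_i\colon C\to B_i$ with $r_0\circ s_0=r_1\circ s_1$. A measure is full if it is positive on every nonempty open set; $V_\mu=\{\mu(U):U\text{ clopen}\}$ is its clopen values set. A full measure $\mu$ on $2^{\mathbb{N}}$ is ultrahomogeneous if for any clopen partitions $P,R$ and any bijection $f\colon P\to R$ with $\mu(x)=\mu(f(x))$ for all $x\in P$, there is a $\mu$-preserving homeomorphism $\varphi$ of $2^{\mathbb{N}}$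 with $\varphi[x]=f(x)$ for every $x\in P$. A measure $\mu$ on $2^{\mathbb{N}}$ is maximal if (i) for every tuple $v_1,\dots,v_n$ of non-zero elements of $V_\mu$ with $\sum_{i}v_i=1$ there is a clopen partition $\{x_1,\dots,x_n\}$ of $2^{\mathbb{N}}$ with $\mu(x_i)=v_i$ for all $i$, and (ii) $|v-w|\in V_\mu$ for all $v,w\in V_\mu$. -}

module Defs where

open import Algebra.Bundles using (CommutativeRing)
import Algebra.Construct.NaturalChoice.Max as Max
import Algebra.Properties.CommutativeMonoid.Sum as Sum
import Algebra.Definitions.RawMonoid as Multiples
open import Data.Bool.Base using (Bool; if_then_else_)
open import Data.Fin.Base using (Fin; zero; suc; toℕ)
open import Data.Fin.Properties using (_≟_)
open import Data.Integer.Base using (ℤ; +_; -[1+_])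
open import Data.Nat.Base as ℕ using (ℕ)
open import Data.Product.Base using (∃; Σ-syntax; ∃-syntax; _×_; _,_; proj₁; proj₂)
open import Function.Bundles using (Inverse; Injection; Bijection; _↔_; _↠_; module Surjection)
import Function.Construct.Identity as Identity
import Function.Construct.Composition as Composition
import Function.Construct.Symmetry as Symmetry
open import Level using (Level; 0ℓ; _⊔_) renaming (suc to lsuc)
open import Relation.Binary.Bundles using (Setoid; TotalOrder)
open import Relation.Binary.Construct.On using () renaming (setoid to On-setoid)
open import Relation.Binary.Core using (Rel)
open import Relation.Binary.Definitions using (_Respects_)
open import Relation.Binary.PropositionalEquality as ≡ using (_≡_; _≢_; _≗_; _→-setoid_)
import Relation.Binary.Reasoning.Setoid as SetoidReasoning
open import Relation.Binary.Structures using (IsTotalOrder)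
open import Relation.Nullary.Decidable.Core using (does; yes; no)
open import Relation.Nullary.Negation.Core using (¬_; contradiction)
open import Relation.Unary using (Pred; _∈_; _≐_; _⊥_; _⊢_; ∁; ⋃; U; Satisfiable)
open import Relation.Unary.Properties using (≐-refl; ≐-sym; ≐-trans)

------------------------------------------------------------------------
-- Categories

record Category (o e h f : Level) : Set (lsuc (o ⊔ e ⊔ h ⊔ f)) where
  infixr 9 _∘_
  infix  4 _≈_
  field
    object : Setoid o e
  Obj : Set o
  Obj = Setoid.Carrier object
  field
    hom : Obj → Obj → Setoid h f
  Hom : Obj → Obj → Set h
  Hom A B = Setoid.Carrier (hom A B)
  _≈_ : ∀ {A B} → Rel (Hom A B) f
  _≈_ {A} {B} = Setoid._≈_ (hom A B)
  field
    id        : ∀ {A} → Hom A A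
    _∘_       : ∀ {A B C} → Hom B C → Hom A B → Hom A C
    identityˡ : ∀ {A B} {r : Hom A B} → id ∘ r ≈ r
    identityʳ : ∀ {A B} {r : Hom A B} → r ∘ id ≈ r
    assoc     : ∀ {A B C D} {r : Hom A B} {s : Hom B C} {t : Hom C D} →
                (t ∘ s) ∘ r ≈ t ∘ (s ∘ r)
    ∘-cong    : ∀ {A B C} {s s′ : Hom B C} {r r′ : Hom A B} →
                s ≈ s′ → r ≈ r′ → s ∘ r ≈ s′ ∘ r′

-- At most countable: finite and empty setoids qualify.
Countable : ∀ {a ℓ} → Setoid a ℓ → Set (a ⊔ ℓ)
Countable S = Injection S (≡.setoid ℕ)

module _ {o e h f} (C : Category o e h f) where
  open Category C

  IsCountable : Set (o ⊔ e ⊔ h ⊔ f)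
  IsCountable = Countable object × (∀ A B → Countable (hom A B))

  IsDirected : Set (o ⊔ h)
  IsDirected = ∀ A₀ A₁ → ∃[ B ] (Hom B A₀ × Hom B A₁)

  HasAmalgamation : Set (o ⊔ h ⊔ f)
  HasAmalgamation =
    ∀ {A B₀ B₁} (r₀ : Hom B₀ A) (r₁ : Hom B₁ A) →
    ∃[ C ] Σ[ s₀ ∈ Hom C B₀ ] Σ[ s₁ ∈ Hom C B₁ ] (r₀ ∘ s₀ ≈ r₁ ∘ s₁)

------------------------------------------------------------------------
-- The Cantor space, with the product topology and its Borel sets

Cantor : Set
Cantor = ℕ → Bool

Cantor-setoid : Setoid 0ℓ 0ℓ
Cantor-setoid = ℕ →-setoid Bool

-- Openness makes a predicate respect _≗_, so no separate extensionality
-- condition is imposed on sets of points.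
IsOpen : Pred Cantor 0ℓ → Set
IsOpen A = ∀ {x} → x ∈ A → ∃[ n ] (∀ y → (∀ i → i ℕ.< n → x i ≡ y i) → y ∈ A)

IsClopen : Pred Cantor 0ℓ → Set
IsClopen A = IsOpen A × IsOpen (∁ A)

data IsBorel : Pred Cantor 0ℓ → Set₁ where
  open-set   : ∀ {A} → IsOpen A → IsBorel A
  complement : ∀ {A} → IsBorel A → IsBorel (∁ A)
  union      : ∀ {A : ℕ → Pred Cantor 0ℓ} → (∀ n → IsBorel (A n)) → IsBorel (⋃ ℕ A)
  resp-≐     : ∀ {A B} → A ≐ B → IsBorel A → IsBorel B

Open Clopen Borel : Set₁
Open   = ∃ IsOpen
Clopen = ∃ IsClopen
Borel  = ∃ IsBorel

open⇒borel : Open → Borel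
open⇒borel (A , o) = A , open-set o

clopen⇒borel : Clopen → Borel
clopen⇒borel (A , o , _) = A , open-set o

whole : Borel
whole = U , open-set (λ _ → 0 , λ _ _ → _)

⋃ᴮ : (ℕ → Borel) → Borel
⋃ᴮ A = ⋃ ℕ (λ n → proj₁ (A n)) , union (λ n → proj₂ (A n))

IsContinuous : (Cantor → Cantor) → Set₁
IsContinuous φ = ∀ {A} → IsOpen A → IsOpen (φ ⊢ A)

preimage-borel : ∀ {φ} → IsContinuous φ → ∀ {A} → IsBorel A → IsBorel (φ ⊢ A)
preimage-borel c (open-set o)         = open-set (c o)
preimage-borel c (complement b)       = complement (preimage-borel c b)
preimage-borel c (union bs)           = union (λ n → preimage-borel c (bs n))
preimage-borel c (resp-≐ (p , q) b)   = resp-≐ (p , q) (preimage-borel c b)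

record Homeomorphism : Set₁ where
  field
    inverse           : Inverse Cantor-setoid Cantor-setoid
  open Inverse inverse public using (to; from)
  field
    to-continuous     : IsContinuous to
    from-continuous   : IsContinuous from

  preimage : Borel → Borel
  preimage (A , b) = to ⊢ A , preimage-borel to-continuous b

  image : Pred Cantor 0ℓ → Pred Cantor 0ℓ
  image A y = ∃[ x ] (x ∈ A × to x ≗ y)

-- The parts are listed by Fin size without repetition, so that functions
-- out of and into Fin size are the functions out of and into the
-- partition regarded as a set of parts.
record ClopenPartition (size : ℕ) : Set₁ where
  field
    part     : Fin size → Pred Cantor 0ℓ
    clopen   : ∀ i → IsClopen (part i)
    nonempty : ∀ i → Satisfiable (part i)
    disjoint : ∀ {i j} → i ≢ j → part i ⊥ part j
    cover    : ∀ x → ∃[ i ] x ∈ part i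

  clopenPart : Fin size → Clopen
  clopenPart i = part i , clopen i

------------------------------------------------------------------------
-- The real numbers, as a Dedekind-complete ordered field

-- The axioms are the classical ones (decidable-strength total order,
-- suprema of all bounded inhabited sets); theorems about such a field are
-- meant to be read together with an excluded middle hypothesis, under
-- which it is unique up to isomorphism.

record CompleteOrderedField : Set₁ where
  infix 4 _≤_ _<_
  field
    commutativeRing : CommutativeRing 0ℓ 0ℓ
  open CommutativeRing commutativeRing public
  field
    _≤_          : Rel Carrier 0ℓ
    isTotalOrder : IsTotalOrder _≈_ _≤_
    +-monoˡ-≤    : ∀ z {x y} → x ≤ y → x + z ≤ y + z
    *-nonneg     : ∀ {x y} → 0# ≤ x → 0# ≤ y → 0# ≤ x * y
    0≉1          : ¬ 0# ≈ 1#
    inverse      : ∀ {x} → ¬ x ≈ 0# → ∃[ y ] x * y ≈ 1#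

  IsUpperBound : Pred Carrier 0ℓ → Carrier → Set
  IsUpperBound S b = ∀ {x} → x ∈ S → x ≤ b

  field
    supremum     : ∀ S → Satisfiable S → ∃ (IsUpperBound S) →
                   ∃[ s ] (IsUpperBound S s × (∀ b → IsUpperBound S b → s ≤ b))

  totalOrder : TotalOrder 0ℓ 0ℓ 0ℓ
  totalOrder = record { isTotalOrder = isTotalOrder }

  open Sum +-commutativeMonoid public
    using (sum; sum-syntax; sum-cong-≋; sum-replicate-zero; ∑-comm)

  _<_ : Rel Carrier 0ℓ
  x < y = x ≤ y × ¬ x ≈ y

  ∣_∣ : Carrier → Carrier
  ∣ x ∣ = Max._⊔_ totalOrder x (- x)

  fromℤ : ℤ → Carrier
  fromℤ (+ n)    = Multiples._×_ +-rawMonoid n 1#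
  fromℤ -[1+ n ] = - Multiples._×_ +-rawMonoid (ℕ.suc n) 1#

  HasSum : (ℕ → Carrier) → Carrier → Set
  HasSum f s = ∀ ε → 0# < ε →
    ∃[ N ] (∀ n → N ℕ.≤ n → ∣ (∑[ i < n ] f (toℕ i)) - s ∣ < ε)

module Theory (ℝ : CompleteOrderedField) where
  open CompleteOrderedField ℝ hiding (zero)

  record IsAdditiveSubgroup (G : Pred Carrier 0ℓ) : Set where
    field
      0-closed : 0# ∈ G
      +-closed : ∀ {x y} → x ∈ G → y ∈ G → x + y ∈ G
      -‿closed : ∀ {x} → x ∈ G → - x ∈ G

  _+ℤ : Pred Carrier 0ℓ → Pred Carrier 0ℓ
  (V +ℤ) x = ∃[ v ] (v ∈ V × ∃[ k ] x ≈ v + fromℤ k)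

  record GroupLike (V : Pred Carrier 0ℓ) : Set where
    field
      respects          : V Respects _≈_
      countablyInfinite : Bijection (≡.setoid ℕ) (On-setoid {B = ∃ V} setoid proj₁)
      0∈V               : 0# ∈ V
      1∈V               : 1# ∈ V
      V⊆[0,1]           : ∀ {v} → v ∈ V → 0# ≤ v × v ≤ 1#
      V+ℤ-subgroup      : IsAdditiveSubgroup (V +ℤ)

  ----------------------------------------------------------------------
  -- The category 𝓕 V

  ∑-fibre : ∀ {m n} → (Fin m → Fin n) → Fin n → (Fin m → Carrier) → Carrier
  ∑-fibre p x ν = ∑[ y < _ ] (if does (p y ≟ x) then ν y else 0#)

  module _ (V : Pred Carrier 0ℓ) where

    record Object : Set₁ where
      field
        size      : ℕ
        partition : ClopenPartition size
        mass      : Fin size → Carrier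
        mass∈V    : ∀ x → mass x ∈ V
        mass>0    : ∀ x → 0# < mass x
        mass-sum  : ∑[ x < size ] mass x ≈ 1#
      open ClopenPartition partition public

    -- Equality as sets of clopen sets with masses, ignoring the listing.
    record _≈ₒ_ (A B : Object) : Set where
      private
        module A = Object A
        module B = Object B
      field
        relist     : Fin A.size ↔ Fin B.size
        same-part  : ∀ i → A.part i ≐ B.part (Inverse.to relist i)
        same-mass  : ∀ i → A.mass i ≈ B.mass (Inverse.to relist i)

    record Morphism (Q P : Object) : Set where
      private
        module Q = Object Q
        module P = Object P
      field
        surjection : Fin Q.size ↠ Fin P.size
      open Surjection surjection public using (to)
      field
        pushforward : ∀ x → P.mass x ≈ ∑-fibre to x Q.mass

  ∑-fibre-id : ∀ {n} x (ν : Fin n → Carrier) → ν x ≈ ∑-fibre (λ y → y) x ν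
  ∑-fibre-id {ℕ.suc n} zero ν =
    sym (trans (+-congˡ (sum-replicate-zero n)) (+-identityʳ (ν zero)))
  ∑-fibre-id (suc x) ν =
    trans (∑-fibre-id x (λ y → ν (suc y)))
      (trans (sum-cong-≋ (λ y → reflexive (lemma y))) (sym (+-identityˡ _)))
    where
    lemma : ∀ y → (if does (y ≟ x) then ν (suc y) else 0#)
                ≡ (if does (suc y ≟ suc x) then ν (suc y) else 0#)
    lemma y with y ≟ x
    ... | yes _ = ≡.refl
    ... | no  _ = ≡.refl

  ∑-fibre-∘ : ∀ {l m n} (p : Fin m → Fin n) (q : Fin l → Fin m) x
              (ν : Fin l → Carrier) →
              ∑-fibre p x (λ y → ∑-fibre q y ν) ≈ ∑-fibre (λ z → p (q z)) x ν
  ∑-fibre-∘ {l} {m} p q x ν = begin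
    (∑[ y < m ] (if does (p y ≟ x) then ∑-fibre q y ν else 0#))
      ≈⟨ sum-cong-≋ distribute ⟩
    (∑[ y < m ] ∑[ z < l ] cell y z)
      ≈⟨ ∑-comm cell ⟩
    (∑[ z < l ] ∑[ y < m ] cell y z)
      ≈⟨ sum-cong-≋ collapse ⟩
    ∑-fibre (λ z → p (q z)) x ν ∎
    where
    open SetoidReasoning setoid
    weight : Fin l → Fin m → Carrier
    weight z y = if does (p y ≟ x) then ν z else 0#
    cell : Fin m → Fin l → Carrier
    cell y z = if does (q z ≟ y) then weight z y else 0#
    distribute : ∀ y → (if does (p y ≟ x) then ∑-fibre q y ν else 0#) ≈ ∑[ z < l ] cell y z
    distribute y with p y ≟ x
    ... | yes _ = refl
    ... | no  _ = sym (trans (sum-cong-≋ (λ z → reflexive (zeros z))) (sum-replicate-zero l))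
      where
      zeros : ∀ z → (if does (q z ≟ y) then 0# else 0#) ≡ 0#
      zeros z with q z ≟ y
      ... | yes _ = ≡.refl
      ... | no  _ = ≡.refl
    flip : ∀ z y → cell y z ≡ (if does (y ≟ q z) then weight z y else 0#)
    flip z y with q z ≟ y | y ≟ q z
    ... | yes _ | yes _ = ≡.refl
    ... | no  _ | no  _ = ≡.refl
    ... | yes e | no ¬e = contradiction (≡.sym e) ¬e
    ... | no ¬e | yes e = contradiction (≡.sym e) ¬e
    collapse : ∀ z → ∑[ y < m ] cell y z ≈ weight z (q z)
    collapse z = trans (sum-cong-≋ (λ y → reflexive (flip z y)))
                       (sym (∑-fibre-id (q z) (weight z)))

  module _ (V : Pred Carrier 0ℓ) where

    open _≈ₒ_

    ≈ₒ-refl : ∀ {A} → _≈ₒ_ V A A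
    ≈ₒ-refl .relist      = Identity.↔-id _
    ≈ₒ-refl .same-part _ = ≐-refl
    ≈ₒ-refl .same-mass _ = refl

    ≈ₒ-sym : ∀ {A B} → _≈ₒ_ V A B → _≈ₒ_ V B A
    ≈ₒ-sym e .relist = Symmetry.↔-sym (relist e)
    ≈ₒ-sym {A} {B} e .same-part i =
      ≐-sym (≡.subst (λ j → Object.part A (Inverse.from (relist e) i) ≐ Object.part B j)
                     (Inverse.strictlyInverseˡ (relist e) i)
                     (same-part e (Inverse.from (relist e) i)))
    ≈ₒ-sym {A} {B} e .same-mass i =
      sym (≡.subst (λ j → Object.mass A (Inverse.from (relist e) i) ≈ Object.mass B j)
                   (Inverse.strictlyInverseˡ (relist e) i)
                   (same-mass e (Inverse.from (relist e) i)))

    ≈ₒ-trans : ∀ {A B C} → _≈ₒ_ V A B → _≈ₒ_ V B C → _≈ₒ_ V A C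
    ≈ₒ-trans d e .relist      = Composition.inverse (relist d) (relist e)
    ≈ₒ-trans d e .same-part i = ≐-trans (same-part d i) (same-part e _)
    ≈ₒ-trans d e .same-mass i = trans (same-mass d i) (same-mass e _)

    𝓕 : Category (lsuc 0ℓ) 0ℓ 0ℓ 0ℓ
    𝓕 = record
      { object = record
        { Carrier = Object V
        ; _≈_ = _≈ₒ_ V
        ; isEquivalence = record { refl = ≈ₒ-refl ; sym = ≈ₒ-sym ; trans = ≈ₒ-trans }
        }
      ; hom = λ Q P → On-setoid {B = Morphism V Q P}
                (Fin (Object.size Q) →-setoid Fin (Object.size P)) Morphism.to
      ; id = λ {A} → record
        { surjection = Identity.↠-id _
        ; pushforward = λ x → ∑-fibre-id x (Object.mass A) }
      ; _∘_ = λ {A} s r → record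
        { surjection = Composition.surjection (Morphism.surjection r) (Morphism.surjection s)
        ; pushforward = λ x → trans (Morphism.pushforward s x)
            (trans (sum-cong-≋ (λ y → if-cong (does (Morphism.to s y ≟ x)) (Morphism.pushforward r y)))
              (∑-fibre-∘ (Morphism.to s) (Morphism.to r) x (Object.mass A))) }
      ; identityˡ = λ _ → ≡.refl
      ; identityʳ = λ _ → ≡.refl
      ; assoc = λ _ → ≡.refl
      ; ∘-cong = λ {_} {_} {_} {s} {_} {_} {r′} e d x →
          ≡.trans (≡.cong (Morphism.to s) (d x)) (e (Morphism.to r′ x))
      }
      where
      if-cong : ∀ b {x y} → x ≈ y → (if b then x else 0#) ≈ (if b then y else 0#)
      if-cong Bool.true  e = e
      if-cong Bool.false e = refl

  ----------------------------------------------------------------------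
  -- Measures

  record ProbabilityMeasure : Set₁ where
    field
      μ                   : Borel → Carrier
      μ-cong              : ∀ {A B} → proj₁ A ≐ proj₁ B → μ A ≈ μ B
      nonnegative         : ∀ A → 0# ≤ μ A
      normalised          : μ whole ≈ 1#
      countably-additive  : ∀ (A : ℕ → Borel) →
                            (∀ {i j} → i ≢ j → proj₁ (A i) ⊥ proj₁ (A j)) →
                            HasSum (λ n → μ (A n)) (μ (⋃ᴮ A))

    μᶜ : Clopen → Carrier
    μᶜ A = μ (clopen⇒borel A)

  module _ (M : ProbabilityMeasure) where
    open ProbabilityMeasure M
    open ClopenPartition using (part; clopenPart)

    IsFull : Set₁
    IsFull = ∀ (A : Open) → Satisfiable (proj₁ A) → 0# < μ (open⇒borel A)

    ClopenValues : Pred Carrier (lsuc 0ℓ)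
    ClopenValues v = ∃[ A ] v ≈ μᶜ A

    IsPreservedBy : Homeomorphism → Set₁
    IsPreservedBy φ = ∀ A → μ (Homeomorphism.preimage φ A) ≈ μ A

    IsUltrahomogeneous : Set₁
    IsUltrahomogeneous =
      ∀ {m n} (P : ClopenPartition m) (R : ClopenPartition n) (f : Fin m ↔ Fin n) →
      (∀ i → μᶜ (clopenPart P i) ≈ μᶜ (clopenPart R (Inverse.to f i))) →
      Σ[ φ ∈ Homeomorphism ] (IsPreservedBy φ ×
        (∀ i → Homeomorphism.image φ (part P i) ≐ part R (Inverse.to f i)))

    record IsMaximal : Set₁ where
      field
        realises   : ∀ {n} (v : Fin n → Carrier) →
                     (∀ i → v i ∈ ClopenValues) → (∀ i → ¬ v i ≈ 0#) →
                     ∑[ i < n ] v i ≈ 1# →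
                     Σ[ P ∈ ClopenPartition n ] (∀ i → μᶜ (clopenPart P i) ≈ v i)
        difference : ∀ {v w} → v ∈ ClopenValues → w ∈ ClopenValues →
                     ∣ v - w ∣ ∈ ClopenValues

module Submission where

-- V consists of the elements of [0,1] in a dense countable group G. Doubling
-- every interior point of V turns [0,1] into a Cantor space whose clopen sets
-- are the finite unions of intervals with endpoints in V; on it μ is Lebesgue
-- measure, obtained as an outer measure from the lengths of a binary tree of
-- intervals. For clopen A the distribution function F A c = μ (A ∩ [0,c]) maps
-- V onto G ∩ [0, μ A], so clopen sets of equal measure are matched by sending
-- a point to the point with the same value of the distribution function. This
-- map is a measure preserving homeomorphism, which gives ultrahomogeneity.
-- Amalgamation couples two distributions inside the fibres over A, splitting
-- masses within G.

open import Defs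
open import Axiom.ExcludedMiddle using (ExcludedMiddle)
import Algebra.Definitions.RawMonoid as Multiples
import Algebra.Properties.CommutativeMonoid.Sum as Sum
import Algebra.Properties.Ring as RingProperties
import Algebra.Solver.CommutativeMonoid.Normal as MonoidNormal
open import Data.Bool.Base using (Bool; true; false; if_then_else_)
open import Data.Fin.Base as Fin using (Fin; zero; suc; toℕ)
import Data.Fin.Properties as Fin
open import Data.Integer.Base using (+_; -[1+_])
open import Data.List.Base using (List; []; _∷_; length)
open import Data.List.Properties using (∷-injectiveˡ; ∷-injectiveʳ)
open import Data.Nat.Base as ℕ using (ℕ; zero; suc)
import Data.Nat.Properties as ℕ
open import Data.Nat.Binary.Base using (ℕᵇ; 2[1+_]; 1+[2_])
import Data.Nat.Binary.Base as ℕᵇ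
import Data.Nat.Binary.Properties as ℕᵇ
open import Data.Product.Base using (∃; Σ-syntax; ∃-syntax; ∃₂; _×_; _,_; proj₁; proj₂)
open import Data.Sum.Base using (_⊎_; inj₁; inj₂; [_,_]′)
open import Data.Unit.Base using (⊤; tt)
open import Data.Vec.Base as Vec using (Vec; []; _∷_)
open import Data.Vec.N-ary using (N-ary; _$ⁿ_)
open import Function.Base using (_∘_; id)
open import Function.Bundles using (Bijection; Inverse; _↔_; _↠_; mk↔ₛ′)
import Function.Construct.Symmetry as Symmetry
open import Level using (0ℓ) renaming (suc to lsuc)
open import Relation.Binary.Bundles using (Setoid)
open import Relation.Binary.PropositionalEquality as ≡ using (_≡_; _≢_; _≗_)
open import Relation.Binary.Structures using (IsTotalOrder)
open import Relation.Nullary.Decidable using (Dec; yes; no; does; True; toWitness; fromWitness)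
open import Relation.Nullary.Negation using (¬_; contradiction)
open import Relation.Unary using (Pred; _∈_; _≐_; _⊆_; _⊥_; _⊢_; _∩_; _∪_; ∁; ⋃; U; ∅; Satisfiable)

-- The measure is not deduced from amalgamation. It is built outright in a model where values can be
-- computed, and the category only borrows a clopen partition from that model. The enumeration of
-- `V` steers the tree: the cut at depth n goes through the n-th element of `V` wherever it can, so
-- each element of `V` divides no interval beyond some finite depth and hence gives a clopen cut.
-- Density of `G`, which comes from `V` being infinite, keeps every interval divisible. The obstacle
-- in ultrahomogeneity is that a homeomorphism must match the cuts in `V` of one clopen set with the
-- cuts in `V` of another. This works because `F A` has slope one on the intervals inside `A` and is
-- flat off `A`, so values in `G` are attained at arguments in `V`. Flat stretches make these
-- arguments ambiguous, but as the measure is full no point of `A` lies in such a stretch.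
-- Preservation is claimed for all Borel sets; comparing outer measures reduces it to one inequality
-- on cylinders, for the map and for its inverse. Compactness enters as induction over the tree,
-- which replaces the decomposition of a clopen set into finitely many cylinders.

module Classical (em : ∀ {ℓ} → ExcludedMiddle ℓ) where

  by-contradiction : ∀ {p} {P : Set p} → ¬ ¬ P → P
  by-contradiction {P = P} ¬¬p with em {P = P}
  ... | yes p = p
  ... | no ¬p = contradiction ¬p ¬¬p

  ∃-by-contradiction : ∀ {a p} {A : Set a} {P : A → Set p} → ¬ (∀ x → ¬ P x) → ∃ P
  ∃-by-contradiction f = by-contradiction λ ¬∃ → f λ x px → ¬∃ (x , px)

  -- Excluded middle gives resizing: the truth value of a large proposition is a small set.
  Small : ∀ {p} → Set p → Set
  Small P = True (em {P = P})

  small : ∀ {p} {P : Set p} → P → Small P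
  small = fromWitness

  large : ∀ {p} {P : Set p} → Small P → P
  large = toWitness

  truth : ∀ {p} → Set p → Bool
  truth P = does (em {P = P})

  truth-true : ∀ {p} {P : Set p} → P → truth P ≡ true
  truth-true {P = P} p with em {P = P}
  ... | yes _ = ≡.refl
  ... | no ¬p = contradiction p ¬p

  truth-false : ∀ {p} {P : Set p} → ¬ P → truth P ≡ false
  truth-false {P = P} ¬p with em {P = P}
  ... | yes p = contradiction p ¬p
  ... | no _  = ≡.refl

  true-truth : ∀ {p} {P : Set p} → truth P ≡ true → P
  true-truth {P = P} e with em {P = P}
  ... | yes p = p

  least : ∀ {p} {P : ℕ → Set p} → ∃ P → ∃[ n ] (P n × (∀ k → P k → n ℕ.≤ k))
  least {P = P} (n , pn) = go n 0 ≡.refl (λ _ _ → ℕ.z≤n)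
    where
    go : ∀ d m → m ℕ.+ d ≡ n → (∀ k → P k → m ℕ.≤ k) → ∃[ n ] (P n × (∀ k → P k → n ℕ.≤ k))
    go zero m e low = m , ≡.subst P (≡.trans (≡.sym e) (ℕ.+-identityʳ m)) pn , low
    go (suc d) m e low with em {P = P m}
    ... | yes pm = m , pm , low
    ... | no ¬pm = go d (suc m) (≡.trans (≡.sym (ℕ.+-suc m d)) e)
                     (λ k pk → ℕ.≤∧≢⇒< (low k pk) λ { ≡.refl → ¬pm pk })

-- Arithmetic, suprema and finite sums in the ordered field.

module OrderedField (em : ∀ {ℓ} → ExcludedMiddle ℓ) (ℝ : CompleteOrderedField) where
  open Classical em
  open CompleteOrderedField ℝ public hiding (zero)
  open IsTotalOrder isTotalOrder public using (total)
    renaming (refl to ≤-refl; trans to ≤-trans; antisym to ≤-antisym; reflexive to ≤-reflexive)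
  open Sum +-commutativeMonoid public using (∑-distrib-+)

  -- Linear arithmetic in the additive group: an expression is the difference
  -- of two monoid expressions, and those are compared by their normal forms.

  infixl 7 _:+_
  infix  8 :-_
  infix  6 _:=_ _:≤_
  infix  3 _⊢≤_

  data Expr (n : ℕ) : Set where
    var  : Fin n → Expr n
    :0   : Expr n
    _:+_ : Expr n → Expr n → Expr n
    :-_  : Expr n → Expr n

  _:-_ : ∀ {n} → Expr n → Expr n → Expr n
  e :- f = e :+ (:- f)
  infixl 7 _:-_

  private module N = MonoidNormal +-commutativeMonoid

  ⟦_⟧ : ∀ {n} → Expr n → Vec Carrier n → Carrier
  ⟦ var i ⟧  ρ = Vec.lookup ρ i
  ⟦ :0 ⟧     ρ = 0#
  ⟦ e :+ f ⟧ ρ = ⟦ e ⟧ ρ + ⟦ f ⟧ ρ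
  ⟦ :- e ⟧   ρ = - ⟦ e ⟧ ρ

  positive negative : ∀ {n} → Expr n → N.Expr n
  positive (var i)  = N.var i
  positive :0       = N.id
  positive (e :+ f) = positive e N.⊕ positive f
  positive (:- e)   = negative e
  negative (var i)  = N.id
  negative :0       = N.id
  negative (e :+ f) = negative e N.⊕ negative f
  negative (:- e)   = positive e

  interchange : ∀ a b c d → (a + b) + (c + d) ≈ (a + c) + (b + d)
  interchange a b c d = trans (+-assoc a b (c + d)) (trans (+-congˡ
    (trans (sym (+-assoc b c d)) (trans (+-congʳ (+-comm b c)) (+-assoc c b d))))
    (sym (+-assoc a c (b + d))))

  cancelʳ : ∀ {a b} c → a + c ≈ b + c → a ≈ b
  cancelʳ {a} {b} c e = trans (sym (absorb a)) (trans (+-congʳ e) (absorb b))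
    where
    absorb : ∀ x → x + c + - c ≈ x
    absorb x = trans (+-assoc x c (- c)) (trans (+-congˡ (-‿inverseʳ c)) (+-identityʳ x))

  difference : ∀ {n} (e : Expr n) ρ → ⟦ e ⟧ ρ + N.⟦ negative e ⟧ ρ ≈ N.⟦ positive e ⟧ ρ
  difference (var i)  ρ = +-identityʳ _
  difference :0       ρ = +-identityʳ _
  difference (e :+ f) ρ = trans (interchange _ _ _ _) (+-cong (difference e ρ) (difference f ρ))
  difference (:- e)   ρ = trans (+-congˡ (sym (difference e ρ)))
    (trans (sym (+-assoc _ _ _)) (trans (+-congʳ (-‿inverseˡ _)) (+-identityˡ _)))

  -- An equation p - n = p′ - n′ is compared as p + n′ = p′ + n. The normal forms of concrete
  -- expressions compute, so that the uses of `solve` and `infer` are discharged by `≡.refl`.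
  Identical : ∀ {n} → Expr n → Expr n → Set
  Identical e f = N.normalise (positive e N.⊕ negative f) ≡ N.normalise (positive f N.⊕ negative e)

  identical : ∀ {n} (e f : Expr n) → Identical e f → ∀ ρ → ⟦ e ⟧ ρ ≈ ⟦ f ⟧ ρ
  identical e f eq ρ = cancelʳ (N.⟦ negative e ⟧ ρ + N.⟦ negative f ⟧ ρ) (begin
    ⟦ e ⟧ ρ + (N.⟦ negative e ⟧ ρ + N.⟦ negative f ⟧ ρ)  ≈⟨ sym (+-assoc _ _ _) ⟩
    ⟦ e ⟧ ρ + N.⟦ negative e ⟧ ρ + N.⟦ negative f ⟧ ρ    ≈⟨ +-congʳ (difference e ρ) ⟩
    N.⟦ positive e N.⊕ negative f ⟧ ρ                    ≈⟨ sym (N.correct (positive e N.⊕ negative f) ρ) ⟩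
    N.⟦ N.normalise (positive e N.⊕ negative f) ⟧⇓ ρ     ≡⟨ ≡.cong (λ nf → N.⟦ nf ⟧⇓ ρ) eq ⟩
    N.⟦ N.normalise (positive f N.⊕ negative e) ⟧⇓ ρ     ≈⟨ N.correct (positive f N.⊕ negative e) ρ ⟩
    N.⟦ positive f N.⊕ negative e ⟧ ρ                    ≈⟨ +-congʳ (sym (difference f ρ)) ⟩
    ⟦ f ⟧ ρ + N.⟦ negative f ⟧ ρ + N.⟦ negative e ⟧ ρ    ≈⟨ +-assoc _ _ _ ⟩
    ⟦ f ⟧ ρ + (N.⟦ negative f ⟧ ρ + N.⟦ negative e ⟧ ρ)  ≈⟨ +-congˡ (+-comm _ _) ⟩
    ⟦ f ⟧ ρ + (N.⟦ negative e ⟧ ρ + N.⟦ negative f ⟧ ρ)  ∎)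
    where open import Relation.Binary.Reasoning.Setoid setoid

  data Equation (n : ℕ) : Set where
    _:=_ : Expr n → Expr n → Equation n

  data Inequality (n : ℕ) : Set where
    _:≤_ : Expr n → Expr n → Inequality n

  data Sequent (n : ℕ) : Set where
    _⊢≤_ : List (Inequality n) → Inequality n → Sequent n

  vars : ∀ n → Vec (Expr n) n
  vars n = Vec.tabulate var

  EqCondition : ∀ {n} → Equation n → Set
  EqCondition (e := f) = Identical e f

  EqMeaning : ∀ {n} → Equation n → Vec Carrier n → Set
  EqMeaning (e := f) ρ = ⟦ e ⟧ ρ ≈ ⟦ f ⟧ ρ

  solve : ∀ {n} (ρ : Vec Carrier n) (f : N-ary n (Expr n) (Equation n)) →
          EqCondition (f $ⁿ vars n) → EqMeaning (f $ⁿ vars n) ρ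
  solve {n} ρ f c with f $ⁿ vars n
  ... | e := e′ = identical e e′ c ρ

  lhs rhs : ∀ {n} → List (Inequality n) → Expr n
  lhs []              = :0
  lhs ((e :≤ f) ∷ hs) = e :+ lhs hs
  rhs []              = :0
  rhs ((e :≤ f) ∷ hs) = f :+ rhs hs

  Condition : ∀ {n} → Sequent n → Set
  Condition (hs ⊢≤ (e :≤ f)) = Identical (e :+ rhs hs) (f :+ lhs hs)

  Assuming : ∀ {n} → List (Inequality n) → Vec Carrier n → Set → Set
  Assuming []              ρ Q = Q
  Assuming ((a :≤ b) ∷ hs) ρ Q = ⟦ a ⟧ ρ ≤ ⟦ b ⟧ ρ → Assuming hs ρ Q

  Meaning : ∀ {n} → Sequent n → Vec Carrier n → Set
  Meaning (hs ⊢≤ (e :≤ f)) ρ = Assuming hs ρ (⟦ e ⟧ ρ ≤ ⟦ f ⟧ ρ)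

  ≤-respˡ : ∀ {a b c} → a ≈ b → a ≤ c → b ≤ c
  ≤-respˡ e = ≤-trans (≤-reflexive (sym e))

  ≤-respʳ : ∀ {a b c} → b ≈ c → a ≤ b → a ≤ c
  ≤-respʳ e p = ≤-trans p (≤-reflexive e)

  +-mono : ∀ {a b c d} → a ≤ b → c ≤ d → a + c ≤ b + d
  +-mono {a} {b} {c} {d} p q = ≤-trans (+-monoˡ-≤ c p)
    (≤-respˡ (+-comm c b) (≤-respʳ (+-comm d b) (+-monoˡ-≤ b q)))

  +-cancelʳ-≤ : ∀ {a b} c → a + c ≤ b + c → a ≤ b
  +-cancelʳ-≤ {a} {b} c p = ≤-respˡ (absorb a) (≤-respʳ (absorb b) (+-monoˡ-≤ (- c) p))
    where
    absorb : ∀ x → x + c + - c ≈ x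
    absorb x = solve (x ∷ c ∷ []) (λ x c → x :+ c :+ (:- c) := x) ≡.refl

  -- The goal e ≤ f follows from hypotheses aᵢ ≤ bᵢ when e + Σ bᵢ and f + Σ aᵢ coincide.
  infer : ∀ {n} (ρ : Vec Carrier n) (f : N-ary n (Expr n) (Sequent n)) →
          Condition (f $ⁿ vars n) → Meaning (f $ⁿ vars n) ρ
  infer {n} ρ f c with f $ⁿ vars n
  ... | hs ⊢≤ (e :≤ e′) = collect hs λ p → +-cancelʳ-≤ (⟦ lhs hs ⟧ ρ)
          (≤-respʳ (identical (e :+ rhs hs) (e′ :+ lhs hs) c ρ) (≤-trans (≤-reflexive (+-comm _ _))
            (≤-trans (+-monoˡ-≤ _ p) (≤-reflexive (+-comm _ _)))))
    where
    collect : ∀ {Q} hs → (⟦ lhs hs ⟧ ρ ≤ ⟦ rhs hs ⟧ ρ → Q) →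
              Assuming hs ρ Q
    collect []              k = k ≤-refl
    collect ((a :≤ b) ∷ hs) k = λ p → collect hs λ q → k (+-mono p q)

  ≰⇒≥ : ∀ {a b} → ¬ a ≤ b → b ≤ a
  ≰⇒≥ {a} {b} p with total a b
  ... | inj₁ q = contradiction q p
  ... | inj₂ q = q

  ≰⇒> : ∀ {a b} → ¬ a ≤ b → b < a
  ≰⇒> p = ≰⇒≥ p , λ e → p (≤-reflexive (sym e))

  <⇒≱ : ∀ {a b} → a < b → ¬ b ≤ a
  <⇒≱ (p , ne) q = ne (≤-antisym p q)

  <-≤-trans : ∀ {a b c} → a < b → b ≤ c → a < c
  <-≤-trans p q = ≰⇒> λ r → <⇒≱ p (≤-trans q r)

  ≤-<-trans : ∀ {a b c} → a ≤ b → b < c → a < c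
  ≤-<-trans p q = ≰⇒> λ r → <⇒≱ q (≤-trans r p)

  ≤⇒<⊎≈ : ∀ {a b} → a ≤ b → a < b ⊎ a ≈ b
  ≤⇒<⊎≈ {a} {b} p with em {P = a ≈ b}
  ... | yes e = inj₂ e
  ... | no ¬e = inj₁ (p , ¬e)

  -- Were 1 ≤ 0, then -1 would be nonnegative, and so would its square, which is 1.
  0≤1 : 0# ≤ 1#
  0≤1 with total 0# 1#
  ... | inj₁ p = p
  ... | inj₂ p = ≤-respʳ (trans (-‿*-‿ 1#) (*-identityˡ 1#)) (*-nonneg q q)
    where
    open RingProperties ring using (-‿distribˡ-*; -‿distribʳ-*; -‿involutive)
    -‿*-‿ : ∀ x → - x * - x ≈ x * x
    -‿*-‿ x = trans (sym (-‿distribˡ-* x (- x)))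
      (trans (-‿cong (sym (-‿distribʳ-* x x))) (-‿involutive (x * x)))
    q : 0# ≤ - 1#
    q = infer (1# ∷ []) (λ i → i :≤ :0 ∷ [] ⊢≤ :0 :≤ :- i) ≡.refl p

  halve : ∀ {ε} → 0# < ε → ∃[ δ ] (0# < δ × δ + δ ≈ ε)
  halve {ε} (0≤ε , 0≉ε) = h * ε , (*-nonneg 0≤h 0≤ε , hε≉0) , double
    where
    two = 1# + 1#
    two≉0 : ¬ two ≈ 0#
    two≉0 e = 0≉1 (≤-antisym 0≤1 (infer (1# ∷ []) (λ i → :0 :≤ i ∷ i :+ i :≤ :0 ∷ [] ⊢≤ i :≤ :0)
                ≡.refl 0≤1 (≤-reflexive e)))
    h = proj₁ (inverse two≉0)
    h+h≈1 : h + h ≈ 1#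
    h+h≈1 = trans (+-cong (sym (*-identityˡ h)) (sym (*-identityˡ h)))
      (trans (sym (distribʳ h 1# 1#)) (proj₂ (inverse two≉0)))
    0≤h : 0# ≤ h
    0≤h = by-contradiction λ ¬p → 0≉1 (≤-antisym 0≤1
      (≤-respˡ h+h≈1 (infer (h ∷ []) (λ h → h :≤ :0 ∷ h :≤ :0 ∷ [] ⊢≤ h :+ h :≤ :0) ≡.refl (≰⇒≥ ¬p) (≰⇒≥ ¬p))))
    double : h * ε + h * ε ≈ ε
    double = trans (sym (distribʳ ε h h)) (trans (*-congʳ h+h≈1) (*-identityˡ ε))
    hε≉0 : ¬ 0# ≈ h * ε
    hε≉0 e = 0≉ε (trans (sym (+-identityʳ 0#)) (trans (+-cong e e) double))

  -- If b < a, then half of a - b is a margin that fails.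
  ≤-by-margins : ∀ {a b} → (∀ ε → 0# < ε → a ≤ b + ε) → a ≤ b
  ≤-by-margins {a} {b} f = by-contradiction λ a≰b →
    let b<a = ≰⇒> a≰b
        0<ε = infer (a ∷ b ∷ []) (λ a b → b :≤ a ∷ [] ⊢≤ :0 :≤ a :- b) ≡.refl (proj₁ b<a)
            , λ e → proj₂ b<a (sym (trans (solve (a ∷ b ∷ []) (λ a b → a := (a :- b) :+ b) ≡.refl)
                                      (trans (+-congʳ (sym e)) (+-identityˡ b))))
        (δ , 0<δ , δ+δ≈ε) = halve 0<ε
    in <⇒≱ 0<δ (infer (a ∷ b ∷ δ ∷ []) (λ a b δ → a :≤ b :+ δ ∷ δ :+ δ :≤ a :- b ∷ [] ⊢≤ δ :≤ :0)
                  ≡.refl (f δ 0<δ) (≤-reflexive δ+δ≈ε))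

  IsSupremum IsInfimum : ∀ {p} → Pred Carrier p → Carrier → Set p
  IsSupremum S s = (∀ {x} → x ∈ S → x ≤ s) × (∀ b → (∀ {x} → x ∈ S → x ≤ b) → s ≤ b)
  IsInfimum  S s = (∀ {x} → x ∈ S → s ≤ x) × (∀ b → (∀ {x} → x ∈ S → b ≤ x) → b ≤ s)

  abstract
    -- `supremum` accepts only predicates in the lowest universe; `Small` brings `S` down to it.
    sup : ∀ {p} (S : Pred Carrier p) → Satisfiable S → ∀ b → (∀ {x} → x ∈ S → x ≤ b) → ∃ (IsSupremum S)
    sup S (x , x∈S) b above =
      let (s , upper , lowest) = supremum (λ x → Small (x ∈ S)) (x , small x∈S) (b , above ∘ large)
      in s , upper ∘ small , λ c above-c → lowest c (above-c ∘ large)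

    -- Found as the supremum of the lower bounds.
    inf : ∀ {p} (S : Pred Carrier p) → Satisfiable S → ∀ b → (∀ {x} → x ∈ S → b ≤ x) → ∃ (IsInfimum S)
    inf S (x , x∈S) b below =
      let (s , upper , lowest) = sup (λ c → ∀ {x} → x ∈ S → c ≤ x) (b , below) x (λ lower → lower x∈S)
      in s , (λ {y} y∈S → lowest y λ lower → lower y∈S) , λ c below-c → upper below-c

  sum-mono : ∀ {n} {f g : Fin n → Carrier} → (∀ i → f i ≤ g i) → sum f ≤ sum g
  sum-mono {zero}  p = ≤-refl
  sum-mono {suc n} p = +-mono (p zero) (sum-mono (p ∘ suc))

  sum-nonneg : ∀ {n} {f : Fin n → Carrier} → (∀ i → 0# ≤ f i) → 0# ≤ sum f
  sum-nonneg {n} p = ≤-respˡ (sum-replicate-zero n) (sum-mono p)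

  sum-zero : ∀ {n} {f : Fin n → Carrier} → (∀ i → f i ≈ 0#) → sum f ≈ 0#
  sum-zero {n} p = trans (sum-cong-≋ p) (sum-replicate-zero n)

  term≤sum : ∀ {n} {f : Fin n → Carrier} → (∀ i → 0# ≤ f i) → ∀ i → f i ≤ sum f
  term≤sum {f = f} p zero = infer (f zero ∷ sum (f ∘ suc) ∷ []) (λ a s → :0 :≤ s ∷ [] ⊢≤ a :≤ a :+ s) ≡.refl
    (sum-nonneg (p ∘ suc))
  term≤sum {f = f} p (suc i) = infer (f zero ∷ f (suc i) ∷ sum (f ∘ suc) ∷ [])
    (λ a x s → :0 :≤ a ∷ x :≤ s ∷ [] ⊢≤ x :≤ a :+ s) ≡.refl (p zero) (term≤sum (p ∘ suc) i)

  partial-sums-mono : ∀ {f : ℕ → Carrier} → (∀ k → 0# ≤ f k) → ∀ {m n} → m ℕ.≤ n →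
                      ∑[ k < m ] f (toℕ k) ≤ ∑[ k < n ] f (toℕ k)
  partial-sums-mono p {n = n} ℕ.z≤n = sum-nonneg {n} (λ k → p (toℕ k))
  partial-sums-mono p (ℕ.s≤s q) = +-mono ≤-refl (partial-sums-mono (p ∘ suc) q)

  +-pos : ∀ {a b} → 0# ≤ a → 0# ≤ b → 0# ≤ a + b
  +-pos {a} {b} = infer (a ∷ b ∷ []) (λ a b → :0 :≤ a ∷ :0 :≤ b ∷ [] ⊢≤ :0 :≤ a :+ b) ≡.refl

  -- Otherwise the multiples of `d` have a supremum s. Adding `d` to a multiple gives a multiple, so
  -- s - d is an upper bound too, which is absurd.
  archimedean : ∀ {d} b → 0# < d → ∃[ n ] b < Multiples._×_ +-rawMonoid n d
  archimedean {d} b 0<d = let (n , p) = ∃-by-contradiction ¬bounded in n , ≰⇒> p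
    where
    open Multiples +-rawMonoid using () renaming (_×_ to _·_)
    ¬bounded : ¬ (∀ n → ¬ ¬ n · d ≤ b)
    ¬bounded below =
      let (s , upper , lowest) = sup (λ x → ∃[ n ] x ≈ n · d) (0# , 0 , refl)
            b (λ { (n , e) → ≤-respˡ (sym e) (by-contradiction (below n)) })
          s≤s-d = lowest (s - d) λ { {x} (n , e) → infer (x ∷ d ∷ s ∷ []) (λ x d s → d :+ x :≤ s ∷ [] ⊢≤ x :≤ s :- d)
                    ≡.refl (≤-respˡ (+-congˡ (sym e)) (upper (suc n , refl))) }
      in <⇒≱ 0<d (infer (d ∷ s ∷ []) (λ d s → s :≤ s :- d ∷ [] ⊢≤ d :≤ :0) ≡.refl s≤s-d)

  -- εₖ = ε / 2ᵏ⁺¹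
  halvings : ∀ {ε} → 0# < ε → ℕ → ∃[ δ ] 0# < δ
  halvings 0<ε zero    = let (δ , 0<δ , _) = halve 0<ε in δ , 0<δ
  halvings 0<ε (suc k) = halvings (proj₁ (proj₂ (halve 0<ε))) k

  sum-halvings : ∀ {ε} (0<ε : 0# < ε) n → ∑[ k < n ] proj₁ (halvings 0<ε (toℕ k)) ≤ ε
  sum-halvings 0<ε zero    = proj₁ 0<ε
  sum-halvings 0<ε (suc n) =
    let (δ , 0<δ , e) = halve 0<ε in ≤-respʳ e (+-mono ≤-refl (sum-halvings 0<δ n))

  abs-cases : ∀ x → (0# ≤ x × ∣ x ∣ ≡ x) ⊎ (x ≤ 0# × ∣ x ∣ ≡ - x)
  -- `∣ x ∣` computes by this very comparison, hence both equations hold by `≡.refl`.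
  abs-cases x with total (- x) x
  ... | inj₁ -x≤x = inj₁ ([ id , (λ x≤0 → infer (x ∷ []) (λ x → x :≤ :0 ∷ :- x :≤ x ∷ [] ⊢≤ :0 :≤ x) ≡.refl x≤0 -x≤x) ]′
                           (total 0# x) , ≡.refl)
  ... | inj₂ x≤-x = inj₂ ([ (λ 0≤x → infer (x ∷ []) (λ x → :0 :≤ x ∷ x :≤ :- x ∷ [] ⊢≤ x :≤ :0) ≡.refl 0≤x x≤-x) , id ]′
                           (total 0# x) , ≡.refl)

  abs-< : ∀ {x ε} → x < ε → - x < ε → ∣ x ∣ < ε
  abs-< {x} {ε} p q = [ (λ e → ≡.subst (_< ε) (≡.sym (proj₂ e)) p) , (λ e → ≡.subst (_< ε) (≡.sym (proj₂ e)) q) ]′ (abs-cases x)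

-- Cylinders, open sets and Borel sets of the Cantor space.

-- Words are read backwards: the head of a word is its last letter, so that
-- extending a word by a letter is _∷_.

Word : Set
Word = List Bool

prefix : Cantor → ℕ → Word
prefix x zero    = []
prefix x (suc n) = x n ∷ prefix x n

length-prefix : ∀ x n → length (prefix x n) ≡ n
length-prefix x zero    = ≡.refl
length-prefix x (suc n) = ≡.cong suc (length-prefix x n)

Cylinder : Word → Pred Cantor 0ℓ
Cylinder []      x = ⊤
Cylinder (b ∷ ρ) x = x (length ρ) ≡ b × Cylinder ρ x

prefix∈Cylinder : ∀ x n → x ∈ Cylinder (prefix x n)
prefix∈Cylinder x zero    = tt
prefix∈Cylinder x (suc n) = ≡.cong x (length-prefix x n) , prefix∈Cylinder x n

cylinder-prefix : ∀ {x} ρ → x ∈ Cylinder ρ → prefix x (length ρ) ≡ ρ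
cylinder-prefix []      _        = ≡.refl
cylinder-prefix (b ∷ ρ) (e , x∈) = ≡.cong₂ _∷_ e (cylinder-prefix ρ x∈)

Agree : ℕ → Cantor → Cantor → Set
Agree n x y = ∀ i → i ℕ.< n → x i ≡ y i

agree-≤ : ∀ {m n x y} → m ℕ.≤ n → Agree n x y → Agree m x y
agree-≤ m≤n a i i<m = a i (ℕ.≤-trans i<m m≤n)

agree-sym : ∀ {n x y} → Agree n x y → Agree n y x
agree-sym a i i<n = ≡.sym (a i i<n)

agree⇒prefix : ∀ {x y} n → Agree n x y → prefix x n ≡ prefix y n
agree⇒prefix zero    a = ≡.refl
agree⇒prefix (suc n) a = ≡.cong₂ _∷_ (a n ℕ.≤-refl) (agree⇒prefix n (agree-≤ (ℕ.n≤1+n n) a))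

prefix⇒agree : ∀ {x y} n → prefix x n ≡ prefix y n → Agree n x y
prefix⇒agree (suc n) e i (ℕ.s≤s i≤n) with ℕ.m≤n⇒m<n∨m≡n i≤n
... | inj₁ i<n    = prefix⇒agree n (∷-injectiveʳ e) i i<n
... | inj₂ ≡.refl = ∷-injectiveˡ e

cylinder⇒agree : ∀ {x y} ρ → x ∈ Cylinder ρ → y ∈ Cylinder ρ → Agree (length ρ) x y
cylinder⇒agree ρ x∈ y∈ = prefix⇒agree (length ρ) (≡.trans (cylinder-prefix ρ x∈) (≡.sym (cylinder-prefix ρ y∈)))

cylinder-open : ∀ ρ → IsOpen (Cylinder ρ)
cylinder-open ρ {x} x∈ = length ρ , λ y a →
  ≡.subst (λ σ → y ∈ Cylinder σ) (≡.trans (≡.sym (agree⇒prefix (length ρ) a)) (cylinder-prefix ρ x∈))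
    (prefix∈Cylinder y (length ρ))

cylinder-∁-open : ∀ ρ → IsOpen (∁ (Cylinder ρ))
cylinder-∁-open ρ {x} x∉ = length ρ , λ y a y∈ →
  x∉ (proj₂ (cylinder-open ρ y∈) x (agree-sym a))

cylinder-inhabited : ∀ ρ → Satisfiable (Cylinder ρ)
cylinder-inhabited []      = (λ _ → false) , tt
cylinder-inhabited (b ∷ ρ) = y , y-last , proj₂ (cylinder-open ρ x∈) y (λ i i< → ≡.sym (y-below i i<))
  where
  x  = proj₁ (cylinder-inhabited ρ)
  x∈ = proj₂ (cylinder-inhabited ρ)
  y : Cantor
  y i with i ℕ.≟ length ρ
  ... | yes _ = b
  ... | no _  = x i
  y-last : y (length ρ) ≡ b
  y-last with length ρ ℕ.≟ length ρ
  ... | yes _ = ≡.refl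
  ... | no ¬e = contradiction ≡.refl ¬e
  y-below : ∀ i → i ℕ.< length ρ → y i ≡ x i
  y-below i i< with i ℕ.≟ length ρ
  ... | yes e = contradiction e (ℕ.<⇒≢ i<)
  ... | no _  = ≡.refl

open⇒cylinder : ∀ {A} → IsOpen A → ∀ {x} → x ∈ A → ∃[ n ] Cylinder (prefix x n) ⊆ A
open⇒cylinder A-open {x} x∈A = let (n , inside) = A-open x∈A in
  n , λ {y} y∈ → inside y (≡.subst (λ k → Agree k x y) (length-prefix x n)
                            (cylinder⇒agree (prefix x n) (prefix∈Cylinder x n) y∈))

open-respects : ∀ {A} → IsOpen A → ∀ {x y} → x ≗ y → x ∈ A → y ∈ A
open-respects A-open x≗y x∈A = proj₂ (A-open x∈A) _ (λ i _ → x≗y i)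

-- An arbitrary predicate on points need not respect `_≗_`, while the inverse laws of a
-- homeomorphism hold only up to `_≗_`. For Borel sets the gap is closed by induction on their
-- generation.
borel-respects : ∀ {A} → IsBorel A → ∀ {x y} → x ≗ y → x ∈ A → y ∈ A
borel-respects (open-set o)         e x∈       = open-respects o e x∈
borel-respects (complement b)       e x∉ y∈    = x∉ (borel-respects b (≡.sym ∘ e) y∈)
borel-respects (union bs)           e (n , x∈) = n , borel-respects (bs n) e x∈
borel-respects (resp-≐ (p , q) b)   e x∈       = p (borel-respects b e (q x∈))

open-∩ : ∀ {A B} → IsOpen A → IsOpen B → IsOpen (A ∩ B)
open-∩ oA oB (x∈A , x∈B) = let (m , p) = oA x∈A ; (n , q) = oB x∈B in
  m ℕ.⊔ n , λ y a → p y (agree-≤ (ℕ.m≤m⊔n m n) a) , q y (agree-≤ (ℕ.m≤n⊔m m n) a)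

open-⋃ : ∀ {A : ℕ → Pred Cantor 0ℓ} → (∀ k → IsOpen (A k)) → IsOpen (⋃ ℕ A)
open-⋃ oA (k , x∈) = let (n , p) = oA k x∈ in n , λ y a → k , p y a

open-U : IsOpen U
open-U _ = 0 , λ _ _ → tt

open-∅ : IsOpen ∅
open-∅ ()

-- Compactness of the Cantor space.

module Bar (em : ∀ {ℓ} → ExcludedMiddle ℓ) where
  open Classical em

  -- Compactness: if the empty word fails P, then so do all prefixes of some branch.
  bar-induction : ∀ {p} (P : Word → Set p) → (∀ ρ → P (false ∷ ρ) → P (true ∷ ρ) → P ρ) →
                  (∀ x → ∃[ n ] P (prefix x n)) → P []
  bar-induction P step barred = by-contradiction λ ¬P[] →
    let (n , p) = barred branch in ¬P-branch ¬P[] n p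
    where
    bad : Word → Bool
    -- The false child if `P` fails there; otherwise the true child, where by `step` `P` fails
    -- whenever it fails at `ρ`.
    bad ρ = truth (P (false ∷ ρ))
    word : ℕ → Word
    word zero    = []
    word (suc n) = bad (word n) ∷ word n
    branch : Cantor
    branch n = bad (word n)
    prefix-branch : ∀ n → prefix branch n ≡ word n
    prefix-branch zero    = ≡.refl
    prefix-branch (suc n) = ≡.cong (bad (word n) ∷_) (prefix-branch n)
    ¬P-extend : ∀ ρ → ¬ P ρ → ¬ P (bad ρ ∷ ρ)
    ¬P-extend ρ ¬p q with em {P = P (false ∷ ρ)}
    ... | yes p = ¬p (step ρ p q)
    ... | no ¬p′ = ¬p′ q
    ¬P-word : ¬ P [] → ∀ n → ¬ P (word n)
    ¬P-word ¬P[] zero    = ¬P[]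
    ¬P-word ¬P[] (suc n) = ¬P-extend (word n) (¬P-word ¬P[] n)
    ¬P-branch : ¬ P [] → ∀ n → ¬ P (prefix branch n)
    ¬P-branch ¬P[] n p = ¬P-word ¬P[] n (≡.subst P (prefix-branch n) p)

-- The outer measure extending an additive weight on words.

n≤suc-pred : ∀ n → n ℕ.≤ suc (ℕ.pred n)
n≤suc-pred zero    = ℕ.z≤n
n≤suc-pred (suc n) = ℕ.≤-refl

module Extension (em : ∀ {ℓ} → ExcludedMiddle ℓ) (ℝ : CompleteOrderedField)
  (m : Word → CompleteOrderedField.Carrier ℝ)
  (m-nonneg : ∀ ρ → CompleteOrderedField._≤_ ℝ (CompleteOrderedField.0# ℝ) (m ρ))
  (m-split : ∀ ρ → CompleteOrderedField._≈_ ℝ (m ρ)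
                     (CompleteOrderedField._+_ ℝ (m (false ∷ ρ)) (m (true ∷ ρ))))
  (m-root : CompleteOrderedField._≈_ ℝ (m []) (CompleteOrderedField.1# ℝ))
  where

  open Classical em
  open Bar em
  open OrderedField em ℝ

  Inside : Word → Pred Cantor 0ℓ → Set
  Inside ρ A = ∀ x → x ∈ Cylinder ρ → x ∈ A

  -- The weight of the cylinders of depth n below ρ that lie inside A.
  α : Pred Cantor 0ℓ → ℕ → Word → Carrier
  α A zero    ρ = if truth (Inside ρ A) then m ρ else 0#
  α A (suc n) ρ = α A n (false ∷ ρ) + α A n (true ∷ ρ)

  inside-child : ∀ {A} b ρ → Inside ρ A → Inside (b ∷ ρ) A
  inside-child b ρ i x (_ , x∈) = i x x∈

  α-nonneg : ∀ A n ρ → 0# ≤ α A n ρ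
  α-nonneg A zero ρ with em {P = Inside ρ A}
  ... | yes _ = m-nonneg ρ
  ... | no _  = ≤-refl
  α-nonneg A (suc n) ρ = +-pos (α-nonneg A n (false ∷ ρ)) (α-nonneg A n (true ∷ ρ))

  α≤m : ∀ A n ρ → α A n ρ ≤ m ρ
  α≤m A zero ρ with em {P = Inside ρ A}
  ... | yes _ = ≤-refl
  ... | no _  = m-nonneg ρ
  α≤m A (suc n) ρ = ≤-respʳ (sym (m-split ρ)) (+-mono (α≤m A n (false ∷ ρ)) (α≤m A n (true ∷ ρ)))

  inside⇒m≤α : ∀ {A} n ρ → Inside ρ A → m ρ ≤ α A n ρ
  inside⇒m≤α {A} zero ρ i with em {P = Inside ρ A}
  ... | yes _ = ≤-refl
  ... | no ¬i = contradiction i ¬i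
  inside⇒m≤α (suc n) ρ i = ≤-respˡ (sym (m-split ρ))
    (+-mono (inside⇒m≤α n (false ∷ ρ) (inside-child false ρ i)) (inside⇒m≤α n (true ∷ ρ) (inside-child true ρ i)))

  α-mono : ∀ {A B} → A ⊆ B → ∀ n ρ → α A n ρ ≤ α B n ρ
  α-mono {A} {B} A⊆B zero ρ with em {P = Inside ρ A}
  ... | yes i = inside⇒m≤α 0 ρ (λ x x∈ → A⊆B (i x x∈))
  ... | no _  = α-nonneg B 0 ρ
  α-mono A⊆B (suc n) ρ = +-mono (α-mono A⊆B n (false ∷ ρ)) (α-mono A⊆B n (true ∷ ρ))

  α-suc : ∀ A n ρ → α A n ρ ≤ α A (suc n) ρ
  α-suc A zero ρ with em {P = Inside ρ A}
  ... | yes i = inside⇒m≤α 1 ρ i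
  ... | no _  = α-nonneg A 1 ρ
  α-suc A (suc n) ρ = +-mono (α-suc A n (false ∷ ρ)) (α-suc A n (true ∷ ρ))

  α-depth : ∀ A {k n} ρ → k ℕ.≤ n → α A k ρ ≤ α A n ρ
  α-depth A {n = zero}  ρ ℕ.z≤n = ≤-refl
  α-depth A {n = suc n} ρ ℕ.z≤n = ≤-trans (α-depth A ρ (ℕ.z≤n {n})) (α-suc A n ρ)
  α-depth A ρ (ℕ.s≤s p) = +-mono (α-depth A (false ∷ ρ) p) (α-depth A (true ∷ ρ) p)

  -- Only an inequality: a cylinder inside `A ∪ B` need not lie inside either set.
  α-modular : ∀ A B n ρ → α A n ρ + α B n ρ ≤ α (A ∪ B) n ρ + α (A ∩ B) n ρ
  α-modular A B zero ρ with em {P = Inside ρ A} | em {P = Inside ρ B}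
  ... | yes i | yes j = +-mono (inside⇒m≤α 0 ρ (λ x x∈ → inj₁ (i x x∈)))
                               (inside⇒m≤α 0 ρ (λ x x∈ → i x x∈ , j x x∈))
  ... | yes i | no _  = +-mono (inside⇒m≤α 0 ρ (λ x x∈ → inj₁ (i x x∈))) (α-nonneg (A ∩ B) 0 ρ)
  ... | no _  | yes j = ≤-respˡ (+-comm _ _)
                          (+-mono (inside⇒m≤α 0 ρ (λ x x∈ → inj₂ (j x x∈))) (α-nonneg (A ∩ B) 0 ρ))
  ... | no _  | no _  = +-mono (α-nonneg (A ∪ B) 0 ρ) (α-nonneg (A ∩ B) 0 ρ)
  α-modular A B (suc n) ρ = ≤-respˡ (interchange _ _ _ _) (≤-respʳ (interchange _ _ _ _)
    (+-mono (α-modular A B n (false ∷ ρ)) (α-modular A B n (true ∷ ρ))))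

  -- ν A is the measure of the interior of A.
  abstract
    ν-sup : ∀ A → ∃ (IsSupremum λ x → ∃[ n ] x ≈ α A n [])
    ν-sup A = sup _ (α A 0 [] , 0 , refl) (m []) λ { (n , e) → ≤-respˡ (sym e) (α≤m A n []) }

    ν : Pred Cantor 0ℓ → Carrier
    ν A = proj₁ (ν-sup A)

    α≤ν : ∀ A n → α A n [] ≤ ν A
    α≤ν A n = proj₁ (proj₂ (ν-sup A)) (n , refl)

    ν-least : ∀ {A b} → (∀ n → α A n [] ≤ b) → ν A ≤ b
    ν-least {A} p = proj₂ (proj₂ (ν-sup A)) _ λ { (n , e) → ≤-respˡ (sym e) (p n) }

    ν-approx : ∀ A {ε} → 0# < ε → ∃[ n ] ν A ≤ α A n [] + ε
    ν-approx A {ε} 0<ε = ∃-by-contradiction λ ¬p → <⇒≱ 0<ε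
      (infer (ν A ∷ ε ∷ []) (λ v e → v :≤ v :- e ∷ [] ⊢≤ e :≤ :0) ≡.refl
        (ν-least λ n → infer (α A n [] ∷ ε ∷ ν A ∷ []) (λ a e v → a :+ e :≤ v ∷ [] ⊢≤ a :≤ v :- e) ≡.refl
          (≰⇒≥ (¬p n))))

  ν-mono : ∀ {A B} → A ⊆ B → ν A ≤ ν B
  ν-mono {A} {B} A⊆B = ν-least λ n → ≤-trans (α-mono A⊆B n []) (α≤ν B n)

  ν-nonneg : ∀ A → 0# ≤ ν A
  ν-nonneg A = ≤-trans (α-nonneg A 0 []) (α≤ν A 0)

  ν-∅ : ν ∅ ≤ 0#
  ν-∅ = ν-least λ n → empty n []
    where
    empty : ∀ n ρ → α ∅ n ρ ≤ 0#
    empty zero ρ with em {P = Inside ρ ∅}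
    ... | yes i = contradiction (proj₂ (cylinder-inhabited ρ)) (i (proj₁ (cylinder-inhabited ρ)))
    ... | no _  = ≤-refl
    empty (suc n) ρ = ≤-respʳ (+-identityˡ 0#) (+-mono (empty n (false ∷ ρ)) (empty n (true ∷ ρ)))

  -- This is how additivity of the weight reaches open sets: two sets with a small intersection have
  -- measures that almost add up to at most that of the union. Monotonicity in the depth lets both
  -- approximations be taken at the same depth.
  ν-modular : ∀ A B → ν A + ν B ≤ ν (A ∪ B) + ν (A ∩ B)
  ν-modular A B = ≤-by-margins λ ε 0<ε →
    let (δ , 0<δ , δ+δ≈ε) = halve 0<ε
        (k , p) = ν-approx A 0<δ
        (l , q) = ν-approx B 0<δ
        n = k ℕ.⊔ l
    in infer (ν A ∷ ν B ∷ α A k [] ∷ α B l [] ∷ α A n [] ∷ α B n [] ∷ α (A ∪ B) n [] ∷ α (A ∩ B) n [] ∷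
              ν (A ∪ B) ∷ ν (A ∩ B) ∷ δ ∷ ε ∷ [])
         (λ νA νB αA αB αA′ αB′ α∪ α∩ ν∪ ν∩ δ ε →
            νA :≤ αA :+ δ ∷ νB :≤ αB :+ δ ∷ δ :+ δ :≤ ε ∷ αA :≤ αA′ ∷ αB :≤ αB′ ∷ αA′ :+ αB′ :≤ α∪ :+ α∩ ∷
            α∪ :≤ ν∪ ∷ α∩ :≤ ν∩ ∷ [] ⊢≤ νA :+ νB :≤ (ν∪ :+ ν∩) :+ ε) ≡.refl
         p q (≤-reflexive δ+δ≈ε) (α-depth A [] (ℕ.m≤m⊔n k l)) (α-depth B [] (ℕ.m≤n⊔m k l))
         (α-modular A B n []) (α≤ν (A ∪ B) n) (α≤ν (A ∩ B) n)

  -- β K N ρ stands for the weight below ρ that the first K of the open sets A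
  -- cover at depth N, in whichever way overlaps are counted.
  exhaust : (A : ℕ → Pred Cantor 0ℓ) → (∀ k → IsOpen (A k)) → (β : ℕ → ℕ → Word → Carrier) →
            (∀ {K L M N} ρ → K ℕ.≤ L → M ℕ.≤ N → β K M ρ ≤ β L N ρ) →
            (∀ K N ρ → β K N (false ∷ ρ) + β K N (true ∷ ρ) ≤ β K (suc N) ρ) →
            (∀ K N ρ → 0# ≤ β K N ρ) →
            (∀ k ρ → Inside ρ (A k) → m ρ ≤ β (suc k) 0 ρ) →
            ∀ n → ∃₂ λ K N → α (⋃ ℕ A) n [] ≤ β K N []
  exhaust A A-open β β-mono β-split β-nonneg β-inside n = bar-induction P step barred
    where
    P : Word → Set
    -- The depth left until level `n`. It truncates to 0, since a branch through the union may have
    -- to be followed beyond level `n` before its cylinder lies inside some `A k`.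
    P ρ = ∃₂ λ K N → α (⋃ ℕ A) (n ℕ.∸ length ρ) ρ ≤ β K N ρ
    step : ∀ ρ → P (false ∷ ρ) → P (true ∷ ρ) → P ρ
    step ρ (K , M , p) (L , N , q) = K ℕ.⊔ L , suc (M ℕ.⊔ N) ,
      ≤-trans (α-depth _ ρ depth)
        (≤-trans (+-mono (≤-trans p (β-mono (false ∷ ρ) (ℕ.m≤m⊔n K L) (ℕ.m≤m⊔n M N)))
                         (≤-trans q (β-mono (true ∷ ρ) (ℕ.m≤n⊔m K L) (ℕ.m≤n⊔m M N))))
          (β-split _ _ ρ))
      where
      depth : n ℕ.∸ length ρ ℕ.≤ suc (n ℕ.∸ suc (length ρ))
      depth = ≡.subst (λ k → n ℕ.∸ length ρ ℕ.≤ suc k) (ℕ.pred[m∸n]≡m∸[1+n] n (length ρ)) (n≤suc-pred _)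
    barred : ∀ x → ∃[ k ] P (prefix x k)
    barred x with em {P = x ∈ ⋃ ℕ A}
    ... | yes (k , x∈Ak) =
      let (l , l-inside) = open⇒cylinder (A-open k) x∈Ak
      in l , suc k , 0 , ≤-trans (α≤m (⋃ ℕ A) (n ℕ.∸ length (prefix x l)) (prefix x l)) (β-inside k (prefix x l) (λ _ → l-inside))
    -- A branch that avoids the union is followed to level `n`, where its cylinder, not being inside
    -- the union, contributes 0.
    ... | no x∉ = n , 0 , 0 , ≤-trans (≤-reflexive (reflexive outside)) (β-nonneg 0 0 (prefix x n))
      where
      outside : α (⋃ ℕ A) (n ℕ.∸ length (prefix x n)) (prefix x n) ≡ 0#
      outside rewrite length-prefix x n | ℕ.n∸n≡0 n
        | truth-false (λ (i : Inside (prefix x n) (⋃ ℕ A)) → x∉ (i x (prefix∈Cylinder x n))) = ≡.refl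

  -- The instance of `exhaust` that counts overlaps with multiplicity. As elsewhere, a bound on an
  -- infinite sum is a common bound on its partial sums.
  ν-subadditive : ∀ {A : ℕ → Pred Cantor 0ℓ} → (∀ k → IsOpen (A k)) → ∀ {b} →
                  (∀ K → ∑[ k < K ] ν (A (toℕ k)) ≤ b) → ν (⋃ ℕ A) ≤ b
  ν-subadditive {A} A-open bound = ν-least λ n →
    let (K , N , p) = exhaust A A-open β β-mono β-split β-nonneg β-inside n
    in ≤-trans p (≤-trans (sum-mono {K} (λ k → α≤ν (A (toℕ k)) N)) (bound K))
    where
    β : ℕ → ℕ → Word → Carrier
    β K N ρ = ∑[ k < K ] α (A (toℕ k)) N ρ
    β-mono : ∀ {K L M N} ρ → K ℕ.≤ L → M ℕ.≤ N → β K M ρ ≤ β L N ρ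
    β-mono {K} {N = N} ρ K≤L M≤N = ≤-trans (sum-mono {K} (λ k → α-depth (A (toℕ k)) ρ M≤N))
      (partial-sums-mono (λ k → α-nonneg (A k) N ρ) K≤L)
    β-split : ∀ K N ρ → β K N (false ∷ ρ) + β K N (true ∷ ρ) ≤ β K (suc N) ρ
    β-split K N ρ = ≤-reflexive (sym (∑-distrib-+ {K} _ _))
    β-nonneg : ∀ K N ρ → 0# ≤ β K N ρ
    β-nonneg K N ρ = sum-nonneg {K} (λ k → α-nonneg (A (toℕ k)) N ρ)
    β-inside : ∀ k ρ → Inside ρ (A k) → m ρ ≤ β (suc k) 0 ρ
    β-inside k ρ i = ≤-trans
      (≡.subst (λ l → m ρ ≤ α (A l) 0 ρ) (≡.sym (Fin.toℕ-fromℕ k)) (inside⇒m≤α 0 ρ i))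
      (term≤sum {suc k} (λ l → α-nonneg (A (toℕ l)) 0 ρ) (Fin.fromℕ k))

  ⋃< : ℕ → (ℕ → Pred Cantor 0ℓ) → Pred Cantor 0ℓ
  ⋃< K A x = ∃[ k ] (k ℕ.< K × x ∈ A k)

  -- The instance of `exhaust` that counts overlaps once.
  ν-continuous : ∀ {A : ℕ → Pred Cantor 0ℓ} → (∀ k → IsOpen (A k)) → ∀ {ε} → 0# < ε →
                 ∃[ K ] ν (⋃ ℕ A) ≤ ν (⋃< K A) + ε
  ν-continuous {A} A-open 0<ε =
    let (n , p) = ν-approx (⋃ ℕ A) 0<ε
        (K , N , q) = exhaust A A-open (λ K → α (⋃< K A)) mono (λ _ _ _ → ≤-refl) (λ K → α-nonneg (⋃< K A))
                        (λ k ρ i → inside⇒m≤α 0 ρ (λ x x∈ → k , ℕ.≤-refl , i x x∈)) n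
    in K , ≤-trans p (+-monoˡ-≤ _ (≤-trans q (α≤ν (⋃< K A) N)))
    where
    mono : ∀ {K L M N} ρ → K ℕ.≤ L → M ℕ.≤ N → α (⋃< K A) M ρ ≤ α (⋃< L A) N ρ
    mono {L = L} {M} ρ K≤L M≤N = ≤-trans (α-mono (λ { (k , k<K , x∈) → k , ℕ.≤-trans k<K K≤L , x∈ }) M ρ)
      (α-depth (⋃< L A) ρ M≤N)

  OpenMeasures : Pred Cantor 0ℓ → Pred Carrier (lsuc 0ℓ)
  OpenMeasures A r = ∃[ O ] (IsOpen O × A ⊆ O × r ≈ ν O)

  abstract
    μ-inf : ∀ A → ∃ (IsInfimum (OpenMeasures A))
    μ-inf A = inf (OpenMeasures A) (ν U , U , open-U , (λ _ → tt) , refl) 0#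
      λ { (O , _ , _ , e) → ≤-respʳ (sym e) (ν-nonneg O) }

    μ : Pred Cantor 0ℓ → Carrier
    μ A = proj₁ (μ-inf A)

    μ≤ν : ∀ {A O} → IsOpen O → A ⊆ O → μ A ≤ ν O
    μ≤ν {A} {O} O-open A⊆O = proj₁ (proj₂ (μ-inf A)) (O , O-open , A⊆O , refl)

    μ-greatest : ∀ {A b} → (∀ O → IsOpen O → A ⊆ O → b ≤ ν O) → b ≤ μ A
    μ-greatest {A} p = proj₂ (proj₂ (μ-inf A)) _ λ { (O , O-open , A⊆O , e) → ≤-respʳ (sym e) (p O O-open A⊆O) }

    μ-approx : ∀ A {ε} → 0# < ε → ∃[ O ] (IsOpen O × A ⊆ O × ν O ≤ μ A + ε)
    μ-approx A {ε} 0<ε = ∃-by-contradiction {P = λ O → IsOpen O × A ⊆ O × ν O ≤ μ A + ε} λ ¬p → <⇒≱ 0<ε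
      (infer (μ A ∷ ε ∷ []) (λ a e → a :+ e :≤ a ∷ [] ⊢≤ e :≤ :0) ≡.refl
        (μ-greatest λ O O-open A⊆O → ≰⇒≥ λ q → ¬p O (O-open , A⊆O , q)))

  μ-mono : ∀ {A B} → A ⊆ B → μ A ≤ μ B
  μ-mono A⊆B = μ-greatest λ O O-open B⊆O → μ≤ν O-open (λ x∈ → B⊆O (A⊆B x∈))

  μ-cong : ∀ {A B} → A ≐ B → μ A ≈ μ B
  μ-cong (p , q) = ≤-antisym (μ-mono p) (μ-mono q)

  μ-nonneg : ∀ A → 0# ≤ μ A
  μ-nonneg A = μ-greatest λ O _ _ → ν-nonneg O

  μ-open : ∀ {O} → IsOpen O → μ O ≈ ν O
  μ-open O-open = ≤-antisym (μ≤ν O-open id) (μ-greatest λ _ _ O⊆ → ν-mono O⊆)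

  -- Each `A k` gets an open cover with excess ε / 2ᵏ⁺¹, and the excesses add up to at most ε.
  μ-subadditive : ∀ {A : ℕ → Pred Cantor 0ℓ} {b} → (∀ K → ∑[ k < K ] μ (A (toℕ k)) ≤ b) → μ (⋃ ℕ A) ≤ b
  μ-subadditive {A} {b} bound = ≤-by-margins λ ε 0<ε →
    let O : ℕ → Pred Cantor 0ℓ
        O k = proj₁ (μ-approx (A k) (proj₂ (halvings 0<ε k)))
        O-open : ∀ k → IsOpen (O k)
        O-open k = proj₁ (proj₂ (μ-approx (A k) (proj₂ (halvings 0<ε k))))
        A⊆O : ∀ k → A k ⊆ O k
        A⊆O k = proj₁ (proj₂ (proj₂ (μ-approx (A k) (proj₂ (halvings 0<ε k)))))
        small-excess k = proj₂ (proj₂ (proj₂ (μ-approx (A k) (proj₂ (halvings 0<ε k)))))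
    in ≤-trans (μ≤ν (open-⋃ {A = O} O-open) λ { (k , x∈) → k , A⊆O k x∈ })
         (ν-subadditive {A = O} O-open λ K → ≤-trans (sum-mono {K} (λ k → small-excess (toℕ k)))
           (≤-respˡ (sym (∑-distrib-+ {K} _ _)) (+-mono (bound K) (sum-halvings 0<ε K))))

  -- The set and its complement have open covers with arbitrarily small overlap. Being symmetric,
  -- the condition passes to complements at once; Carathéodory's inequality is derived from it in
  -- `μ-split`.
  Measurable : Pred Cantor 0ℓ → Set₁
  Measurable A = ∀ {ε} → 0# < ε → ∃₂ λ O Q → IsOpen O × IsOpen Q × A ⊆ O × ∁ A ⊆ Q × ν (O ∩ Q) ≤ ε

  measurable-≐ : ∀ {A B} → A ≐ B → Measurable A → Measurable B
  measurable-≐ (p , q) A-meas 0<ε = let (O , Q , oO , oQ , A⊆O , ∁A⊆Q , s) = A-meas 0<ε in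
    O , Q , oO , oQ , (λ x∈ → A⊆O (q x∈)) , (λ x∉ → ∁A⊆Q λ x∈ → x∉ (p x∈)) , s

  measurable-∁ : ∀ {A} → Measurable A → Measurable (∁ A)
  measurable-∁ A-meas 0<ε = let (O , Q , oO , oQ , A⊆O , ∁A⊆Q , s) = A-meas 0<ε in
    Q , O , oQ , oO , ∁A⊆Q , (λ ¬x∉ → A⊆O (by-contradiction ¬x∉)) ,
    ≤-trans (ν-mono λ { (x∈Q , x∈O) → x∈O , x∈Q }) s

  interior : Pred Cantor 0ℓ → ℕ → Pred Cantor 0ℓ
  interior A n x = Inside (prefix x n) A

  α-interior : ∀ A {n} k ρ → length ρ ℕ.+ k ≡ n → α A k ρ ≤ α (interior A n) k ρ
  α-interior A zero ρ e with em {P = Inside ρ A}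
  ... | yes i = inside⇒m≤α 0 ρ λ x x∈ → ≡.subst (λ σ → Inside σ A)
                  (≡.trans (≡.sym (cylinder-prefix ρ x∈))
                    (≡.cong (prefix x) (≡.trans (≡.sym (ℕ.+-identityʳ _)) e))) i
  ... | no _  = α-nonneg (interior A _) 0 ρ
  α-interior A (suc k) ρ e = +-mono (α-interior A k (false ∷ ρ) (≡.trans (≡.sym (ℕ.+-suc _ k)) e))
                                    (α-interior A k (true ∷ ρ) (≡.trans (≡.sym (ℕ.+-suc _ k)) e))

  -- The cylinders of a suitable depth `n` inside `A` form a clopen set `C` that exhausts `A` up to
  -- ε, so the complement of `C` is the required cover of the complement of `A`.
  measurable-open : ∀ {A} → IsOpen A → Measurable A
  measurable-open {A} A-open {ε} 0<ε =
    A , ∁ C , A-open , ∁C-open , id , (λ x∉A x∈C → x∉A (C⊆A x∈C)) , excess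
    where
    n = proj₁ (ν-approx A 0<ε)
    C = interior A n
    C⊆A : C ⊆ A
    C⊆A {x} i = i x (prefix∈Cylinder x n)
    ∁C-open : IsOpen (∁ C)
    ∁C-open {x} x∉ = n , λ y a y∈ → x∉ (≡.subst (λ ρ → Inside ρ A) (≡.sym (agree⇒prefix n a)) y∈)
    excess : ν (A ∩ ∁ C) ≤ ε
    excess = infer (ν (A ∩ ∁ C) ∷ ν C ∷ ν ((A ∩ ∁ C) ∪ C) ∷ ν ((A ∩ ∁ C) ∩ C) ∷ ν A ∷ α A n [] ∷ ε ∷ [])
      (λ d c u i a αn e → d :+ c :≤ u :+ i ∷ u :≤ a ∷ i :≤ :0 ∷ a :≤ αn :+ e ∷ αn :≤ c ∷ [] ⊢≤ d :≤ e) ≡.refl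
      (ν-modular (A ∩ ∁ C) C) (ν-mono λ { (inj₁ (x∈A , _)) → x∈A ; (inj₂ x∈C) → C⊆A x∈C })
      (≤-trans (ν-mono λ { ((_ , x∉C) , x∈C) → x∉C x∈C }) ν-∅) (proj₂ (ν-approx A 0<ε))
      (≤-trans (α-interior A n [] ≡.refl) (α≤ν C n))

  -- An infinite intersection of the `Q k` need not be open, so only the first `K` are intersected,
  -- where `K` is so large that the first `K` of the `O k` exhaust their union up to δ. The overlap
  -- then consists of what those `O k` miss and of the sets `O k ∩ Q k`, each of the two having
  -- measure at most δ.
  measurable-⋃ : ∀ {A : ℕ → Pred Cantor 0ℓ} → (∀ k → Measurable (A k)) → Measurable (⋃ ℕ A)
  measurable-⋃ {A} A-meas {ε} 0<ε =
    ⋃ ℕ O , (λ x → ∀ k → k ℕ.< K → x ∈ Q k) , open-⋃ O-open , Q<-open K ,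
    (λ { (k , x∈) → k , A⊆O k x∈ }) , (λ x∉ k _ → ∁A⊆Q k λ x∈ → x∉ (k , x∈)) , excess
    where
    δ = proj₁ (halve 0<ε)
    0<δ = proj₁ (proj₂ (halve 0<ε))
    δ+δ≈ε = proj₂ (proj₂ (halve 0<ε))
    approx = λ k → A-meas k (proj₂ (halvings 0<δ k))
    O Q E : ℕ → Pred Cantor 0ℓ
    O k = proj₁ (approx k)
    Q k = proj₁ (proj₂ (approx k))
    E k = O k ∩ Q k
    O-open : ∀ k → IsOpen (O k)
    O-open k = proj₁ (proj₂ (proj₂ (approx k)))
    Q-open : ∀ k → IsOpen (Q k)
    Q-open k = proj₁ (proj₂ (proj₂ (proj₂ (approx k))))
    A⊆O : ∀ k → A k ⊆ O k
    A⊆O k = proj₁ (proj₂ (proj₂ (proj₂ (proj₂ (approx k)))))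
    ∁A⊆Q : ∀ k → ∁ (A k) ⊆ Q k
    ∁A⊆Q k = proj₁ (proj₂ (proj₂ (proj₂ (proj₂ (proj₂ (approx k))))))
    K = proj₁ (ν-continuous O-open 0<δ)
    Q< : ℕ → Pred Cantor 0ℓ
    Q< K x = ∀ k → k ℕ.< K → x ∈ Q k
    Q<-open : ∀ K → IsOpen (Q< K)
    Q<-open zero    _  = 0 , λ _ _ _ ()
    Q<-open (suc K) x∈ =
      let (m , p) = Q<-open K (λ k k<K → x∈ k (ℕ.m≤n⇒m≤1+n k<K))
          (n , q) = Q-open K (x∈ K ℕ.≤-refl)
      in m ℕ.⊔ n , λ y a k k<1+K → [ (λ k<K → p y (agree-≤ (ℕ.m≤m⊔n m n) a) k k<K)
                                   , (λ { ≡.refl → q y (agree-≤ (ℕ.m≤n⊔m m n) a) }) ]′ (ℕ.m≤n⇒m<n∨m≡n (ℕ.≤-pred k<1+K))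
    excess : ν (⋃ ℕ O ∩ Q< K) ≤ ε
    excess = infer (ν (⋃ ℕ O ∩ Q< K) ∷ ν (⋃< K O) ∷ ν ((⋃ ℕ O ∩ Q< K) ∪ ⋃< K O) ∷ ν ((⋃ ℕ O ∩ Q< K) ∩ ⋃< K O) ∷
                    ν (⋃ ℕ O) ∷ δ ∷ ε ∷ [])
      (λ d c u i a δ e → d :+ c :≤ u :+ i ∷ u :≤ a ∷ i :≤ δ ∷ a :≤ c :+ δ ∷ δ :+ δ :≤ e ∷ [] ⊢≤ d :≤ e) ≡.refl
      (ν-modular (⋃ ℕ O ∩ Q< K) (⋃< K O))
      (ν-mono λ { (inj₁ (x∈ , _)) → x∈ ; (inj₂ (k , _ , x∈)) → k , x∈ })
      (≤-trans (ν-mono λ { ((_ , x∈Q) , k , k<K , x∈O) → k , x∈O , x∈Q k k<K })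
        (ν-subadditive (λ k → open-∩ (O-open k) (Q-open k)) λ L →
          ≤-trans (sum-mono {L} λ k → proj₂ (proj₂ (proj₂ (proj₂ (proj₂ (proj₂ (approx (toℕ k)))))))) (sum-halvings 0<δ L)))
      (proj₂ (ν-continuous O-open 0<δ)) (≤-reflexive δ+δ≈ε)

  borel⇒measurable : ∀ {A} → IsBorel A → Measurable A
  borel⇒measurable (open-set o)   = measurable-open o
  borel⇒measurable (complement b) = measurable-∁ (borel⇒measurable b)
  borel⇒measurable (union bs)     = measurable-⋃ (λ k → borel⇒measurable (bs k))
  borel⇒measurable (resp-≐ e b)   = measurable-≐ e (borel⇒measurable b)

  -- If `W` is a nearly optimal open cover of `E`, then `W ∩ O` and `W ∩ Q` cover the two pieces,
  -- and by `ν-modular` their measures together exceed that of `W` by no more than the overlap.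
  μ-split : ∀ {A} → Measurable A → ∀ E → μ (E ∩ A) + μ (E ∩ ∁ A) ≤ μ E
  μ-split {A} A-meas E = ≤-by-margins λ ε 0<ε →
    let (δ , 0<δ , δ+δ≈ε) = halve 0<ε
        (O , Q , oO , oQ , A⊆O , ∁A⊆Q , s) = A-meas 0<δ
        (W , oW , E⊆W , t) = μ-approx E 0<δ
    in infer (μ (E ∩ A) ∷ μ (E ∩ ∁ A) ∷ ν (W ∩ O) ∷ ν (W ∩ Q) ∷ ν ((W ∩ O) ∪ (W ∩ Q)) ∷
              ν ((W ∩ O) ∩ (W ∩ Q)) ∷ ν W ∷ μ E ∷ δ ∷ ε ∷ [])
         (λ a b a′ b′ u i w e δ ε → a :≤ a′ ∷ b :≤ b′ ∷ a′ :+ b′ :≤ u :+ i ∷ u :≤ w ∷ i :≤ δ ∷ w :≤ e :+ δ ∷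
            δ :+ δ :≤ ε ∷ [] ⊢≤ a :+ b :≤ e :+ ε) ≡.refl
         (μ≤ν (open-∩ oW oO) λ { (x∈E , x∈A) → E⊆W x∈E , A⊆O x∈A })
         (μ≤ν (open-∩ oW oQ) λ { (x∈E , x∉A) → E⊆W x∈E , ∁A⊆Q x∉A })
         (ν-modular (W ∩ O) (W ∩ Q)) (ν-mono [ proj₁ , proj₁ ]′)
         (≤-trans (ν-mono λ { ((_ , x∈O) , _ , x∈Q) → x∈O , x∈Q }) s) t (≤-reflexive δ+δ≈ε)

  -- Carathéodory's inequality splits off `A zero`; the other sets lie in what remains of `E`.
  μ-superadditive : ∀ {n} (A : Fin n → Pred Cantor 0ℓ) → (∀ k → Measurable (A k)) →
                        (∀ {i j} → i ≢ j → A i ⊥ A j) → ∀ E → (∀ k → A k ⊆ E) → ∑[ k < n ] μ (A k) ≤ μ E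
  μ-superadditive {zero}  A A-meas disj E A⊆E = μ-nonneg E
  μ-superadditive {suc n} A A-meas disj E A⊆E = ≤-trans
    (+-mono (μ-mono λ x∈ → A⊆E zero x∈ , x∈)
            (μ-superadditive (A ∘ suc) (A-meas ∘ suc) (λ i≢j → disj (i≢j ∘ Fin.suc-injective)) (E ∩ ∁ (A zero))
              λ k x∈ → A⊆E (suc k) x∈ , λ x∈₀ → disj (λ ()) (x∈₀ , x∈)))
    (μ-split (A-meas zero) E)

-- Countable additivity, and how preimages change the measure.

module Measure (em : ∀ {ℓ} → ExcludedMiddle ℓ) (ℝ : CompleteOrderedField)
  (m : Word → CompleteOrderedField.Carrier ℝ)
  (m-nonneg : ∀ ρ → CompleteOrderedField._≤_ ℝ (CompleteOrderedField.0# ℝ) (m ρ))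
  (m-split : ∀ ρ → CompleteOrderedField._≈_ ℝ (m ρ)
                     (CompleteOrderedField._+_ ℝ (m (false ∷ ρ)) (m (true ∷ ρ))))
  (m-root : CompleteOrderedField._≈_ ℝ (m []) (CompleteOrderedField.1# ℝ))
  where

  open Classical em
  open OrderedField em ℝ
  open Extension em ℝ m m-nonneg m-split m-root
  open Theory ℝ using (ProbabilityMeasure)

  μ-U : μ U ≈ 1#
  μ-U = trans (μ-open open-U) (trans (≤-antisym (ν-least λ n → α≤m U n [])
    (≤-trans (inside⇒m≤α 0 [] (λ _ _ → tt)) (α≤ν U 0))) m-root)

  μ-∅ : μ ∅ ≤ 0#
  μ-∅ = ≤-trans (μ≤ν open-∅ id) ν-∅

  μ-∪ : ∀ A B → μ (A ∪ B) ≤ μ A + μ B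
  μ-∪ A B = ≤-trans (μ-mono λ { (inj₁ x∈) → 0 , x∈ ; (inj₂ x∈) → 1 , x∈ })
    (μ-subadditive {A = S} bound)
    where
    S : ℕ → Pred Cantor 0ℓ
    S 0 = A
    S 1 = B
    S _ = ∅
    rest : ∀ K → ∑[ k < K ] μ (S (2 ℕ.+ toℕ k)) ≤ 0#
    rest zero    = ≤-refl
    rest (suc K) = ≤-respʳ (+-identityˡ 0#) (+-mono μ-∅ (rest K))
    bound : ∀ K → ∑[ k < K ] μ (S (toℕ k)) ≤ μ A + μ B
    bound 0 = +-pos (μ-nonneg A) (μ-nonneg B)
    bound 1 = infer (μ A ∷ μ B ∷ []) (λ a b → :0 :≤ b ∷ [] ⊢≤ a :+ :0 :≤ a :+ b) ≡.refl (μ-nonneg B)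
    bound (suc (suc K)) = infer (μ A ∷ μ B ∷ (∑[ k < K ] μ (S (2 ℕ.+ toℕ k))) ∷ [])
      (λ a b r → r :≤ :0 ∷ [] ⊢≤ a :+ (b :+ r) :≤ a :+ b) ≡.refl (rest K)

  μ-cover : ∀ {n} (A : Fin n → Pred Cantor 0ℓ) E → (∀ x → x ∈ E → ∃[ i ] x ∈ A i) → μ E ≤ ∑[ i < n ] μ (A i)
  μ-cover {zero}  A E cover = ≤-trans (μ-mono λ {x} x∈ → contradiction (proj₁ (cover x x∈)) λ ()) μ-∅
  μ-cover {suc n} A E cover = ≤-trans (μ-mono split)
    (≤-trans (μ-∪ (A zero) rest) (+-mono ≤-refl (μ-cover (A ∘ suc) rest (λ _ x∈ → x∈))))
    where
    rest : Pred Cantor 0ℓ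
    rest x = ∃[ i ] x ∈ A (suc i)
    split : E ⊆ (A zero ∪ rest)
    split {x} x∈ with cover x x∈
    ... | zero  , x∈A = inj₁ x∈A
    ... | suc i , x∈A = inj₂ (i , x∈A)

  μ-additive : ∀ {A} → Measurable A → ∀ E → μ E ≈ μ (E ∩ A) + μ (E ∩ ∁ A)
  μ-additive {A} A-meas E = ≤-antisym
    (≤-trans (μ-mono λ {x} x∈ → split x x∈) (μ-∪ (E ∩ A) (E ∩ ∁ A))) (μ-split A-meas E)
    where
    split : ∀ x → x ∈ E → x ∈ ((E ∩ A) ∪ (E ∩ ∁ A))
    split x x∈ with em {P = x ∈ A}
    ... | yes x∈A = inj₁ (x∈ , x∈A)
    ... | no x∉A  = inj₂ (x∈ , x∉A)

  -- Superadditivity keeps the partial sums below the measure of the union, and subadditivity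
  -- forbids all of them to stay ε below it. Being monotone, they remain within ε from some index
  -- on.
  μ-sums : (A : ℕ → Pred Cantor 0ℓ) → (∀ k → Measurable (A k)) → (∀ {i j} → i ≢ j → A i ⊥ A j) →
               HasSum (λ k → μ (A k)) (μ (⋃ ℕ A))
  μ-sums A A-meas disj ε 0<ε = N , λ n N≤n → abs-< (≤-<-trans (below n) 0<ε) (above n N≤n)
    where
    s = μ (⋃ ℕ A)
    S : ℕ → Carrier
    S n = ∑[ k < n ] μ (A (toℕ k))
    S≤s : ∀ n → S n ≤ s
    S≤s n = μ-superadditive {n} (λ k → A (toℕ k)) (λ k → A-meas (toℕ k)) (λ i≢j → disj (i≢j ∘ Fin.toℕ-injective))
              (⋃ ℕ A) (λ k x∈ → toℕ k , x∈)
    below : ∀ n → S n - s ≤ 0#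
    below n = infer (S n ∷ s ∷ []) (λ a b → a :≤ b ∷ [] ⊢≤ a :- b :≤ :0) ≡.refl (S≤s n)
    close : ∃[ N ] ¬ (ε ≤ s - S N)
    close = ∃-by-contradiction λ far → <⇒≱ 0<ε
      (infer (s ∷ ε ∷ []) (λ s e → s :≤ s :- e ∷ [] ⊢≤ e :≤ :0) ≡.refl
        (μ-subadditive λ K → infer (ε ∷ s ∷ S K ∷ []) (λ e s a → e :≤ s :- a ∷ [] ⊢≤ a :≤ s :- e) ≡.refl
          (by-contradiction (far K))))
    N = proj₁ close
    above : ∀ n → N ℕ.≤ n → - (S n - s) < ε
    above n N≤n = ≰⇒> λ p → proj₂ close
      (infer (ε ∷ s ∷ S n ∷ S N ∷ []) (λ e s a b → e :≤ :- (a :- s) ∷ b :≤ a ∷ [] ⊢≤ e :≤ s :- b) ≡.refl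
        p (partial-sums-mono (λ k → μ-nonneg (A k)) N≤n))

  measure : ProbabilityMeasure
  measure = record
    { μ                  = λ A → μ (proj₁ A)
    ; μ-cong             = μ-cong
    ; nonnegative        = λ A → μ-nonneg (proj₁ A)
    ; normalised         = μ-U
    ; countably-additive = λ A → μ-sums (λ k → proj₁ (A k)) (λ k → borel⇒measurable (proj₂ (A k)))
    }

  -- The cylinders of a fixed depth inside `A` have disjoint preimages, each at least as heavy as
  -- its cylinder; their weights are collected along the tree by `μ-split`.
  ν≤μ-preimage : ∀ {φ} → (∀ ρ → IsOpen (φ ⊢ Cylinder ρ)) → (∀ ρ → m ρ ≤ μ (φ ⊢ Cylinder ρ)) →
                     ∀ A → ν A ≤ μ (φ ⊢ A)
  ν≤μ-preimage {φ} φ-open φ-big A = ν-least λ n → ≤-trans (go n []) (μ-mono proj₁)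
    where
    go : ∀ n ρ → α A n ρ ≤ μ (φ ⊢ (A ∩ Cylinder ρ))
    go zero ρ with em {P = Inside ρ A}
    ... | yes i = ≤-trans (φ-big ρ) (μ-mono λ {x} x∈ → i (φ x) x∈ , x∈)
    ... | no _  = μ-nonneg _
    go (suc n) ρ = ≤-trans
      (+-mono (≤-trans (go n (false ∷ ρ)) (μ-mono λ { (x∈A , e , x∈ρ) → (x∈A , x∈ρ) , e , x∈ρ }))
              (≤-trans (go n (true ∷ ρ)) (μ-mono λ { (x∈A , e , x∈ρ) →
                (x∈A , x∈ρ) , λ { (e′ , _) → contradiction (≡.trans (≡.sym e) e′) λ () } })))
      (μ-split (measurable-open (φ-open (false ∷ ρ))) (φ ⊢ (A ∩ Cylinder ρ)))

  -- If φ does not shrink cylinders, its inverse ψ does not shrink any set under preimages.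
  μ-preimage≤ : ∀ {φ ψ} → (∀ ρ → IsOpen (φ ⊢ Cylinder ρ)) → (∀ ρ → m ρ ≤ μ (φ ⊢ Cylinder ρ)) →
                    IsContinuous ψ → (∀ x → ψ (φ x) ≗ x) → ∀ A → μ (ψ ⊢ A) ≤ μ A
  μ-preimage≤ {φ} {ψ} φ-open φ-big ψ-cont ψφ A = μ-greatest λ O O-open A⊆O →
    ≤-trans (μ≤ν (ψ-cont O-open) A⊆O)
      (≤-trans (ν≤μ-preimage φ-open φ-big (ψ ⊢ O))
        (≤-trans (μ-mono λ {x} x∈ → open-respects O-open (ψφ x) x∈) (≤-reflexive (μ-open O-open))))

-- The dense group, the tree of intervals and its length measure.

module Intervals (em : ∀ {ℓ} → ExcludedMiddle ℓ) (ℝ : CompleteOrderedField)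
  (V : Pred (CompleteOrderedField.Carrier ℝ) 0ℓ) (groupLike : Theory.GroupLike ℝ V)
  where

  open Classical em
  open OrderedField em ℝ
  open Multiples +-rawMonoid using () renaming (_×_ to _·_)
  open Theory ℝ using (_+ℤ; module IsAdditiveSubgroup; module GroupLike)
  open GroupLike groupLike public
  open IsAdditiveSubgroup V+ℤ-subgroup public

  G : Pred Carrier 0ℓ
  G = V +ℤ

  0≤V : ∀ {c} → c ∈ V → 0# ≤ c
  0≤V = proj₁ ∘ V⊆[0,1]

  V≤1 : ∀ {c} → c ∈ V → c ≤ 1#
  V≤1 = proj₂ ∘ V⊆[0,1]

  G-respects : ∀ {x y} → x ≈ y → x ∈ G → y ∈ G
  G-respects e (c , c∈V , k , x≈) = c , c∈V , k , trans (sym e) x≈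

  V⊆G : V ⊆ G
  V⊆G {c} c∈V = c , c∈V , + 0 , sym (+-identityʳ c)

  G-difference : ∀ {x y} → x ∈ G → y ∈ G → x - y ∈ G
  G-difference x∈ y∈ = +-closed x∈ (-‿closed y∈)

  multiple-nonneg : ∀ n → 0# ≤ n · 1#
  multiple-nonneg zero    = ≤-refl
  multiple-nonneg (suc n) = +-pos 0≤1 (multiple-nonneg n)

  -- Write the element as c + k with c in `V`. For k = 0 it is c; for k > 0 it is at least 1, hence
  -- 1; for k < 0 it is at most 0, hence 0.
  G∩[0,1]⊆V : ∀ {x} → x ∈ G → 0# ≤ x → x ≤ 1# → x ∈ V
  G∩[0,1]⊆V {x} (c , c∈V , + zero , x≈) 0≤x x≤1 = respects (sym (trans x≈ (+-identityʳ c))) c∈V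
  G∩[0,1]⊆V {x} (c , c∈V , + suc n , x≈) 0≤x x≤1 = respects (sym (≤-antisym x≤1
    (≤-respʳ (sym x≈) (infer (1# ∷ c ∷ n · 1# ∷ []) (λ i c k → :0 :≤ c ∷ :0 :≤ k ∷ [] ⊢≤ i :≤ c :+ (i :+ k)) ≡.refl
      (0≤V c∈V) (multiple-nonneg n))))) 1∈V
  G∩[0,1]⊆V {x} (c , c∈V , -[1+ n ] , x≈) 0≤x x≤1 = respects (sym (≤-antisym
    (≤-respˡ (sym x≈) (infer (1# ∷ c ∷ n · 1# ∷ []) (λ i c k → c :≤ i ∷ :0 :≤ k ∷ [] ⊢≤ c :+ (:- (i :+ k)) :≤ :0) ≡.refl
      (V≤1 c∈V) (multiple-nonneg n))) 0≤x)) 0∈V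

  private module Enumeration = Bijection countablyInfinite

  v : ℕ → Carrier
  v k = proj₁ (Enumeration.to k)

  v∈V : ∀ k → v k ∈ V
  v∈V k = proj₂ (Enumeration.to k)

  index : ∀ {c} → c ∈ V → ∃[ k ] v k ≈ c
  index {c} c∈V = Enumeration.strictlySurjective (c , c∈V)

  -- Otherwise G would consist of the multiples of its least positive element,
  -- and V would be finite.
  no-least-positive : ∀ {d} → 0# < d → d ∈ G → ¬ (∀ g → g ∈ G → 0# < g → d ≤ g)
  no-least-positive {d} 0<d d∈G least-d =
    -- As `N · d` exceeds 1, the values of `v` are among the `N` multiples of `d` below it, so two
    -- of the first `N` + 1 values coincide although `v` is injective.
    let (i , j , i<j , e) = Fin.pigeonhole ℕ.≤-refl (λ (i : Fin (suc N)) → proj₁ (v-multiple (toℕ i)))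
    in ℕ.<⇒≢ i<j (Enumeration.injective (trans (proj₂ (v-multiple (toℕ i)))
         (trans (reflexive (≡.cong (λ k → toℕ k · d) e)) (sym (proj₂ (v-multiple (toℕ j)))))))
    where
    multiple : ∀ N g → g ∈ G → 0# ≤ g → ¬ (N · d ≤ g) → Σ[ k ∈ Fin N ] g ≈ toℕ k · d
    multiple zero    g g∈G 0≤g g< = contradiction 0≤g g<
    multiple (suc N) g g∈G 0≤g g< with ≤⇒<⊎≈ 0≤g
    ... | inj₂ 0≈g = zero , sym 0≈g
    ... | inj₁ 0<g =
      let d≤g = least-d g g∈G 0<g
          (k , e) = multiple N (g - d) (G-difference g∈G d∈G)
            (infer (g ∷ d ∷ []) (λ g d → d :≤ g ∷ [] ⊢≤ :0 :≤ g :- d) ≡.refl d≤g)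
            (λ p → g< (infer (g ∷ d ∷ N · d ∷ []) (λ g d n → n :≤ g :- d ∷ [] ⊢≤ d :+ n :≤ g) ≡.refl p))
      in suc k , trans (solve (g ∷ d ∷ []) (λ g d → g := d :+ (g :- d)) ≡.refl) (+-congˡ e)
    N = proj₁ (archimedean 1# 0<d)
    v-multiple : ∀ i → Σ[ k ∈ Fin N ] v i ≈ toℕ k · d
    v-multiple i = multiple N (v i) (V⊆G (v∈V i)) (0≤V (v∈V i))
      (λ p → <⇒≱ (proj₂ (archimedean 1# 0<d)) (≤-trans p (V≤1 (v∈V i))))

  _between_and_ : Carrier → Carrier → Carrier → Set
  c between a and b = a < c × c < b

  abstract
    -- If nothing in `V` lay between, b - a would be the least positive element of `G`: a smaller
    -- positive g would put a + g between.
    V-dense : ∀ {a b} → a ∈ V → b ∈ V → a < b → ∃[ c ] (c ∈ V × c between a and b)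
    V-dense {a} {b} a∈V b∈V a<b = ∃-by-contradiction λ gap →
      no-least-positive (0<d , λ e → proj₂ a<b (≤-antisym (proj₁ a<b)
          (infer (a ∷ b ∷ []) (λ a b → b :- a :≤ :0 ∷ [] ⊢≤ b :≤ a) ≡.refl (≤-reflexive (sym e)))))
        (G-difference (V⊆G b∈V) (V⊆G a∈V))
        λ g g∈G 0<g → by-contradiction λ d≰g →
          let g<d = ≰⇒> d≰g in
          gap (a + g)
            ( G∩[0,1]⊆V (+-closed (V⊆G a∈V) g∈G) (+-pos (0≤V a∈V) (proj₁ 0<g))
                (infer (a ∷ b ∷ g ∷ 1# ∷ []) (λ a b g i → g :≤ b :- a ∷ b :≤ i ∷ [] ⊢≤ a :+ g :≤ i) ≡.refl
                  (proj₁ g<d) (V≤1 b∈V))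
            , ≰⇒> (λ p → <⇒≱ 0<g (infer (a ∷ g ∷ []) (λ a g → a :+ g :≤ a ∷ [] ⊢≤ g :≤ :0) ≡.refl p))
            , ≰⇒> (λ p → <⇒≱ g<d (infer (a ∷ b ∷ g ∷ []) (λ a b g → b :≤ a :+ g ∷ [] ⊢≤ b :- a :≤ g) ≡.refl p)))
      where
      0<d : 0# ≤ b - a
      0<d = infer (a ∷ b ∷ []) (λ a b → a :≤ b ∷ [] ⊢≤ :0 :≤ b :- a) ≡.refl (proj₁ a<b)

  record Interval : Set where
    constructor interval
    field
      lo hi : Carrier
      lo∈V  : lo ∈ V
      hi∈V  : hi ∈ V
      lo<hi : lo < hi

  open Interval

  abstract
    cut : ∀ I n → ∃[ c ] (c ∈ V × c between lo I and hi I × (v n between lo I and hi I → c ≈ v n))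
    cut I n with em {P = v n between lo I and hi I}
    ... | yes b = v n , v∈V n , b , λ _ → refl
    ... | no ¬b = let (c , c∈V , b) = V-dense (lo∈V I) (hi∈V I) (lo<hi I) in
                  c , c∈V , b , λ b → contradiction b ¬b

  -- The Cantor space is [0,1] with every interior point c of V doubled: at
  -- depth n the interval of a word is cut at v n if v n lies in its interior,
  -- and anywhere in V otherwise.
  child : Bool → Interval → ℕ → Interval
  child false I n = let (c , c∈V , (lo<c , c<hi) , _) = cut I n in interval (lo I) c (lo∈V I) c∈V lo<c
  child true  I n = let (c , c∈V , (lo<c , c<hi) , _) = cut I n in interval c (hi I) c∈V (hi∈V I) c<hi

  node : Word → Interval
  node []      = interval 0# 1# 0∈V 1∈V (0≤1 , 0≉1)
  node (b ∷ ρ) = child b (node ρ) (length ρ)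

  left right mid : Word → Carrier
  left  ρ = lo (node ρ)
  right ρ = hi (node ρ)
  mid   ρ = proj₁ (cut (node ρ) (length ρ))

  mid∈V : ∀ ρ → mid ρ ∈ V
  mid∈V ρ = proj₁ (proj₂ (cut (node ρ) (length ρ)))

  left<mid : ∀ ρ → left ρ < mid ρ
  left<mid ρ = proj₁ (proj₁ (proj₂ (proj₂ (cut (node ρ) (length ρ)))))

  mid<right : ∀ ρ → mid ρ < right ρ
  mid<right ρ = proj₂ (proj₁ (proj₂ (proj₂ (cut (node ρ) (length ρ)))))

  mid-v : ∀ ρ → v (length ρ) between left ρ and right ρ → mid ρ ≈ v (length ρ)
  mid-v ρ = proj₂ (proj₂ (proj₂ (cut (node ρ) (length ρ))))

  left-step : ∀ b ρ → left ρ ≤ left (b ∷ ρ)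
  left-step false ρ = ≤-refl
  left-step true  ρ = proj₁ (left<mid ρ)

  right-step : ∀ b ρ → right (b ∷ ρ) ≤ right ρ
  right-step false ρ = proj₁ (mid<right ρ)
  right-step true  ρ = ≤-refl

  -- Either `v (length ρ)` is not interior to the node of `ρ`, or that node is cut exactly there.
  -- Hence the element of `V` with index n divides no interval from depth n + 1 on.
  undivided : ∀ b ρ → v (length ρ) ≤ left (b ∷ ρ) ⊎ right (b ∷ ρ) ≤ v (length ρ)
  undivided b ρ with em {P = left ρ < v (length ρ)} | em {P = v (length ρ) < right ρ}
  ... | no ≤l  | _       = inj₁ (≤-trans (by-contradiction (≤l ∘ ≰⇒>)) (left-step b ρ))
  ... | yes _  | no r≤   = inj₂ (≤-trans (right-step b ρ) (by-contradiction (r≤ ∘ ≰⇒>)))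
  undivided false ρ | yes l< | yes <r = inj₂ (≤-reflexive (mid-v ρ (l< , <r)))
  undivided true  ρ | yes l< | yes <r = inj₁ (≤-reflexive (sym (mid-v ρ (l< , <r))))

  left-mono : ∀ x {k n} → k ℕ.≤ n → left (prefix x k) ≤ left (prefix x n)
  left-mono x k≤n = go (ℕ.≤⇒≤′ k≤n)
    where
    go : ∀ {k n} → k ℕ.≤′ n → left (prefix x k) ≤ left (prefix x n)
    go ℕ.≤′-refl         = ≤-refl
    go (ℕ.≤′-step {n} p) = ≤-trans (go p) (left-step (x n) (prefix x n))

  right-mono : ∀ x {k n} → k ℕ.≤ n → right (prefix x n) ≤ right (prefix x k)
  right-mono x k≤n = go (ℕ.≤⇒≤′ k≤n)
    where
    go : ∀ {k n} → k ℕ.≤′ n → right (prefix x n) ≤ right (prefix x k)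
    go ℕ.≤′-refl         = ≤-refl
    go (ℕ.≤′-step {n} p) = ≤-trans (right-step (x n) (prefix x n)) (go p)

  -- A point lies on a side of `c` as soon as one of its intervals does. An interior `c` of `V` is
  -- doubled: its lower copy is in `Below c`, its upper copy in `Above c`. For `c` outside `V` a
  -- point may be on neither side.
  Below Above : Carrier → Pred Cantor 0ℓ
  Below c x = ∃[ n ] right (prefix x n) ≤ c
  Above c x = ∃[ n ] c ≤ left (prefix x n)

  below-mono : ∀ {c d} → c ≤ d → Below c ⊆ Below d
  below-mono c≤d (n , p) = n , ≤-trans p c≤d

  above-mono : ∀ {c d} → c ≤ d → Above d ⊆ Above c
  above-mono c≤d (n , p) = n , ≤-trans c≤d p

  below-open : ∀ c → IsOpen (Below c)
  below-open c (n , p) = n , λ y a → n , ≡.subst (λ ρ → right ρ ≤ c) (agree⇒prefix n a) p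

  above-open : ∀ c → IsOpen (Above c)
  above-open c (n , p) = n , λ y a → n , ≡.subst (λ ρ → c ≤ left ρ) (agree⇒prefix n a) p

  below-⊥-above : ∀ {c x} → x ∈ Below c → ¬ x ∈ Above c
  below-⊥-above {c} {x} (n , p) (k , q) = <⇒≱ (lo<hi (node (prefix x (n ℕ.⊔ k))))
    (≤-trans (right-mono x (ℕ.m≤m⊔n n k)) (≤-trans p (≤-trans q (left-mono x (ℕ.m≤n⊔m n k)))))

  below-or-above : ∀ {c} → c ∈ V → ∀ x → x ∈ Below c ⊎ x ∈ Above c
  below-or-above c∈V x with index c∈V
  ... | k , vk≈c with undivided (x k) (prefix x k)
  ...   | inj₁ p = inj₂ (suc k , ≤-trans (≤-reflexive (trans (sym vk≈c) (reflexive (≡.cong v (≡.sym (length-prefix x k)))))) p)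
  ...   | inj₂ p = inj₁ (suc k , ≤-trans p (≤-reflexive (trans (reflexive (≡.cong v (length-prefix x k))) vk≈c)))

  ¬below⇒above : ∀ {c} → c ∈ V → ∀ {x} → ¬ x ∈ Below c → x ∈ Above c
  ¬below⇒above c∈V {x} ¬b = [ (λ b → contradiction b ¬b) , id ]′ (below-or-above c∈V x)

  ¬above⇒below : ∀ {c} → c ∈ V → ∀ {x} → ¬ x ∈ Above c → x ∈ Below c
  ¬above⇒below c∈V {x} ¬a = [ id , (λ a → contradiction a ¬a) ]′ (below-or-above c∈V x)

  below-clopen : ∀ {c} → c ∈ V → IsClopen (Below c)
  below-clopen c∈V = below-open _ , λ x∉ →
    let (n , p) = above-open _ (¬below⇒above c∈V x∉) in n , λ y a y∈ → below-⊥-above y∈ (p y a)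

  above-clopen : ∀ {c} → c ∈ V → IsClopen (Above c)
  above-clopen c∈V = above-open _ , λ x∉ →
    let (n , p) = below-open _ (¬above⇒below c∈V x∉) in n , λ y a y∈ → below-⊥-above (p y a) y∈

  below-1 : ∀ x → x ∈ Below 1#
  below-1 x = 0 , ≤-refl

  above-0 : ∀ x → x ∈ Above 0#
  above-0 x = 0 , ≤-refl

  letter-above : ∀ {x} n → x n ≡ true → x ∈ Above (mid (prefix x n))
  letter-above {x} n e = suc n , ≤-reflexive (reflexive (≡.cong (λ b → left (b ∷ prefix x n)) (≡.sym e)))

  letter-below : ∀ {x} n → x n ≡ false → x ∈ Below (mid (prefix x n))
  letter-below {x} n e = suc n , ≤-reflexive (reflexive (≡.cong (λ b → right (b ∷ prefix x n)) e))

  above-letter : ∀ {x} n → x ∈ Above (mid (prefix x n)) → x n ≡ true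
  above-letter {x} n a with x n in e
  ... | true  = ≡.refl
  ... | false = contradiction a (below-⊥-above (letter-below n e))

  below-letter : ∀ {x} n → x ∈ Below (mid (prefix x n)) → x n ≡ false
  below-letter {x} n b with x n in e
  ... | false = ≡.refl
  ... | true  = contradiction (letter-above n e) (below-⊥-above b)

  cylinder-above : ∀ {x} ρ → x ∈ Cylinder ρ → x ∈ Above (left ρ)
  cylinder-above ρ x∈ = length ρ , ≤-reflexive (reflexive (≡.cong left (≡.sym (cylinder-prefix ρ x∈))))

  cylinder-below : ∀ {x} ρ → x ∈ Cylinder ρ → x ∈ Below (right ρ)
  cylinder-below ρ x∈ = length ρ , ≤-reflexive (reflexive (≡.cong right (cylinder-prefix ρ x∈)))

  -- The bounds of the parent are weaker, so `x` lies in the parent's cylinder by induction, and its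
  -- next letter is read off from its side of the midpoint, which is one of the two given bounds.
  between⇒cylinder : ∀ {x} ρ → x ∈ Above (left ρ) → x ∈ Below (right ρ) → x ∈ Cylinder ρ
  between⇒cylinder []      a b = tt
  between⇒cylinder {x} (l ∷ ρ) a b = letter l a b , x∈ρ
    where
    x∈ρ : x ∈ Cylinder ρ
    x∈ρ = between⇒cylinder ρ (above-mono (left-step l ρ) a) (below-mono (right-step l ρ) b)
    letter : ∀ l → x ∈ Above (left (l ∷ ρ)) → x ∈ Below (right (l ∷ ρ)) → x (length ρ) ≡ l
    letter true  a b = above-letter (length ρ) (≡.subst (λ σ → x ∈ Above (mid σ)) (≡.sym (cylinder-prefix ρ x∈ρ)) a)
    letter false a b = below-letter (length ρ) (≡.subst (λ σ → x ∈ Below (mid σ)) (≡.sym (cylinder-prefix ρ x∈ρ)) b)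

  -- Each letter records the side of a midpoint, and midpoints are in `V`. As the midpoint depends
  -- on the earlier letters, `same` and `letter` proceed together.
  sides-determine : ∀ {x y} → (∀ {c} → c ∈ V → x ∈ Above c → y ∈ Above c) →
                    (∀ {c} → c ∈ V → y ∈ Above c → x ∈ Above c) → x ≗ y
  sides-determine {x} {y} x⇒y y⇒x n = ∷-injectiveˡ (same (suc n))
    where
    same : ∀ n → prefix x n ≡ prefix y n
    letter : ∀ n → x n ≡ y n
    same zero    = ≡.refl
    same (suc n) = ≡.cong₂ _∷_ (letter n) (same n)
    letter n with x n in e
    ... | true  = ≡.sym (above-letter n (≡.subst (λ σ → y ∈ Above (mid σ)) (same n)
                    (x⇒y (mid∈V (prefix x n)) (letter-above n e))))
    ... | false = ≡.sym (below-letter n (¬above⇒below (mid∈V (prefix y n)) λ a → below-⊥-above (letter-below n e)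
                    (y⇒x (mid∈V (prefix x n)) (≡.subst (λ σ → y ∈ Above (mid σ)) (≡.sym (same n)) a))))

  -- From a Dedekind cut of `V` to a point: `s c` is true when the point shall lie above `c`, and
  -- the branch obeys `s` at each midpoint it meets.
  module Cut (s : Carrier → Bool) where

    word : ℕ → Word
    word zero    = []
    word (suc n) = s (mid (word n)) ∷ word n

    point : Cantor
    point n = s (mid (word n))

    prefix-point : ∀ n → prefix point n ≡ word n
    prefix-point zero    = ≡.refl
    prefix-point (suc n) = ≡.cong (s (mid (word n)) ∷_) (prefix-point n)

    module _ (s-0 : s 0# ≡ true) (s-1 : s 1# ≡ false)
             (s-antitone : ∀ {c d} → c ∈ V → d ∈ V → c ≤ d → s d ≡ true → s c ≡ true) where

      s-left : ∀ n → s (left (word n)) ≡ true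
      s-left zero = s-0
      s-left (suc n) with s (mid (word n)) in e
      ... | true  = e
      ... | false = s-left n

      s-right : ∀ n → s (right (word n)) ≡ false
      s-right zero = s-1
      s-right (suc n) with s (mid (word n)) in e
      ... | true  = s-right n
      ... | false = e

      above-point : ∀ {c} → c ∈ V → point ∈ Above c → s c ≡ true
      above-point c∈V (n , p) = s-antitone c∈V (lo∈V (node (prefix point n))) p
        (≡.trans (≡.cong (s ∘ left) (prefix-point n)) (s-left n))

      below-point : ∀ {c} → c ∈ V → point ∈ Below c → s c ≡ false
      below-point {c} c∈V (n , p) with s c in e
      ... | false = ≡.refl
      ... | true  = ≡.trans (≡.sym (s-antitone (hi∈V (node (prefix point n))) c∈V p e))
                      (≡.trans (≡.cong (s ∘ right) (prefix-point n)) (s-right n))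

      point-above : ∀ {c} → c ∈ V → s c ≡ true → point ∈ Above c
      point-above c∈V e = ¬below⇒above c∈V λ b → contradiction (≡.trans (≡.sym e) (below-point c∈V b)) λ ()

  m : Word → Carrier
  m ρ = right ρ - left ρ

  m-nonneg : ∀ ρ → 0# ≤ m ρ
  m-nonneg ρ = infer (left ρ ∷ right ρ ∷ []) (λ a b → a :≤ b ∷ [] ⊢≤ :0 :≤ b :- a) ≡.refl (proj₁ (lo<hi (node ρ)))

  m-split : ∀ ρ → m ρ ≈ m (false ∷ ρ) + m (true ∷ ρ)
  m-split ρ = solve (left ρ ∷ mid ρ ∷ right ρ ∷ []) (λ a c b → b :- a := (c :- a) :+ (b :- c)) ≡.refl

  m-root : m [] ≈ 1#
  m-root = solve (1# ∷ []) (λ i → i :- :0 := i) ≡.refl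

  open Extension em ℝ m m-nonneg m-split m-root public
  open Measure em ℝ m m-nonneg m-split m-root public

  α-below-full : ∀ {c} n ρ → right ρ ≤ c → m ρ ≤ α (Below c) n ρ
  α-below-full n ρ p = inside⇒m≤α n ρ (λ x x∈ → below-mono p (cylinder-below ρ x∈))

  α-above-full : ∀ {c} n ρ → c ≤ left ρ → m ρ ≤ α (Above c) n ρ
  α-above-full n ρ p = inside⇒m≤α n ρ (λ x x∈ → above-mono p (cylinder-above ρ x∈))

  v-index : ∀ {c k} (ρ : Word) → v k ≈ c → suc (length ρ) ℕ.+ 0 ≡ suc k → v (length ρ) ≈ c
  v-index ρ e l = trans (reflexive (≡.cong v (≡.trans (≡.sym (ℕ.+-identityʳ _)) (ℕ.suc-injective l)))) e

  -- At depth `suc k` no cylinder is divided by `c`, so the cylinders of that depth on its lower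
  -- side fill the part of `ρ` to the left of `c`.
  α-below : ∀ {c k} → v k ≈ c → ∀ n ρ → length ρ ℕ.+ n ≡ suc k → c ≤ right ρ → c - left ρ ≤ α (Below c) n ρ
  α-below e zero [] () c≤
  α-below {c} e zero (b ∷ ρ) l c≤ =
    [ (λ p → infer (c ∷ left (b ∷ ρ) ∷ α (Below c) 0 (b ∷ ρ) ∷ []) (λ c l a → c :≤ l ∷ :0 :≤ a ∷ [] ⊢≤ c :- l :≤ a)
               ≡.refl (≤-respˡ (v-index ρ e l) p) (α-nonneg (Below c) 0 (b ∷ ρ)))
    , (λ p → ≤-trans (+-monoˡ-≤ _ c≤) (α-below-full 0 (b ∷ ρ) (≤-respʳ (v-index ρ e l) p)))
    ]′ (undivided b ρ)
  α-below {c} e (suc n) ρ l c≤ =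
    [ (λ c≤mid → infer (c ∷ left ρ ∷ α (Below c) n (false ∷ ρ) ∷ α (Below c) n (true ∷ ρ) ∷ [])
        (λ c l a b → c :- l :≤ a ∷ :0 :≤ b ∷ [] ⊢≤ c :- l :≤ a :+ b) ≡.refl
        (α-below e n (false ∷ ρ) (≡.trans (≡.sym (ℕ.+-suc _ n)) l) c≤mid) (α-nonneg (Below c) n (true ∷ ρ)))
    , (λ mid≤c → infer (c ∷ left ρ ∷ mid ρ ∷ α (Below c) n (false ∷ ρ) ∷ α (Below c) n (true ∷ ρ) ∷ [])
        (λ c l m a b → m :- l :≤ a ∷ c :- m :≤ b ∷ [] ⊢≤ c :- l :≤ a :+ b) ≡.refl
        (α-below-full n (false ∷ ρ) mid≤c) (α-below e n (true ∷ ρ) (≡.trans (≡.sym (ℕ.+-suc _ n)) l) c≤))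
    ]′ (total c (mid ρ))

  α-above : ∀ {c k} → v k ≈ c → ∀ n ρ → length ρ ℕ.+ n ≡ suc k → left ρ ≤ c → right ρ - c ≤ α (Above c) n ρ
  α-above e zero [] () ≤c
  α-above {c} e zero (b ∷ ρ) l ≤c =
    [ (λ p → ≤-trans (infer (right (b ∷ ρ) ∷ left (b ∷ ρ) ∷ c ∷ []) (λ r l c → l :≤ c ∷ [] ⊢≤ r :- c :≤ r :- l) ≡.refl ≤c)
               (α-above-full 0 (b ∷ ρ) (≤-respˡ (v-index ρ e l) p)))
    , (λ p → infer (c ∷ right (b ∷ ρ) ∷ α (Above c) 0 (b ∷ ρ) ∷ []) (λ c r a → r :≤ c ∷ :0 :≤ a ∷ [] ⊢≤ r :- c :≤ a)
               ≡.refl (≤-respʳ (v-index ρ e l) p) (α-nonneg (Above c) 0 (b ∷ ρ)))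
    ]′ (undivided b ρ)
  α-above {c} e (suc n) ρ l ≤c =
    [ (λ c≤mid → infer (c ∷ right ρ ∷ mid ρ ∷ α (Above c) n (false ∷ ρ) ∷ α (Above c) n (true ∷ ρ) ∷ [])
        (λ c r m a b → m :- c :≤ a ∷ r :- m :≤ b ∷ [] ⊢≤ r :- c :≤ a :+ b) ≡.refl
        (α-above e n (false ∷ ρ) (≡.trans (≡.sym (ℕ.+-suc _ n)) l) ≤c) (α-above-full n (true ∷ ρ) c≤mid))
    , (λ mid≤c → infer (c ∷ right ρ ∷ α (Above c) n (false ∷ ρ) ∷ α (Above c) n (true ∷ ρ) ∷ [])
        (λ c r a b → :0 :≤ a ∷ r :- c :≤ b ∷ [] ⊢≤ r :- c :≤ a :+ b) ≡.refl
        (α-nonneg (Above c) n (false ∷ ρ)) (α-above e n (true ∷ ρ) (≡.trans (≡.sym (ℕ.+-suc _ n)) l) mid≤c))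
    ]′ (total c (mid ρ))

  -- Only lower bounds are computed on the tree. The upper bound for `Below c` comes from the lower
  -- bound for `Above c`, as the two measures add up to at most 1.
  μ-below : ∀ {c} → c ∈ V → μ (Below c) ≈ c
  μ-below {c} c∈V = ≤-antisym upper lower
    where
    k = proj₁ (index c∈V)
    at-least : ∀ {A} → IsOpen A → α A (suc k) [] ≤ μ A
    at-least A-open = ≤-respʳ (sym (μ-open A-open)) (α≤ν _ (suc k))
    lower : c ≤ μ (Below c)
    lower = infer (c ∷ μ (Below c) ∷ []) (λ c a → c :- :0 :≤ a ∷ [] ⊢≤ c :≤ a) ≡.refl
      (≤-trans (α-below (proj₂ (index c∈V)) (suc k) [] ≡.refl (V≤1 c∈V)) (at-least (below-open c)))
    upper : μ (Below c) ≤ c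
    upper = infer (c ∷ 1# ∷ μ (Below c) ∷ μ (Above c) ∷ []) (λ c i a b → i :- c :≤ b ∷ a :+ b :≤ i ∷ [] ⊢≤ a :≤ c) ≡.refl
      (≤-trans (α-above (proj₂ (index c∈V)) (suc k) [] ≡.refl (0≤V c∈V)) (at-least (above-open c)))
      (≤-trans (+-mono (μ-mono λ x∈ → tt , x∈) (μ-mono λ x∈ → tt , λ x∈′ → below-⊥-above x∈′ x∈))
        (≤-respʳ μ-U (μ-split (measurable-open (below-open c)) U)))

-- Distribution functions of clopen sets and the transport between sets of equal measure.

clopen-open : ∀ {A} → IsClopen A → IsOpen A
clopen-open (oA , _) = oA

module Homogeneity (em : ∀ {ℓ} → ExcludedMiddle ℓ) (ℝ : CompleteOrderedField)
  (V : Pred (CompleteOrderedField.Carrier ℝ) 0ℓ) (groupLike : Theory.GroupLike ℝ V)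
  where

  open Classical em
  open Bar em
  open OrderedField em ℝ
  open Intervals em ℝ V groupLike

  clopen-∩ : ∀ {A B} → IsClopen A → IsClopen B → IsClopen (A ∩ B)
  clopen-∩ {A} {B} (oA , oA′) (oB , oB′) = open-∩ oA oB , outside
    where
    outside : IsOpen (∁ (A ∩ B))
    outside {x} x∉ with em {P = x ∈ A}
    ... | no x∉A  = let (n , p) = oA′ x∉A in n , λ y a y∈ → p y a (proj₁ y∈)
    ... | yes x∈A = let (n , p) = oB′ (λ x∈B → x∉ (x∈A , x∈B)) in n , λ y a y∈ → p y a (proj₂ y∈)

  split-open : ∀ {A B} → IsOpen A → (∀ {x} → x ∈ A → ¬ x ∈ B) → ∀ {E} → (∀ {x} → x ∈ E → ¬ x ∈ A → x ∈ B) →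
               μ E ≈ μ (E ∩ A) + μ (E ∩ B)
  split-open A-open disj {E} cover = trans (μ-additive (measurable-open A-open) E)
    (+-congˡ (μ-cong ((λ { (x∈E , x∉A) → x∈E , cover x∈E x∉A }) , λ { (x∈E , x∈B) → x∈E , λ x∈A → disj x∈A x∈B })))

  split-at : ∀ {c} → c ∈ V → ∀ E → μ E ≈ μ (E ∩ Below c) + μ (E ∩ Above c)
  split-at c∈V E = split-open (below-open _) below-⊥-above (λ _ → ¬below⇒above c∈V)

  split-child : ∀ {E} ρ → E ⊆ Cylinder ρ → μ E ≈ μ (E ∩ Cylinder (false ∷ ρ)) + μ (E ∩ Cylinder (true ∷ ρ))
  split-child {E} ρ E⊆ρ = split-open (cylinder-open (false ∷ ρ))
    (λ { (e , _) (e′ , _) → contradiction (≡.trans (≡.sym e) e′) λ () })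
    λ {x} x∈E x∉ → other x (E⊆ρ x∈E) x∉
    where
    other : ∀ x → x ∈ Cylinder ρ → ¬ x ∈ Cylinder (false ∷ ρ) → x ∈ Cylinder (true ∷ ρ)
    other x x∈ρ x∉ with x (length ρ)
    ... | true  = ≡.refl , x∈ρ
    ... | false = contradiction (≡.refl , x∈ρ) x∉

  μ-empty : ∀ {A} → (∀ {x} → ¬ x ∈ A) → μ A ≈ 0#
  μ-empty {A} empty = ≤-antisym (≤-trans (μ-mono empty) μ-∅) (μ-nonneg A)

  μ-between : ∀ {c d} → c ∈ V → d ∈ V → c ≤ d → μ (Above c ∩ Below d) ≈ d - c
  μ-between {c} {d} c∈V d∈V c≤d = trans
    (solve (c ∷ μ (Above c ∩ Below d) ∷ []) (λ c a → a := c :+ a :- c) ≡.refl)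
    (+-congʳ (trans (+-cong (trans (sym (μ-below c∈V)) (μ-cong ((λ b → below-mono c≤d b , b) , proj₂)))
                            (μ-cong ((λ { (a , b) → b , a }) , λ { (b , a) → a , b })))
               (trans (sym (split-at c∈V (Below d))) (μ-below d∈V))))

  μ-cylinder : ∀ ρ → μ (Cylinder ρ) ≈ m ρ
  μ-cylinder ρ = trans
    (μ-cong ((λ x∈ → cylinder-above ρ x∈ , cylinder-below ρ x∈) , λ { (a , b) → between⇒cylinder ρ a b }))
    (μ-between (Interval.lo∈V (node ρ)) (Interval.hi∈V (node ρ)) (proj₁ (Interval.lo<hi (node ρ))))

  μ-positive : ∀ {A} → IsOpen A → ∀ {x} → x ∈ A → 0# < μ A
  μ-positive A-open {x} x∈A =
    let (n , inside) = open⇒cylinder A-open x∈A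
        ρ = prefix x n
    in <-≤-trans (≰⇒> λ p → <⇒≱ (Interval.lo<hi (node ρ))
         (infer (left ρ ∷ right ρ ∷ []) (λ l r → r :- l :≤ :0 ∷ [] ⊢≤ r :≤ l) ≡.refl (≤-respˡ (μ-cylinder ρ) p)))
         (μ-mono inside)

  μ-inhabited : ∀ {A} → 0# < μ A → Satisfiable A
  μ-inhabited 0<μ = ∃-by-contradiction λ empty → <⇒≱ 0<μ (≤-reflexive (μ-empty (empty _)))

  clopen-decides : ∀ {A} → IsClopen A → ∀ x → ∃[ n ] (Cylinder (prefix x n) ⊆ A ⊎ Cylinder (prefix x n) ⊆ ∁ A)
  clopen-decides {A} (oA , oA′) x with em {P = x ∈ A}
  ... | yes x∈A = let (n , p) = open⇒cylinder oA x∈A in n , inj₁ p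
  ... | no x∉A  = let (n , p) = open⇒cylinder oA′ x∉A in n , inj₂ p

  m∈G : ∀ ρ → m ρ ∈ G
  m∈G ρ = G-difference (V⊆G (Interval.hi∈V (node ρ))) (V⊆G (Interval.lo∈V (node ρ)))

  -- Cylinders have lengths in `G`; bar induction adds them up over a clopen set.
  μ∈G : ∀ {A} → IsClopen A → μ A ∈ G
  μ∈G {A} A-clopen = G-respects (μ-cong (proj₁ , λ x∈ → x∈ , tt)) (bar-induction P step barred)
    where
    P : Word → Set
    P ρ = μ (A ∩ Cylinder ρ) ∈ G
    step : ∀ ρ → P (false ∷ ρ) → P (true ∷ ρ) → P ρ
    step ρ p q = G-respects (sym (trans (split-child ρ proj₂)
      (+-cong (μ-cong ((λ { ((x∈A , _) , x∈) → x∈A , x∈ }) , λ { (x∈A , x∈) → (x∈A , proj₂ x∈) , x∈ }))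
              (μ-cong ((λ { ((x∈A , _) , x∈) → x∈A , x∈ }) , λ { (x∈A , x∈) → (x∈A , proj₂ x∈) , x∈ })))))
      (+-closed p q)
    leaf : ∀ ρ → Cylinder ρ ⊆ A ⊎ Cylinder ρ ⊆ ∁ A → P ρ
    leaf ρ (inj₁ inside)  = G-respects (sym (trans (μ-cong (proj₂ , λ x∈ → inside x∈ , x∈)) (μ-cylinder ρ))) (m∈G ρ)
    leaf ρ (inj₂ outside) = G-respects (sym (μ-empty {A ∩ Cylinder ρ} λ { (x∈A , x∈) → outside x∈ x∈A })) 0-closed
    barred : ∀ x → ∃[ n ] P (prefix x n)
    barred x = let (n , decided) = clopen-decides A-clopen x in n , leaf (prefix x n) decided

  μ∈V : ∀ {A} → IsClopen A → μ A ∈ V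
  μ∈V A-clopen = G∩[0,1]⊆V (μ∈G A-clopen) (μ-nonneg _) (≤-respʳ μ-U (μ-mono _))

  F : Pred Cantor 0ℓ → Carrier → Carrier
  F A c = μ (A ∩ Below c)

  F-mono : ∀ {A c d} → c ≤ d → F A c ≤ F A d
  F-mono c≤d = μ-mono λ { (x∈A , b) → x∈A , below-mono c≤d b }

  F-0 : ∀ {A} → F A 0# ≈ 0#
  F-0 = μ-empty λ { (_ , b) → below-⊥-above b (above-0 _) }

  F-1 : ∀ {A} → F A 1# ≈ μ A
  F-1 = μ-cong (proj₁ , λ x∈ → x∈ , below-1 _)

  -- Bar induction descends to cylinders inside or outside `A`. The value `t` is sought in the left
  -- child if `A` has at least that much measure there; otherwise the remainder is sought in the
  -- right child. Remainders stay in `G`, so in a cylinder inside `A` the argument `left ρ + t`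
  -- belongs to `V`.
  F-surjective : ∀ {A} → IsClopen A → ∀ {t} → t ∈ G → 0# ≤ t → t ≤ μ A → ∃[ d ] (d ∈ V × F A d ≈ t)
  F-surjective {A} A-clopen t∈G 0≤t t≤ =
    let (d , d∈V , _ , _ , e) = bar-induction P step barred t∈G 0≤t (≤-trans t≤ (μ-mono λ x∈ → x∈ , tt))
    in d , d∈V , trans (μ-cong ((λ { (x∈A , b) → (x∈A , tt) , b }) , λ { ((x∈A , _) , b) → x∈A , b })) e
    where
    P : Word → Set
    P ρ = ∀ {t} → t ∈ G → 0# ≤ t → t ≤ μ (A ∩ Cylinder ρ) →
          ∃[ d ] (d ∈ V × left ρ ≤ d × d ≤ right ρ × μ ((A ∩ Cylinder ρ) ∩ Below d) ≈ t)
    step : ∀ ρ → P (false ∷ ρ) → P (true ∷ ρ) → P ρ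
    step ρ p q {t} t∈G 0≤t t≤ = [ in-left , in-right ]′ (total t a)
      where
      a b : Carrier
      a = μ (A ∩ Cylinder (false ∷ ρ))
      b = μ (A ∩ Cylinder (true ∷ ρ))
      Goal : Set
      Goal = ∃[ d ] (d ∈ V × left ρ ≤ d × d ≤ right ρ × μ ((A ∩ Cylinder ρ) ∩ Below d) ≈ t)
      in-left : t ≤ a → Goal
      in-left t≤a =
        let (d , d∈V , l≤d , d≤mid , e) = p t∈G 0≤t t≤a
        in d , d∈V , l≤d , ≤-trans d≤mid (proj₁ (mid<right ρ)) ,
           trans (μ-cong ((λ { ((x∈A , x∈ρ) , below) → (x∈A , between⇒cylinder (false ∷ ρ)
                              (cylinder-above ρ x∈ρ) (below-mono d≤mid below)) , below })
                         , λ { ((x∈A , x∈) , below) → (x∈A , proj₂ x∈) , below })) e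
      whole≈ : μ (A ∩ Cylinder ρ) ≈ a + b
      whole≈ = trans (split-child ρ proj₂)
        (+-cong (μ-cong ((λ { ((x∈A , _) , x∈) → x∈A , x∈ }) , λ { (x∈A , x∈) → (x∈A , proj₂ x∈) , x∈ }))
                (μ-cong ((λ { ((x∈A , _) , x∈) → x∈A , x∈ }) , λ { (x∈A , x∈) → (x∈A , proj₂ x∈) , x∈ })))
      a∈G : a ∈ G
      a∈G = μ∈G (clopen-∩ A-clopen (cylinder-open (false ∷ ρ) , cylinder-∁-open (false ∷ ρ)))
      in-right : a ≤ t → Goal
      in-right a≤t =
        let (d , d∈V , mid≤d , d≤r , e) = q (G-difference t∈G a∈G)
              (infer (a ∷ t ∷ []) (λ a t → a :≤ t ∷ [] ⊢≤ :0 :≤ t :- a) ≡.refl a≤t)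
              (infer (a ∷ b ∷ t ∷ []) (λ a b t → t :≤ a :+ b ∷ [] ⊢≤ t :- a :≤ b) ≡.refl (≤-respʳ whole≈ t≤))
        in d , d∈V , ≤-trans (proj₁ (left<mid ρ)) mid≤d , d≤r ,
           trans (split-child ρ λ { ((_ , x∈ρ) , _) → x∈ρ })
             (trans (+-cong
                (μ-cong ((λ { (((x∈A , _) , _) , x∈) → x∈A , x∈ })
                        , λ { (x∈A , x∈) → ((x∈A , proj₂ x∈) , below-mono mid≤d (cylinder-below (false ∷ ρ) x∈)) , x∈ }))
                (trans (μ-cong ((λ { (((x∈A , _) , below) , x∈) → (x∈A , x∈) , below })
                               , λ { ((x∈A , x∈) , below) → ((x∈A , proj₂ x∈) , below) , x∈ })) e))
             (solve (a ∷ t ∷ []) (λ a t → a :+ (t :- a) := t) ≡.refl))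
    inside-leaf : ∀ ρ → Cylinder ρ ⊆ A → P ρ
    inside-leaf ρ inside {t} t∈G 0≤t t≤ = d , d∈V , l≤d , d≤r ,
      trans (μ-cong ((λ { ((_ , x∈) , below) → cylinder-above ρ x∈ , below })
                    , λ { (above , below) → let x∈ = between⇒cylinder ρ above (below-mono d≤r below)
                                            in (inside x∈ , x∈) , below }))
        (trans (μ-between (Interval.lo∈V (node ρ)) d∈V l≤d) (solve (left ρ ∷ t ∷ []) (λ l t → l :+ t :- l := t) ≡.refl))
      where
      d = left ρ + t
      l≤d : left ρ ≤ d
      l≤d = infer (left ρ ∷ t ∷ []) (λ l t → :0 :≤ t ∷ [] ⊢≤ l :≤ l :+ t) ≡.refl 0≤t
      d≤r : d ≤ right ρ
      d≤r = infer (left ρ ∷ right ρ ∷ t ∷ []) (λ l r t → t :≤ r :- l ∷ [] ⊢≤ l :+ t :≤ r) ≡.refl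
              (≤-trans t≤ (≤-respʳ (μ-cylinder ρ) (μ-mono proj₂)))
      d∈V : d ∈ V
      d∈V = G∩[0,1]⊆V (+-closed (V⊆G (Interval.lo∈V (node ρ))) t∈G) (≤-trans (0≤V (Interval.lo∈V (node ρ))) l≤d)
              (≤-trans d≤r (V≤1 (Interval.hi∈V (node ρ))))
    outside-leaf : ∀ ρ → Cylinder ρ ⊆ ∁ A → P ρ
    outside-leaf ρ outside {t} t∈G 0≤t t≤ =
      left ρ , Interval.lo∈V (node ρ) , ≤-refl , proj₁ (Interval.lo<hi (node ρ)) ,
      trans (μ-empty {(A ∩ Cylinder ρ) ∩ Below (left ρ)} (empty ∘ proj₁))
            (≤-antisym 0≤t (≤-respʳ (μ-empty {A ∩ Cylinder ρ} empty) t≤))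
      where
      empty : ∀ {x} → ¬ x ∈ (A ∩ Cylinder ρ)
      empty (x∈A , x∈) = outside x∈ x∈A
    leaf : ∀ ρ → Cylinder ρ ⊆ A ⊎ Cylinder ρ ⊆ ∁ A → P ρ
    leaf ρ (inj₁ inside)  = inside-leaf ρ inside
    leaf ρ (inj₂ outside) = outside-leaf ρ outside
    barred : ∀ x → ∃[ n ] P (prefix x n)
    barred x = let (n , decided) = clopen-decides A-clopen x in n , leaf (prefix x n) decided

  -- Since μ is full, no point of A lies between two levels at which F A agrees.
  F-reflects : ∀ {A c d x} → IsOpen A → c ∈ V → d ∈ V → F A c ≤ F A d → x ∈ A → x ∈ Above d → x ∈ Above c
  F-reflects {A} {c} {d} {x} A-open c∈V d∈V Fc≤Fd x∈A above-d = ¬below⇒above c∈V λ below-c →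
    <⇒≱ (μ-positive {gap} gap-open ((x∈A , below-c) , above-d))
      (infer (F A c ∷ F A d ∷ μ ((A ∩ Below c) ∩ Below d) ∷ μ gap ∷ [])
        (λ Fc Fd a g → Fc :≤ Fd ∷ Fd :≤ a ∷ a :+ g :≤ Fc ∷ [] ⊢≤ g :≤ :0) ≡.refl
        Fc≤Fd (μ-mono λ { (y∈A , y<d) → (y∈A , below-mono (d≤c below-c) y<d) , y<d })
        (≤-reflexive (sym (split-at d∈V (A ∩ Below c)))))
    where
    gap : Pred Cantor 0ℓ
    gap = (A ∩ Below c) ∩ Above d
    gap-open : IsOpen gap
    gap-open = open-∩ (open-∩ A-open (below-open c)) (above-open d)
    d≤c : x ∈ Below c → d ≤ c
    d≤c below-c = ≰⇒≥ λ c≤d → below-⊥-above below-c (above-mono c≤d above-d)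

  -- The point of B with the same position as x in A: it lies above c exactly
  -- when x lies above some d with F A d at least F B c.
  side : Pred Cantor 0ℓ → Pred Cantor 0ℓ → Cantor → Carrier → Bool
  side A B x c = truth (∃[ d ] (d ∈ V × F B c ≤ F A d × x ∈ Above d))

  abstract
    transport : Pred Cantor 0ℓ → Pred Cantor 0ℓ → Cantor → Cantor
    transport A B x = Cut.point (side A B x)

  module Transport {A B} (A-clopen : IsClopen A) (B-clopen : IsClopen B) (μA≈μB : μ A ≈ μ B) where

    private
      A-open = clopen-open A-clopen

      side-0 : ∀ x → side A B x 0# ≡ true
      side-0 x = truth-true (0# , 0∈V , ≤-reflexive (trans F-0 (sym F-0)) , above-0 x)

      side-1 : ∀ {x} → x ∈ A → side A B x 1# ≡ false
      side-1 {x} x∈A = truth-false λ { (d , d∈V , p , above) → below-⊥-above (below-1 x)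
        (F-reflects A-open 1∈V d∈V (≤-respˡ (trans F-1 (trans (sym μA≈μB) (sym F-1))) p) x∈A above) }

      side-antitone : ∀ {x c c′} → c ∈ V → c′ ∈ V → c ≤ c′ → side A B x c′ ≡ true → side A B x c ≡ true
      side-antitone _ _ c≤c′ e =
        let (d , d∈V , p , above) = true-truth e in truth-true (d , d∈V , ≤-trans (F-mono c≤c′) p , above)

    abstract
      -- The cut of `A` that is matched with the cut `c` of `B`. It need not be unique, since `F A`
      -- is flat off `A`; therefore `above⇒` and `above⇐` admit every `d` with the right value.
      level : ∀ {c} → c ∈ V → ∃[ d ] (d ∈ V × F A d ≈ F B c)
      level {c} c∈V = F-surjective A-clopen (μ∈G (clopen-∩ B-clopen (below-clopen c∈V))) (μ-nonneg _)
        (≤-respʳ (sym μA≈μB) (μ-mono proj₁))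

      above⇒ : ∀ {x} → x ∈ A → ∀ {c d} → c ∈ V → d ∈ V → F A d ≈ F B c → x ∈ Above d → transport A B x ∈ Above c
      above⇒ {x} x∈A c∈V d∈V e above = Cut.point-above (side A B x) (side-0 x) (side-1 x∈A) side-antitone c∈V
        (truth-true (_ , d∈V , ≤-reflexive (sym e) , above))

      above⇐ : ∀ {x} → x ∈ A → ∀ {c d} → c ∈ V → d ∈ V → F A d ≈ F B c → transport A B x ∈ Above c → x ∈ Above d
      above⇐ {x} x∈A c∈V d∈V e above =
        let (d′ , d′∈V , p , above′) = true-truth
              (Cut.above-point (side A B x) (side-0 x) (side-1 x∈A) side-antitone c∈V above)
        in F-reflects A-open d∈V d′∈V (≤-respˡ (sym e) p) x∈A above′

    below⇒ : ∀ {x} → x ∈ A → ∀ {c d} → c ∈ V → d ∈ V → F A d ≈ F B c → x ∈ Below d → transport A B x ∈ Below c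
    below⇒ x∈A c∈V d∈V e below = ¬above⇒below c∈V λ above → below-⊥-above below (above⇐ x∈A c∈V d∈V e above)

    -- On a cylinder that misses `B` the function `F B` is constant, so both endpoints have the same
    -- level in `A`. An image above the left endpoint would then be above the right one as well.
    transport∈B : ∀ {x} → x ∈ A → transport A B x ∈ B
    transport∈B {x} x∈A = by-contradiction λ y∉B →
      let (n , outside) = open⇒cylinder (proj₂ B-clopen) y∉B in absurd (prefix y n) (prefix∈Cylinder y n) outside
      where
      y = transport A B x
      absurd : ∀ ρ → y ∈ Cylinder ρ → ¬ Cylinder ρ ⊆ ∁ B
      absurd ρ y∈ρ outside =
        let c∈V = Interval.lo∈V (node ρ)
            c′∈V = Interval.hi∈V (node ρ)
            (d , d∈V , e) = level c∈V
            (d′ , d′∈V , e′) = level c′∈V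
            above-d = above⇐ x∈A c∈V d∈V e (cylinder-above ρ y∈ρ)
            above-d′ = F-reflects A-open d′∈V d∈V (≤-respˡ (sym e′) (≤-respʳ (sym e) flat)) x∈A above-d
        in below-⊥-above (cylinder-below ρ y∈ρ) (above⇒ x∈A c′∈V d′∈V e′ above-d′)
        where
        flat : F B (right ρ) ≤ F B (left ρ)
        flat = μ-mono λ { (z∈B , z<) → z∈B , ¬above⇒below (Interval.lo∈V (node ρ))
          λ above → outside (between⇒cylinder ρ above z<) z∈B }

    -- Given the earlier letters of the image, the next one depends only on the side of a single
    -- level in `V` on which `x` lies, and that is locally constant.
    transport-modulus : ∀ {x} → x ∈ A → ∀ n → ∃[ k ] (∀ y → y ∈ A → Agree k x y →
                        prefix (transport A B x) n ≡ prefix (transport A B y) n)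
    transport-modulus x∈A zero = 0 , λ _ _ _ → ≡.refl
    transport-modulus {x} x∈A (suc n) = extend (transport-modulus x∈A n)
      where
      ρ = prefix (transport A B x) n
      letter : ∃[ k ] (∀ y → y ∈ A → Agree k x y → ρ ≡ prefix (transport A B y) n → transport A B x n ≡ transport A B y n)
      letter =
        let (d , d∈V , e) = level (mid∈V ρ) in
        [ (λ below → let (k , stable) = below-open d below in k , λ y y∈A a same →
             ≡.trans (below-letter n (below⇒ x∈A (mid∈V ρ) d∈V e below)) (≡.sym (below-letter n
               (≡.subst (λ σ → transport A B y ∈ Below (mid σ)) same (below⇒ y∈A (mid∈V ρ) d∈V e (stable y a))))))
        , (λ above → let (k , stable) = above-open d above in k , λ y y∈A a same →
             ≡.trans (above-letter n (above⇒ x∈A (mid∈V ρ) d∈V e above)) (≡.sym (above-letter n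
               (≡.subst (λ σ → transport A B y ∈ Above (mid σ)) same (above⇒ y∈A (mid∈V ρ) d∈V e (stable y a))))))
        ]′ (below-or-above d∈V x)
      extend : ∃[ k ] (∀ y → y ∈ A → Agree k x y → ρ ≡ prefix (transport A B y) n) →
               ∃[ k ] (∀ y → y ∈ A → Agree k x y →
                 transport A B x n ∷ ρ ≡ transport A B y n ∷ prefix (transport A B y) n)
      extend (k , same) = let (l , p) = letter in k ℕ.⊔ l , λ y y∈A a →
        let same-y = same y y∈A (agree-≤ (ℕ.m≤m⊔n k l) a)
        in ≡.cong₂ _∷_ (p y y∈A (agree-≤ (ℕ.m≤n⊔m k l) a) same-y) same-y

    -- The part of A that is carried into a given cylinder.
    source : Word → Pred Cantor 0ℓ
    source ρ = (A ∩ Below (proj₁ (level (Interval.hi∈V (node ρ))))) ∩ Above (proj₁ (level (Interval.lo∈V (node ρ))))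

    source-open : ∀ ρ → IsOpen (source ρ)
    source-open ρ = open-∩ (open-∩ A-open (below-open _)) (above-open _)

    source⊆A : ∀ ρ → source ρ ⊆ A
    source⊆A ρ = proj₁ ∘ proj₁

    source-transport : ∀ {x} ρ → x ∈ source ρ → transport A B x ∈ Cylinder ρ
    source-transport ρ ((x∈A , below) , above) =
      let (_ , c∈V , e) = level (Interval.lo∈V (node ρ))
          (_ , d∈V , e′) = level (Interval.hi∈V (node ρ))
      in between⇒cylinder ρ (above⇒ x∈A (Interval.lo∈V (node ρ)) c∈V e above)
                            (below⇒ x∈A (Interval.hi∈V (node ρ)) d∈V e′ below)

    -- The increment of `F B` over the interval of `ρ` equals the increment of `F A` between the
    -- matching levels.
    μ-source : ∀ ρ → μ (Cylinder ρ ∩ B) ≤ μ (source ρ)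
    μ-source ρ = infer
      (F B (left ρ) ∷ F B (right ρ) ∷ F A c ∷ F A d ∷ μ ((B ∩ Below (right ρ)) ∩ Below (left ρ)) ∷
       μ ((B ∩ Below (right ρ)) ∩ Above (left ρ)) ∷ μ ((A ∩ Below d) ∩ Below c) ∷ μ (Cylinder ρ ∩ B) ∷ μ (source ρ) ∷ [])
      (λ Bl Br Ac Ad Brl Br-l Adc t s → Bl :≤ Brl ∷ t :≤ Br-l ∷ Brl :+ Br-l :≤ Br ∷ Ac :≤ Bl ∷ Br :≤ Ad ∷
         Ad :≤ Adc :+ s ∷ Adc :≤ Ac ∷ [] ⊢≤ t :≤ s) ≡.refl
      (μ-mono λ { (x∈B , below) → (x∈B , below-mono (proj₁ (Interval.lo<hi (node ρ))) below) , below })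
      (μ-mono λ { (x∈ρ , x∈B) → (x∈B , cylinder-below ρ x∈ρ) , cylinder-above ρ x∈ρ })
      (≤-reflexive (sym (split-at (Interval.lo∈V (node ρ)) (B ∩ Below (right ρ)))))
      (≤-reflexive (proj₂ (proj₂ (level (Interval.lo∈V (node ρ))))))
      (≤-reflexive (sym (proj₂ (proj₂ (level (Interval.hi∈V (node ρ)))))))
      (≤-reflexive (split-at (proj₁ (proj₂ (level (Interval.lo∈V (node ρ))))) (A ∩ Below d)))
      (μ-mono λ { ((x∈A , _) , below) → x∈A , below })
      where
      c d : Carrier
      c = proj₁ (level (Interval.lo∈V (node ρ)))
      d = proj₁ (level (Interval.hi∈V (node ρ)))

  module Inverse-transport {A B} (A-clopen : IsClopen A) (B-clopen : IsClopen B) (μA≈μB : μ A ≈ μ B) where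
    private
      module AB = Transport A-clopen B-clopen μA≈μB
      module BA = Transport B-clopen A-clopen (sym μA≈μB)

    -- If `d` is a level for `c` on the way back, then `c` is a level for `d` on the way out, so `x`
    -- returns to the side of `c` it started from, for every `c` in `V`.
    transport-inverse : ∀ {x} → x ∈ A → transport B A (transport A B x) ≗ x
    transport-inverse {x} x∈A = sides-determine back forth
      where
      y∈B = AB.transport∈B x∈A
      back : ∀ {c} → c ∈ V → transport B A (transport A B x) ∈ Above c → x ∈ Above c
      back c∈V above = let (d , d∈V , e) = BA.level c∈V in
        AB.above⇐ x∈A d∈V c∈V (sym e) (BA.above⇐ y∈B c∈V d∈V e above)
      forth : ∀ {c} → c ∈ V → x ∈ Above c → transport B A (transport A B x) ∈ Above c
      forth c∈V above = let (d , d∈V , e) = BA.level c∈V in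
        BA.above⇒ y∈B c∈V d∈V e (AB.above⇒ x∈A d∈V c∈V (sym e) above)

-- Ultrahomogeneity, clopen values, fullness and maximality of the measure.

module Existence (em : ∀ {ℓ} → ExcludedMiddle ℓ) (ℝ : CompleteOrderedField)
  (V : Pred (CompleteOrderedField.Carrier ℝ) 0ℓ) (groupLike : Theory.GroupLike ℝ V)
  where

  open Classical em
  open OrderedField em ℝ
  open Intervals em ℝ V groupLike
  open Homogeneity em ℝ V groupLike
  open Theory ℝ using (IsFull; IsMaximal; IsUltrahomogeneous; IsPreservedBy; ClopenValues)
  open ClopenPartition

  module Glue {k l} (P : ClopenPartition k) (R : ClopenPartition l) (f : Fin k ↔ Fin l)
              (same-μ : ∀ i → μ (part P i) ≈ μ (part R (Inverse.to f i))) where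

    private
      f→ = Inverse.to f
      module T (i : Fin k) = Transport (clopen P i) (clopen R (f→ i)) (same-μ i)

    glue : Cantor → Cantor
    glue x = let (i , _) = cover P x in transport (part P i) (part R (f→ i)) x

    part-unique : ∀ {n} (Q : ClopenPartition n) {x i j} → x ∈ part Q i → x ∈ part Q j → i ≡ j
    part-unique Q {x} {i} {j} x∈i x∈j with i Fin.≟ j
    ... | yes e = e
    ... | no ne = contradiction (x∈i , x∈j) (disjoint Q ne)

    glue-part : ∀ {x i} → x ∈ part P i → glue x ≡ transport (part P i) (part R (f→ i)) x
    glue-part {x} x∈i = ≡.cong (λ i → transport (part P i) (part R (f→ i)) x) (part-unique P (proj₂ (cover P x)) x∈i)

    glue∈ : ∀ {x i} → x ∈ part P i → glue x ∈ part R (f→ i)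
    glue∈ {i = i} x∈i = ≡.subst (_∈ part R (f→ i)) (≡.sym (glue-part x∈i)) (T.transport∈B i x∈i)

    glue-modulus : ∀ x n → ∃[ k ] (∀ y → Agree k x y → Agree n (glue x) (glue y))
    glue-modulus x n =
      let (i , x∈i) = cover P x
          (k , stays) = proj₁ (clopen P i) x∈i
          (l , same) = T.transport-modulus i x∈i n
      in k ℕ.⊔ l , λ y a → let y∈i = stays y (agree-≤ (ℕ.m≤m⊔n k l) a) in
         prefix⇒agree n (≡.trans (same y y∈i (agree-≤ (ℕ.m≤n⊔m k l) a))
           (≡.cong (λ z → prefix z n) (≡.sym (glue-part y∈i))))

    glue-continuous : IsContinuous glue
    glue-continuous O-open {x} gx∈O =
      let (n , inside) = O-open gx∈O
          (k , near) = glue-modulus x n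
      in k , λ y a → inside (glue y) (near y a)

    glue-cong : ∀ {x y} → x ≗ y → glue x ≗ glue y
    glue-cong {x} {y} x≗y n = let (k , near) = glue-modulus x (suc n) in near y (λ i _ → x≗y i) n ℕ.≤-refl

    -- The parts of `R` cut the cylinder into pieces. Each piece is no heavier than its source, and
    -- the sources are disjoint subsets of the preimage.
    m≤μ-glue : ∀ ρ → m ρ ≤ μ (glue ⊢ Cylinder ρ)
    m≤μ-glue ρ = ≤-trans (≤-reflexive (sym (μ-cylinder ρ)))
      (≤-trans (μ-cover (λ i → Cylinder ρ ∩ part R (f→ i)) (Cylinder ρ) covered)
        (≤-trans (sum-mono (λ i → T.μ-source i ρ))
          (μ-superadditive (λ i → T.source i ρ) (λ i → measurable-open (T.source-open i ρ))
            (λ i≢j → λ { (x∈i , x∈j) → disjoint P i≢j (T.source⊆A _ ρ x∈i , T.source⊆A _ ρ x∈j) })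
            (glue ⊢ Cylinder ρ) λ i x∈ → ≡.subst (_∈ Cylinder ρ) (≡.sym (glue-part (T.source⊆A i ρ x∈)))
              (T.source-transport i ρ x∈))))
      where
      covered : ∀ x → x ∈ Cylinder ρ → ∃[ i ] x ∈ (Cylinder ρ ∩ part R (f→ i))
      covered x x∈ = let (j , x∈j) = cover R x in Inverse.from f j , x∈ ,
        ≡.subst (λ j → x ∈ part R j) (≡.sym (Inverse.strictlyInverseˡ f j)) x∈j

  ultrahomogeneous : IsUltrahomogeneous measure
  ultrahomogeneous P R f same-μ = φ , preserved , λ i → image⊆ i , image⊇ i
    where
    same-μ′ : ∀ j → μ (part R j) ≈ μ (part P (Inverse.from f j))
    same-μ′ j = trans (reflexive (≡.cong (μ ∘ part R) (≡.sym (Inverse.strictlyInverseˡ f j)))) (sym (same-μ (Inverse.from f j)))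
    module To   = Glue P R f same-μ
    module From = Glue R P (Symmetry.↔-sym f) same-μ′
    from-to : ∀ x → From.glue (To.glue x) ≗ x
    from-to x n = let (i , x∈i) = cover P x in
      ≡.trans (≡.cong-app (From.glue-part (To.glue∈ x∈i)) n)
        (≡.trans (≡.cong (λ j → transport (part R (Inverse.to f i)) (part P j) (To.glue x) n) (Inverse.strictlyInverseʳ f i))
          (Inverse-transport.transport-inverse (clopen P i) (clopen R (Inverse.to f i)) (same-μ i) x∈i n))
    to-from : ∀ y → To.glue (From.glue y) ≗ y
    to-from y n = let (j , y∈j) = cover R y in
      ≡.trans (≡.cong-app (To.glue-part (From.glue∈ y∈j)) n)
        (≡.trans (≡.cong (λ i → transport (part P (Inverse.from f j)) (part R i) (From.glue y) n) (Inverse.strictlyInverseˡ f j))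
          (Inverse-transport.transport-inverse (clopen R j) (clopen P (Inverse.from f j)) (same-μ′ j) y∈j n))
    φ : Homeomorphism
    φ = record
      { inverse = record
        { to        = To.glue
        ; from      = From.glue
        ; to-cong   = To.glue-cong
        ; from-cong = From.glue-cong
        ; inverse   = (λ {y} {x} e n → ≡.trans (To.glue-cong e n) (to-from y n))
                    , (λ {x} {y} e n → ≡.trans (From.glue-cong e n) (from-to x n))
        }
      ; to-continuous   = To.glue-continuous
      ; from-continuous = From.glue-continuous
      }
    preserved : IsPreservedBy measure φ
    -- Both inequalities are instances of `μ-preimage≤`. The second is applied to the preimage of
    -- `A` under `To.glue`: pulling it back further along `From.glue` gives a set that contains `A`,
    -- as `A` respects `_≗_`.
    preserved (A , A-borel) = ≤-antisym
      (μ-preimage≤ (λ ρ → From.glue-continuous (cylinder-open ρ)) From.m≤μ-glue To.glue-continuous to-from A)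
      (≤-trans (μ-mono λ {x} x∈A → borel-respects A-borel (λ n → ≡.sym (to-from x n)) x∈A)
        (μ-preimage≤ (λ ρ → To.glue-continuous (cylinder-open ρ)) To.m≤μ-glue From.glue-continuous from-to (To.glue ⊢ A)))
    image⊆ : ∀ i → Homeomorphism.image φ (part P i) ⊆ part R (Inverse.to f i)
    image⊆ i (x , x∈i , e) = open-respects (proj₁ (clopen R (Inverse.to f i))) e (To.glue∈ x∈i)
    image⊇ : ∀ i → part R (Inverse.to f i) ⊆ Homeomorphism.image φ (part P i)
    image⊇ i {y} y∈ = From.glue y ,
      ≡.subst (λ j → From.glue y ∈ part P j) (Inverse.strictlyInverseʳ f i) (From.glue∈ y∈) , to-from y

  -- The left end of the i-th of consecutive intervals of lengths `w`, the first beginning at `a`.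
  start : ∀ {n} → Carrier → (Fin n → Carrier) → Fin n → Carrier
  start a w zero    = a
  start a w (suc i) = start (a + w zero) (w ∘ suc) i

  block : ∀ {n} → Carrier → (Fin n → Carrier) → Fin n → Pred Cantor 0ℓ
  block a w i = Above (start a w i) ∩ Below (start a w i + w i)

  start-bounds : ∀ {n} a (w : Fin n → Carrier) → (∀ i → 0# ≤ w i) → ∀ i → a ≤ start a w i × start a w i + w i ≤ a + sum w
  start-bounds a w w≥0 zero = ≤-refl ,
    infer (a ∷ w zero ∷ sum (w ∘ suc) ∷ []) (λ a x s → :0 :≤ s ∷ [] ⊢≤ a :+ x :≤ a :+ (x :+ s)) ≡.refl
      (sum-nonneg (w≥0 ∘ suc))
  start-bounds a w w≥0 (suc i) = let (p , q) = start-bounds (a + w zero) (w ∘ suc) (w≥0 ∘ suc) i in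
    infer (a ∷ w zero ∷ start a w (suc i) ∷ []) (λ a x s → :0 :≤ x ∷ a :+ x :≤ s ∷ [] ⊢≤ a :≤ s) ≡.refl (w≥0 zero) p ,
    ≤-respʳ (+-assoc _ _ _) q

  start∈G : ∀ {n} {a} → a ∈ G → (w : Fin n → Carrier) → (∀ i → w i ∈ G) → ∀ i → start a w i ∈ G
  start∈G a∈G w w∈G zero    = a∈G
  start∈G a∈G w w∈G (suc i) = start∈G (+-closed a∈G (w∈G zero)) (w ∘ suc) (w∈G ∘ suc) i

  block-disjoint : ∀ {n} a (w : Fin n → Carrier) → (∀ i → 0# ≤ w i) → ∀ {i j} → i ≢ j → block a w i ⊥ block a w j
  block-disjoint a w w≥0 {zero}  {zero}  i≢j _ = i≢j ≡.refl
  block-disjoint a w w≥0 {zero}  {suc j} _ ((_ , below) , (above , _)) =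
    below-⊥-above below (above-mono (proj₁ (start-bounds (a + w zero) (w ∘ suc) (w≥0 ∘ suc) j)) above)
  block-disjoint a w w≥0 {suc i} {zero}  _ ((above , _) , (_ , below)) =
    below-⊥-above below (above-mono (proj₁ (start-bounds (a + w zero) (w ∘ suc) (w≥0 ∘ suc) i)) above)
  block-disjoint a w w≥0 {suc i} {suc j} i≢j = block-disjoint (a + w zero) (w ∘ suc) (w≥0 ∘ suc) (i≢j ∘ ≡.cong suc)

  block-cover : ∀ {n} a (w : Fin n → Carrier) → (∀ i → 0# ≤ w i) → (∀ i → start a w i + w i ∈ V) →
                ∀ x → x ∈ Above a → x ∈ Below (a + sum w) → ∃[ i ] x ∈ block a w i
  block-cover {zero}  a w w≥0 w∈V x above below =
    contradiction above (below-⊥-above (below-mono (≤-reflexive (+-identityʳ a)) below))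
  block-cover {suc n} a w w≥0 w∈V x above below =
    [ (λ below₀ → zero , above , below₀)
    , (λ above₀ → let (i , x∈) = block-cover (a + w zero) (w ∘ suc) (w≥0 ∘ suc) (w∈V ∘ suc) x above₀
                                   (below-mono (≤-reflexive (sym (+-assoc _ _ _))) below)
                  in suc i , x∈)
    ]′ (below-or-above (w∈V zero) x)

  -- The unit interval is cut into consecutive blocks of lengths `w i`. Their endpoints are partial
  -- sums, hence in `G` and in [0,1], hence in `V`.
  realise : ∀ {n} (w : Fin n → Carrier) → (∀ i → w i ∈ G) → (∀ i → 0# < w i) → sum w ≈ 1# →
            Σ[ P ∈ ClopenPartition n ] (∀ i → μ (part P i) ≈ w i)
  realise {n} w w∈G w>0 sum≈1 = record
    { part     = block 0# w
    ; clopen   = λ i → clopen-∩ (above-clopen (s∈V i)) (below-clopen (e∈V i))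
    ; nonempty = λ i → μ-inhabited (<-≤-trans (w>0 i) (≤-reflexive (sym (μ-block i))))
    ; disjoint = block-disjoint 0# w w≥0
    ; cover    = λ x → block-cover 0# w w≥0 e∈V x (above-0 x) (below-mono 1≤total (below-1 x))
    } , μ-block
    where
    w≥0 : ∀ i → 0# ≤ w i
    w≥0 = proj₁ ∘ w>0
    total≈1 : 0# + sum w ≈ 1#
    total≈1 = trans (+-identityˡ _) sum≈1
    1≤total : 1# ≤ 0# + sum w
    1≤total = ≤-reflexive (sym total≈1)
    s∈G : ∀ i → start 0# w i ∈ G
    s∈G = start∈G 0-closed w w∈G
    0≤s : ∀ i → 0# ≤ start 0# w i
    0≤s i = proj₁ (start-bounds 0# w w≥0 i)
    e≤1 : ∀ i → start 0# w i + w i ≤ 1#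
    e≤1 i = ≤-respʳ total≈1 (proj₂ (start-bounds 0# w w≥0 i))
    s≤e : ∀ i → start 0# w i ≤ start 0# w i + w i
    s≤e i = infer (start 0# w i ∷ w i ∷ []) (λ s x → :0 :≤ x ∷ [] ⊢≤ s :≤ s :+ x) ≡.refl (w≥0 i)
    s∈V : ∀ i → start 0# w i ∈ V
    s∈V i = G∩[0,1]⊆V (s∈G i) (0≤s i) (≤-trans (s≤e i) (e≤1 i))
    e∈V : ∀ i → start 0# w i + w i ∈ V
    e∈V i = G∩[0,1]⊆V (+-closed (s∈G i) (w∈G i)) (≤-trans (0≤s i) (s≤e i)) (e≤1 i)
    μ-block : ∀ i → μ (block 0# w i) ≈ w i
    μ-block i = trans (μ-between (s∈V i) (e∈V i) (s≤e i))
      (solve (start 0# w i ∷ w i ∷ []) (λ s x → s :+ x :- s := x) ≡.refl)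

  clopenValues≐V : ClopenValues measure ≐ V
  clopenValues≐V = (λ { ((A , A-clopen) , e) → respects (sym e) (μ∈V A-clopen) })
                 , (λ {c} c∈V → (Below c , below-clopen c∈V) , sym (μ-below c∈V))

  full : IsFull measure
  full (A , A-open) (x , x∈A) = μ-positive A-open x∈A

  maximal : IsMaximal measure
  maximal = record
    { realises   = λ w w∈ w≉0 sum≈1 → realise w (V⊆G ∘ V∋ w∈) (λ i → 0≤V (V∋ w∈ i) , w≉0 i ∘ sym) sum≈1
    ; difference = λ {a} {b} a∈ b∈ → proj₂ clopenValues≐V (difference∈V (proj₁ clopenValues≐V a∈) (proj₁ clopenValues≐V b∈))
    }
    where
    V∋ : ∀ {n} {w : Fin n → Carrier} → (∀ i → w i ∈ ClopenValues measure) → ∀ i → w i ∈ V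
    V∋ w∈ i = proj₁ clopenValues≐V (w∈ i)
    difference∈V : ∀ {a b} → a ∈ V → b ∈ V → ∣ a - b ∣ ∈ V
    difference∈V {a} {b} a∈V b∈V =
      [ (λ { (0≤x , e) → ≡.subst V (≡.sym e) (G∩[0,1]⊆V a-b∈G 0≤x
           (infer (a ∷ b ∷ 1# ∷ []) (λ a b i → a :≤ i ∷ :0 :≤ b ∷ [] ⊢≤ a :- b :≤ i) ≡.refl (V≤1 a∈V) (0≤V b∈V))) })
      , (λ { (x≤0 , e) → ≡.subst V (≡.sym e) (G∩[0,1]⊆V (-‿closed a-b∈G)
           (infer (a ∷ b ∷ []) (λ a b → a :- b :≤ :0 ∷ [] ⊢≤ :0 :≤ :- (a :- b)) ≡.refl x≤0)
           (infer (a ∷ b ∷ 1# ∷ []) (λ a b i → b :≤ i ∷ :0 :≤ a ∷ [] ⊢≤ :- (a :- b) :≤ i) ≡.refl (V≤1 b∈V) (0≤V a∈V))) })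
      ]′ (abs-cases (a - b))
      where
      a-b∈G : a - b ∈ G
      a-b∈G = G-difference (V⊆G a∈V) (V⊆G b∈V)

-- Couplings, directedness and amalgamation.

prepend : ∀ {a} {A : Set a} {n} → A → (Fin n → A) → Fin (suc n) → A
prepend x f zero    = x
prepend x f (suc i) = f i

module Amalgamation (em : ∀ {ℓ} → ExcludedMiddle ℓ) (ℝ : CompleteOrderedField)
  (V : Pred (CompleteOrderedField.Carrier ℝ) 0ℓ) (groupLike : Theory.GroupLike ℝ V)
  where

  open Classical em
  open OrderedField em ℝ
  open Intervals em ℝ V groupLike using (G; V⊆G; G-difference; G∩[0,1]⊆V; 0-closed; +-closed)
  open Existence em ℝ V groupLike using (realise)
  open Theory ℝ using (Object; module Object; Morphism; module Morphism; ∑-fibre; ∑-fibre-id; 𝓕)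

  restrict : Bool → Carrier → Carrier
  restrict b a = if b then a else 0#

  restrict-nonneg : ∀ b {a} → 0# ≤ a → 0# ≤ restrict b a
  restrict-nonneg true  p = p
  restrict-nonneg false p = ≤-refl

  restrict-cong : ∀ b {a a′} → a ≈ a′ → restrict b a ≈ restrict b a′
  restrict-cong true  e = e
  restrict-cong false e = refl

  restrict-+ : ∀ b {a a′} → restrict b (a + a′) ≈ restrict b a + restrict b a′
  restrict-+ true  = refl
  restrict-+ false = sym (+-identityˡ 0#)

  restrict-sum : ∀ b {n} (f : Fin n → Carrier) → restrict b (sum f) ≈ ∑[ i < n ] restrict b (f i)
  restrict-sum true  f = refl
  restrict-sum false {n} f = sym (sum-replicate-zero n)

  restrict-≟ : ∀ {n} {i x : Fin n} a → i ≡ x → restrict (does (i Fin.≟ x)) a ≡ a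
  restrict-≟ {i = i} {x} a e with i Fin.≟ x
  ... | yes _ = ≡.refl
  ... | no ne = contradiction e ne

  restrict-≢ : ∀ {n} {i x : Fin n} a → i ≢ x → restrict (does (i Fin.≟ x)) a ≡ 0#
  restrict-≢ {i = i} {x} a ne with i Fin.≟ x
  ... | yes e = contradiction e ne
  ... | no _  = ≡.refl

  Carved : ∀ {n} → (Fin n → Bool) → (Fin n → Carrier) → (Fin n → Carrier) → Set
  Carved q ν h = ∀ j → h j ∈ G × 0# ≤ h j × h j ≤ ν j × (q j ≡ false → h j ≈ 0#)

  carve : ∀ {n} (q : Fin n → Bool) (ν : Fin n → Carrier) → (∀ j → ν j ∈ G) → (∀ j → 0# ≤ ν j) →
          ∀ {t} → t ∈ G → 0# ≤ t → t ≤ ∑[ j < n ] restrict (q j) (ν j) → ∃[ h ] (Carved q ν h × sum h ≈ t)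
  carve {zero} q ν ν∈G ν≥0 t∈G 0≤t t≤ = (λ ()) , (λ ()) , ≤-antisym 0≤t t≤
  carve {suc n} q ν ν∈G ν≥0 {t} t∈G 0≤t t≤ with q zero in e
  ... | false =
    let (h , carved , h-sum) = carve (q ∘ suc) (ν ∘ suc) (ν∈G ∘ suc) (ν≥0 ∘ suc) t∈G 0≤t (≤-respʳ (+-identityˡ _) t≤)
    in prepend 0# h , (λ { zero → 0-closed , ≤-refl , ν≥0 zero , (λ _ → refl) ; (suc j) → carved j })
       , trans (+-identityˡ _) h-sum
  ... | true = [ small-t , large-t ]′ (total t (ν zero))
    where
    rest : Carrier
    rest = ∑[ j < n ] restrict (q (suc j)) (ν (suc j))
    not-false : ∀ {a} → q zero ≡ false → a ≈ 0#
    not-false e′ = contradiction (≡.trans (≡.sym e) e′) λ ()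
    small-t : t ≤ ν zero → ∃[ h ] (Carved q ν h × sum h ≈ t)
    small-t t≤ν =
      let (h , carved , h-sum) = carve (q ∘ suc) (ν ∘ suc) (ν∈G ∘ suc) (ν≥0 ∘ suc) 0-closed ≤-refl
            (sum-nonneg {n} λ j → restrict-nonneg (q (suc j)) (ν≥0 (suc j)))
      in prepend t h , (λ { zero → t∈G , 0≤t , t≤ν , not-false ; (suc j) → carved j })
         , trans (+-congˡ h-sum) (+-identityʳ t)
    large-t : ν zero ≤ t → ∃[ h ] (Carved q ν h × sum h ≈ t)
    large-t ν≤t =
      let (h , carved , h-sum) = carve (q ∘ suc) (ν ∘ suc) (ν∈G ∘ suc) (ν≥0 ∘ suc) (G-difference t∈G (ν∈G zero))
            (infer (ν zero ∷ t ∷ []) (λ a t → a :≤ t ∷ [] ⊢≤ :0 :≤ t :- a) ≡.refl ν≤t)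
            (infer (ν zero ∷ t ∷ rest ∷ []) (λ a t r → t :≤ a :+ r ∷ [] ⊢≤ t :- a :≤ r) ≡.refl t≤)
      in prepend (ν zero) h , (λ { zero → ν∈G zero , ν≥0 zero , ≤-refl , not-false ; (suc j) → carved j })
         , trans (+-congˡ h-sum) (solve (ν zero ∷ t ∷ []) (λ a t → a :+ (t :- a) := t) ≡.refl)

  record Coupling {k m n} (r₀ : Fin m → Fin k) (μ : Fin m → Carrier)
                  (r₁ : Fin n → Fin k) (ν : Fin n → Carrier) : Set where
    field
      h        : Fin m → Fin n → Carrier
      h∈G      : ∀ i j → h i j ∈ G
      h≥0      : ∀ i j → 0# ≤ h i j
      support  : ∀ i j → r₀ i ≢ r₁ j → h i j ≈ 0#
      row-sum  : ∀ i → ∑[ j < n ] h i j ≈ μ i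
      col-sum  : ∀ j → ∑[ i < m ] h i j ≈ ν j

  fibre-split : ∀ {n k} (r : Fin n → Fin k) x (f g : Fin n → Carrier) →
                ∑-fibre r x (λ j → f j + g j) ≈ ∑-fibre r x f + ∑-fibre r x g
  fibre-split {n} r x f g = trans (sum-cong-≋ {n} (λ j → restrict-+ (does (r j Fin.≟ x)))) (∑-distrib-+ {n} _ _)

  -- The northwest corner rule, fibre by fibre: the first row is carved out of the columns over the
  -- same point, which suffice by `balanced`, and is subtracted from them. Rows and columns stay
  -- balanced over each point, so the induction continues.
  couple : ∀ {k m n} (r₀ : Fin m → Fin k) (μ : Fin m → Carrier) (r₁ : Fin n → Fin k) (ν : Fin n → Carrier) →
           (∀ i → μ i ∈ G) → (∀ i → 0# ≤ μ i) → (∀ j → ν j ∈ G) → (∀ j → 0# ≤ ν j) →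
           (∀ x → ∑-fibre r₀ x μ ≈ ∑-fibre r₁ x ν) → Coupling r₀ μ r₁ ν
  couple {m = zero} r₀ μ r₁ ν μ∈G μ≥0 ν∈G ν≥0 balanced = record
    { h = λ () ; h∈G = λ () ; h≥0 = λ () ; support = λ () ; row-sum = λ ()
    -- Without rows every fibre sum is zero, which forces the nonnegative `ν j` to vanish.
    ; col-sum = λ j → ≤-antisym (ν≥0 j) (≤-respˡ (reflexive (restrict-≟ {i = r₁ j} (ν j) ≡.refl))
        (≤-trans (term≤sum {f = λ l → restrict (does (r₁ l Fin.≟ r₁ j)) (ν l)} (λ l → restrict-nonneg (does (r₁ l Fin.≟ r₁ j)) (ν≥0 l)) j)
          (≤-reflexive (sym (balanced (r₁ j))))))
    }
  couple {m = suc m} {n} r₀ μ r₁ ν μ∈G μ≥0 ν∈G ν≥0 balanced = record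
    { h       = prepend h₀ (Coupling.h later)
    ; h∈G     = λ { zero j → proj₁ (carved j) ; (suc i) → Coupling.h∈G later i }
    ; h≥0     = λ { zero j → h₀≥0 j ; (suc i) → Coupling.h≥0 later i }
    ; support = λ { zero j ne → outside j (ne ∘ ≡.sym) ; (suc i) → Coupling.support later i }
    ; row-sum = λ { zero → proj₂ (proj₂ first) ; (suc i) → Coupling.row-sum later i }
    ; col-sum = λ j → trans (+-congˡ (Coupling.col-sum later j)) (sym (ν≈ j))
    }
    where
    q : Fin n → Bool
    q j = does (r₁ j Fin.≟ r₀ zero)
    first : ∃[ h ] (Carved q ν h × sum h ≈ μ zero)
    first = carve q ν ν∈G ν≥0 (μ∈G zero) (μ≥0 zero) (≤-respʳ (balanced (r₀ zero))
      (≤-respˡ (reflexive (restrict-≟ {i = r₀ zero} (μ zero) ≡.refl))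
        (term≤sum {f = λ i → restrict (does (r₀ i Fin.≟ r₀ zero)) (μ i)}
          (λ i → restrict-nonneg (does (r₀ i Fin.≟ r₀ zero)) (μ≥0 i)) zero)))
    h₀ : Fin n → Carrier
    h₀ = proj₁ first
    carved : Carved q ν h₀
    carved = proj₁ (proj₂ first)
    h₀≥0 : ∀ j → 0# ≤ h₀ j
    h₀≥0 j = proj₁ (proj₂ (carved j))
    outside : ∀ j → r₁ j ≢ r₀ zero → h₀ j ≈ 0#
    outside j ne = proj₂ (proj₂ (proj₂ (carved j))) (q-false (r₁ j Fin.≟ r₀ zero))
      where
      q-false : ∀ (d : Dec (r₁ j ≡ r₀ zero)) → does d ≡ false
      q-false (yes e) = contradiction e ne
      q-false (no _)  = ≡.refl
    ν′ : Fin n → Carrier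
    ν′ j = ν j - h₀ j
    ν≈ : ∀ j → ν j ≈ h₀ j + ν′ j
    ν≈ j = solve (ν j ∷ h₀ j ∷ []) (λ a b → a := b :+ (a :- b)) ≡.refl
    h₀-fibre : ∀ x → ∑-fibre r₁ x h₀ ≈ restrict (does (r₀ zero Fin.≟ x)) (μ zero)
    h₀-fibre x with r₀ zero Fin.≟ x
    ... | yes ≡.refl = trans (sum-cong-≋ inside) (proj₂ (proj₂ first))
      where
      inside : ∀ j → restrict (does (r₁ j Fin.≟ r₀ zero)) (h₀ j) ≈ h₀ j
      inside j with r₁ j Fin.≟ r₀ zero
      ... | yes _ = refl
      ... | no ne = sym (outside j ne)
    ... | no ne = sum-zero elsewhere
      where
      elsewhere : ∀ j → restrict (does (r₁ j Fin.≟ x)) (h₀ j) ≈ 0#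
      elsewhere j with r₁ j Fin.≟ x
      ... | yes e = outside j (λ e′ → ne (≡.trans (≡.sym e′) e))
      ... | no _  = refl
    balanced′ : ∀ x → ∑-fibre (r₀ ∘ suc) x (μ ∘ suc) ≈ ∑-fibre r₁ x ν′
    balanced′ x = cancelʳ (∑-fibre r₁ x h₀) (trans (+-comm _ _) (trans (+-congʳ (h₀-fibre x))
      (trans (balanced x) (trans (sum-cong-≋ λ j → restrict-cong (does (r₁ j Fin.≟ x)) (ν≈ j))
        (trans (fibre-split r₁ x h₀ ν′) (+-comm _ _))))))
    later : Coupling (r₀ ∘ suc) (μ ∘ suc) r₁ ν′
    later = couple (r₀ ∘ suc) (μ ∘ suc) r₁ ν′ (μ∈G ∘ suc) (μ≥0 ∘ suc)
      (λ j → G-difference (ν∈G j) (proj₁ (carved j)))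
      (λ j → infer (ν j ∷ h₀ j ∷ []) (λ a b → b :≤ a ∷ [] ⊢≤ :0 :≤ a :- b) ≡.refl (proj₁ (proj₂ (proj₂ (carved j)))))
      balanced′

  -- Objects have positive masses only, so cells of mass zero must be dropped. Quantifying over the
  -- tests `b` makes total, row and column sums instances of one statement.
  positive-part : ∀ {n} (w : Fin n → Carrier) → (∀ l → 0# ≤ w l) →
                  ∃[ k ] Σ[ e ∈ (Fin k → Fin n) ] ((∀ i → 0# < w (e i)) ×
                    (∀ (b : Fin n → Bool) → ∑[ i < k ] restrict (b (e i)) (w (e i)) ≈ ∑[ l < n ] restrict (b l) (w l)))
  positive-part {zero}  w w≥0 = 0 , (λ ()) , (λ ()) , λ _ → refl
  positive-part {suc n} w w≥0 =
    let (k , e , pos , sums) = positive-part (w ∘ suc) (w≥0 ∘ suc) in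
    [ (λ 0<w → suc k , prepend zero (suc ∘ e) , (λ { zero → 0<w ; (suc i) → pos i }) , λ b → +-congˡ (sums (b ∘ suc)))
    , (λ 0≈w → k , suc ∘ e , pos , λ b → trans (sums (b ∘ suc)) (sym (trans (+-congʳ (vanish (b zero) 0≈w)) (+-identityˡ _))))
    ]′ (≤⇒<⊎≈ (w≥0 zero))
    where
    vanish : ∀ b {a} → 0# ≈ a → restrict b a ≈ 0#
    vanish true  e = sym e
    vanish false e = refl

  sum-↑ : ∀ a {b} (f : Fin (a ℕ.+ b) → Carrier) → sum f ≈ ∑[ i < a ] f (i Fin.↑ˡ b) + ∑[ j < b ] f (a Fin.↑ʳ j)
  sum-↑ zero    f = sym (+-identityˡ _)
  sum-↑ (suc a) f = trans (+-congˡ (sum-↑ a (f ∘ suc))) (sym (+-assoc _ _ _))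

  sum-combine : ∀ m {n} (f : Fin (m ℕ.* n) → Carrier) → sum f ≈ ∑[ i < m ] ∑[ j < n ] f (Fin.combine i j)
  sum-combine zero        f = refl
  sum-combine (suc m) {n} f = trans (sum-↑ n f) (+-congˡ (sum-combine m (f ∘ (n Fin.↑ʳ_))))

  -- The fibre product reduced to the cells to which a coupling gives positive mass. With plain
  -- functions in place of morphisms to an object, directedness is the case of constant maps to one
  -- point.
  pullback : ∀ {k} (A B : Object V) (r₀ : Fin (Object.size A) → Fin k) (r₁ : Fin (Object.size B) → Fin k) →
             (∀ x → ∑-fibre r₀ x (Object.mass A) ≈ ∑-fibre r₁ x (Object.mass B)) →
             ∃[ C ] Σ[ s₀ ∈ Morphism V C A ] Σ[ s₁ ∈ Morphism V C B ]
               (∀ x → r₀ (Morphism.to s₀ x) ≡ r₁ (Morphism.to s₁ x))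
  pullback A B r₀ r₁ balanced = C , s₀ , s₁ , commutes
    where
    module A = Object A
    module B = Object B
    a = A.size
    b = B.size
    open Coupling (couple r₀ A.mass r₁ B.mass (V⊆G ∘ A.mass∈V) (proj₁ ∘ A.mass>0)
                     (V⊆G ∘ B.mass∈V) (proj₁ ∘ B.mass>0) balanced)
    w : Fin (a ℕ.* b) → Carrier
    w l = h (Fin.quotient b l) (Fin.remainder {a} b l)
    cells = positive-part w (λ l → h≥0 _ _)
    size = proj₁ cells
    cell : Fin size → Fin (a ℕ.* b)
    cell = proj₁ (proj₂ cells)
    mass : Fin size → Carrier
    mass i = w (cell i)
    mass>0 : ∀ i → 0# < mass i
    mass>0 = proj₁ (proj₂ (proj₂ cells))
    mass∈G : ∀ i → mass i ∈ G
    mass∈G i = h∈G _ _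
    to₀ : Fin size → Fin a
    to₀ i = Fin.quotient b (cell i)
    to₁ : Fin size → Fin b
    to₁ i = Fin.remainder {a} b (cell i)
    cell-sum : ∀ (q : Fin a → Fin b → Bool) →
               ∑[ i < size ] restrict (q (to₀ i) (to₁ i)) (mass i) ≈ ∑[ i < a ] ∑[ j < b ] restrict (q i j) (h i j)
    cell-sum q = trans (proj₂ (proj₂ (proj₂ cells)) (λ l → q (Fin.quotient b l) (Fin.remainder {a} b l)))
      (trans (sum-combine a _) (sum-cong-≋ λ i → sum-cong-≋ λ j → reflexive
        (≡.cong (λ { (i , j) → restrict (q i j) (h i j) }) (Fin.remQuot-combine {a} i j))))
    mass-sum : sum mass ≈ 1#
    mass-sum = trans (cell-sum (λ _ _ → true)) (trans (sum-cong-≋ row-sum) A.mass-sum)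
    push₀ : ∀ x → A.mass x ≈ ∑-fibre to₀ x mass
    push₀ x = trans (∑-fibre-id x A.mass) (trans (sum-cong-≋ λ i →
        trans (restrict-cong (does (i Fin.≟ x)) (sym (row-sum i))) (restrict-sum (does (i Fin.≟ x)) (h i)))
      (sym (cell-sum (λ i _ → does (i Fin.≟ x)))))
    push₁ : ∀ x → B.mass x ≈ ∑-fibre to₁ x mass
    push₁ x = trans (∑-fibre-id x B.mass) (trans (sum-cong-≋ λ j →
        trans (restrict-cong (does (j Fin.≟ x)) (sym (col-sum j))) (restrict-sum (does (j Fin.≟ x)) (λ i → h i j)))
      (trans (∑-comm (λ j i → restrict (does (j Fin.≟ x)) (h i j))) (sym (cell-sum (λ _ j → does (j Fin.≟ x))))))
    onto : ∀ {n} (s : Fin size → Fin n) {x μx} → 0# < μx → μx ≈ ∑-fibre s x mass → ∃[ i ] s i ≡ x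
    -- A point with positive mass cannot have an empty fibre.
    onto s 0<μ e = ∃-by-contradiction λ miss → <⇒≱ 0<μ (≤-reflexive (trans e
      (sum-zero λ i → reflexive (restrict-≢ (mass i) (miss i)))))
    surjection : ∀ {n} (s : Fin size → Fin n) → (∀ x → ∃[ i ] s i ≡ x) → Fin size ↠ Fin n
    surjection s hit = record
      { to = s ; cong = ≡.cong s ; surjective = λ x → proj₁ (hit x) , λ { ≡.refl → proj₂ (hit x) } }
    C : Object V
    C = record
      { size      = size
      -- Neither objects nor morphisms relate the clopen sets to the masses, so any clopen partition
      -- with `size` parts serves; `realise` provides one.
      ; partition = proj₁ (realise mass mass∈G mass>0 mass-sum)
      ; mass      = mass
      ; mass∈V    = λ i → G∩[0,1]⊆V (mass∈G i) (proj₁ (mass>0 i)) (≤-respʳ mass-sum (term≤sum (proj₁ ∘ mass>0) i))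
      ; mass>0    = mass>0
      ; mass-sum  = mass-sum
      }
    s₀ : Morphism V C A
    s₀ = record { surjection = surjection to₀ (λ x → onto to₀ (A.mass>0 x) (push₀ x)) ; pushforward = push₀ }
    s₁ : Morphism V C B
    s₁ = record { surjection = surjection to₁ (λ x → onto to₁ (B.mass>0 x) (push₁ x)) ; pushforward = push₁ }
    commutes : ∀ x → r₀ (to₀ x) ≡ r₁ (to₁ x)
    commutes x = by-contradiction λ ne → <⇒≱ (mass>0 x) (≤-reflexive (support (to₀ x) (to₁ x) ne))

  directed : IsDirected (𝓕 V)
  directed A B =
    let (C , s₀ , s₁ , _) = pullback {1} A B (λ _ → zero) (λ _ → zero)
          (λ { zero → trans (Object.mass-sum A) (sym (Object.mass-sum B)) })
    in C , s₀ , s₁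

  amalgamation : HasAmalgamation (𝓕 V)
  amalgamation {A} {B₀} {B₁} r₀ r₁ = pullback B₀ B₁ (Morphism.to r₀) (Morphism.to r₁)
    (λ x → trans (sym (Morphism.pushforward r₀ x)) (Morphism.pushforward r₁ x))

-- Codes in ℕ and countability of the category.

-- A self-delimiting code: `k` in unary by constructors `2[1+_]`, ended by one `1+[2_]`, after which
-- `b` follows. Injectivity is then that of the constructors.
pairᵇ : ℕ → ℕᵇ → ℕᵇ
pairᵇ zero    b = 1+[2 b ]
pairᵇ (suc k) b = 2[1+ pairᵇ k b ]

pairᵇ-injective : ∀ {k l b c} → pairᵇ k b ≡ pairᵇ l c → k ≡ l × b ≡ c
pairᵇ-injective {zero}  {zero}  e = ≡.refl , ℕᵇ.1+[2_]-injective e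
pairᵇ-injective {suc k} {suc l} e = let (p , q) = pairᵇ-injective {k} {l} (ℕᵇ.2[1+_]-injective e) in ≡.cong suc p , q

abstract
  pair : ℕ → ℕ → ℕ
  pair k l = ℕᵇ.toℕ (pairᵇ k (ℕᵇ.fromℕ l))

  pair-injective : ∀ {k l k′ l′} → pair k l ≡ pair k′ l′ → k ≡ k′ × l ≡ l′
  pair-injective {k} {l} {k′} e =
    let (p , q) = pairᵇ-injective {k} {k′} (ℕᵇ.toℕ-injective e) in p , ℕᵇ.fromℕ-injective q

tuple : ∀ {n} → (Fin n → ℕ) → ℕ
tuple {zero}  f = 0
tuple {suc n} f = pair (f zero) (tuple (f ∘ suc))

tuple-injective : ∀ {n} (f g : Fin n → ℕ) → tuple f ≡ tuple g → f ≗ g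
tuple-injective f g e zero    = proj₁ (pair-injective e)
tuple-injective f g e (suc i) = tuple-injective (f ∘ suc) (g ∘ suc) (proj₂ (pair-injective e)) i

tuple-injective-cast : ∀ {m n} (e : m ≡ n) (f : Fin m → ℕ) (g : Fin n → ℕ) → tuple f ≡ tuple g →
                       ∀ i → f i ≡ g (Fin.cast e i)
tuple-injective-cast ≡.refl f g p i = ≡.trans (tuple-injective f g p i) (≡.cong g (≡.sym (Fin.cast-is-id ≡.refl i)))

table : (Word → ℕ) → ℕ → Word → ℕ
table g zero    ρ = g ρ
table g (suc n) ρ = pair (table g n (false ∷ ρ)) (table g n (true ∷ ρ))

table-injective : ∀ g h n ρ → table g n ρ ≡ table h n ρ → ∀ x → x ∈ Cylinder ρ →
                  g (prefix x (n ℕ.+ length ρ)) ≡ h (prefix x (n ℕ.+ length ρ))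
table-injective g h zero    ρ e x x∈ = ≡.subst (λ σ → g σ ≡ h σ) (≡.sym (cylinder-prefix ρ x∈)) e
table-injective g h (suc n) ρ e x x∈ = ≡.subst (λ k → g (prefix x k) ≡ h (prefix x k)) (ℕ.+-suc n (length ρ)) (go (x (length ρ)) ≡.refl)
  where
  go : ∀ b → x (length ρ) ≡ b → g (prefix x (n ℕ.+ suc (length ρ))) ≡ h (prefix x (n ℕ.+ suc (length ρ)))
  go false l = table-injective g h n (false ∷ ρ) (proj₁ (pair-injective e)) x (l , x∈)
  go true  l = table-injective g h n (true ∷ ρ) (proj₂ (pair-injective e)) x (l , x∈)

module Countability (em : ∀ {ℓ} → ExcludedMiddle ℓ) where
  open Classical em
  open Bar em
  open ClopenPartition

  -- The code need not respect ≈: an element is sent to the least code in its class.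
  countable-by-code : ∀ {a ℓ} (S : Setoid a ℓ) (code : Setoid.Carrier S → ℕ) →
                      (∀ {x y} → code x ≡ code y → Setoid._≈_ S x y) → Countable S
  countable-by-code S code reflects = record
    { to        = number
    ; cong      = λ {x} {y} e → ℕ.≤-antisym
        (least-number x (moved (sym e) (attained y))) (least-number y (moved e (attained x)))
    ; injective = λ {x} {y} e →
        let (x′ , x′≈x , p) = attained x
            (y′ , y′≈y , q) = attained y
        in trans (sym x′≈x) (trans (reflects (≡.trans p (≡.trans e (≡.sym q)))) y′≈y)
    }
    where
    open Setoid S
    IsCodeOf : Carrier → ℕ → Set _
    IsCodeOf x n = ∃[ y ] (y ≈ x × code y ≡ n)
    minimum : ∀ x → ∃[ n ] (IsCodeOf x n × (∀ k → IsCodeOf x k → n ℕ.≤ k))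
    minimum x = least {P = IsCodeOf x} (code x , x , refl , ≡.refl)
    number : Carrier → ℕ
    number x = proj₁ (minimum x)
    attained : ∀ x → IsCodeOf x (number x)
    attained x = proj₁ (proj₂ (minimum x))
    least-number : ∀ x {k} → IsCodeOf x k → number x ℕ.≤ k
    least-number x {k} = proj₂ (proj₂ (minimum x)) k
    moved : ∀ {x y k} → x ≈ y → IsCodeOf x k → IsCodeOf y k
    moved e (z , z≈x , p) = z , trans z≈x e , p

  label : ∀ {n} → ClopenPartition n → Cantor → Fin n
  label P x = proj₁ (cover P x)

  label-unique : ∀ {n} (P : ClopenPartition n) {x i} → x ∈ part P i → label P x ≡ i
  label-unique P {x} {i} x∈i with label P x Fin.≟ i
  ... | yes e = e
  ... | no ne = contradiction (proj₂ (cover P x) , x∈i) (disjoint P ne)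

  abstract
    -- Labels are locally constant, and compactness makes the modulus uniform.
    label-modulus : ∀ {n} (P : ClopenPartition n) → ∃[ N ] (∀ x y → Agree N x y → label P x ≡ label P y)
    label-modulus P = let (N , same) = bar-induction Q step barred in N , λ x y → same x y tt tt
      where
      Q : Word → Set
      Q ρ = ∃[ N ] (∀ x y → x ∈ Cylinder ρ → y ∈ Cylinder ρ → Agree N x y → label P x ≡ label P y)
      step : ∀ ρ → Q (false ∷ ρ) → Q (true ∷ ρ) → Q ρ
      step ρ (M , p) (N , q) = K , λ x y x∈ y∈ a → by-letter x y x∈ y∈ a (x (length ρ)) ≡.refl
        where
        K : ℕ
        -- The term `suc (length ρ)` makes the two points share the letter after `ρ`, so that they
        -- lie below the same child.
        K = (M ℕ.⊔ N) ℕ.⊔ suc (length ρ)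
        by-letter : ∀ x y → x ∈ Cylinder ρ → y ∈ Cylinder ρ → Agree K x y → ∀ b → x (length ρ) ≡ b → label P x ≡ label P y
        by-letter x y x∈ y∈ a b e = go b e (≡.trans (≡.sym (a (length ρ) (ℕ.m≤n⊔m (M ℕ.⊔ N) (suc (length ρ))))) e)
          where
          go : ∀ b → x (length ρ) ≡ b → y (length ρ) ≡ b → label P x ≡ label P y
          go false e e′ = p x y (e , x∈) (e′ , y∈) (agree-≤ (ℕ.≤-trans (ℕ.m≤m⊔n M N) (ℕ.m≤m⊔n (M ℕ.⊔ N) _)) a)
          go true  e e′ = q x y (e , x∈) (e′ , y∈) (agree-≤ (ℕ.≤-trans (ℕ.m≤n⊔m M N) (ℕ.m≤m⊔n (M ℕ.⊔ N) _)) a)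
      barred : ∀ x → ∃[ n ] Q (prefix x n)
      barred x = let (i , x∈i) = cover P x
                     (n , inside) = open⇒cylinder (proj₁ (clopen P i)) x∈i
                 in n , 0 , λ y z y∈ z∈ _ → ≡.trans (label-unique P (inside y∈)) (≡.sym (label-unique P (inside z∈)))

  -- A sample point stands for the cylinder; at the depth of the modulus its choice does not matter.
  wordLabel : ∀ {n} → ClopenPartition n → Word → ℕ
  wordLabel P ρ = toℕ (label P (proj₁ (cylinder-inhabited ρ)))

  wordLabel-prefix : ∀ {n} (P : ClopenPartition n) x → wordLabel P (prefix x (proj₁ (label-modulus P))) ≡ toℕ (label P x)
  wordLabel-prefix P x = ≡.cong toℕ (proj₂ (label-modulus P) y x
    (≡.subst (λ k → Agree k y x) (length-prefix x N)
      (cylinder⇒agree (prefix x N) (proj₂ (cylinder-inhabited (prefix x N))) (prefix∈Cylinder x N))))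
    where
    N = proj₁ (label-modulus P)
    y = proj₁ (cylinder-inhabited (prefix x N))

  -- The labels of the words of length `N` form a finite table, and together with `N` it determines
  -- the label of every point.
  partitionCode : ∀ {n} → ClopenPartition n → ℕ
  partitionCode P = let (N , _) = label-modulus P in pair N (table (wordLabel P) N [])

  partitionCode-injective : ∀ {m n} (P : ClopenPartition m) (Q : ClopenPartition n) →
                            partitionCode P ≡ partitionCode Q → ∀ x → toℕ (label P x) ≡ toℕ (label Q x)
  partitionCode-injective P Q e x =
    ≡.trans (≡.sym (wordLabel-prefix P x)) (≡.trans same (wordLabel-prefix Q x))
    where
    M N : ℕ
    M = proj₁ (label-modulus P)
    N = proj₁ (label-modulus Q)
    compare : ∀ M N → M ≡ N → table (wordLabel P) M [] ≡ table (wordLabel Q) N [] →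
              wordLabel P (prefix x M) ≡ wordLabel Q (prefix x N)
    compare M .M ≡.refl t = ≡.subst (λ k → wordLabel P (prefix x k) ≡ wordLabel Q (prefix x k)) (ℕ.+-identityʳ M)
      (table-injective (wordLabel P) (wordLabel Q) M [] t x tt)
    same : wordLabel P (prefix x M) ≡ wordLabel Q (prefix x N)
    same = let (p , q) = pair-injective e in compare M N p q

module CountableCategory (em : ∀ {ℓ} → ExcludedMiddle ℓ) (ℝ : CompleteOrderedField)
  (V : Pred (CompleteOrderedField.Carrier ℝ) 0ℓ) (groupLike : Theory.GroupLike ℝ V)
  where

  open CompleteOrderedField ℝ using (_≈_; sym; trans; reflexive)
  open Countability em
  open Theory ℝ using (Object; module Object; Morphism; module Morphism; _≈ₒ_; 𝓕)
  open Intervals em ℝ V groupLike using (v; index)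

  massCode : ∀ (A : Object V) → Fin (Object.size A) → ℕ
  massCode A i = proj₁ (index (Object.mass∈V A i))

  -- The code depends on the listing of the parts, which `_≈ₒ_` ignores. It only has to reflect
  -- equality, and equal codes already force equal listings, up to a cast of sizes.
  code : Object V → ℕ
  code A = pair (Object.size A) (pair (partitionCode (Object.partition A)) (tuple (massCode A)))

  same-code : ∀ {A B} → code A ≡ code B → _≈ₒ_ V A B
  same-code {A} {B} e = record
    { relist    = mk↔ₛ′ (Fin.cast size≡) (Fin.cast (≡.sym size≡))
                    (Fin.cast-involutive size≡ (≡.sym size≡)) (Fin.cast-involutive (≡.sym size≡) size≡)
    ; same-part = λ i → (λ {x} → part⊆ i x) , (λ {x} → part⊇ i x)
    ; same-mass = λ i → trans (sym (proj₂ (index (A.mass∈V i))))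
        (trans (reflexive (≡.cong v (tuple-injective-cast size≡ (massCode A) (massCode B) masses≡ i)))
          (proj₂ (index (B.mass∈V (Fin.cast size≡ i)))))
    }
    where
    module A = Object A
    module B = Object B
    rest≡ = pair-injective e
    size≡ : A.size ≡ B.size
    size≡ = proj₁ rest≡
    parts≡ : partitionCode A.partition ≡ partitionCode B.partition
    parts≡ = proj₁ (pair-injective (proj₂ rest≡))
    masses≡ : tuple (massCode A) ≡ tuple (massCode B)
    masses≡ = proj₂ (pair-injective (proj₂ rest≡))
    labels≡ : ∀ x → toℕ (label A.partition x) ≡ toℕ (label B.partition x)
    labels≡ = partitionCode-injective A.partition B.partition parts≡
    part⊆ : ∀ i x → x ∈ A.part i → x ∈ B.part (Fin.cast size≡ i)
    part⊆ i x x∈ = ≡.subst (λ j → x ∈ B.part j) (Fin.toℕ-injective (≡.trans (≡.sym (labels≡ x))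
      (≡.trans (≡.cong toℕ (label-unique A.partition x∈)) (≡.sym (Fin.toℕ-cast size≡ i))))) (proj₂ (B.cover x))
    part⊇ : ∀ i x → x ∈ B.part (Fin.cast size≡ i) → x ∈ A.part i
    part⊇ i x x∈ = ≡.subst (λ j → x ∈ A.part j) (Fin.toℕ-injective (≡.trans (labels≡ x)
      (≡.trans (≡.cong toℕ (label-unique B.partition x∈)) (Fin.toℕ-cast size≡ i)))) (proj₂ (A.cover x))

  countable : IsCountable (𝓕 V)
  countable = countable-by-code (Category.object (𝓕 V)) code same-code
            , λ A B → countable-by-code (Category.hom (𝓕 V) A B) (λ r → tuple (toℕ ∘ Morphism.to r))
                (λ {r} {s} e i → Fin.toℕ-injective (tuple-injective (toℕ ∘ Morphism.to r) (toℕ ∘ Morphism.to s) e i))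

proposition3p3 :
  (∀ {ℓ} → ExcludedMiddle ℓ) →
  (ℝ : CompleteOrderedField) →
  let open CompleteOrderedField ℝ using (Carrier)
      open Theory ℝ
  in
  (V : Pred Carrier 0ℓ) → GroupLike V →
  IsCountable (𝓕 V) × IsDirected (𝓕 V) × HasAmalgamation (𝓕 V) ×
  (Σ[ M ∈ ProbabilityMeasure ]
    (IsFull M × IsMaximal M × IsUltrahomogeneous M × ClopenValues M ≐ V))
proposition3p3 em ℝ V groupLike = countable , directed , (λ {A} {B₀} {B₁} → amalgamation {A} {B₀} {B₁}) ,
  measure , full , maximal , ultrahomogeneous , clopenValues≐V
  where
  open CountableCategory em ℝ V groupLike using (countable)
  open Amalgamation em ℝ V groupLike using (directed; amalgamation)
  open Intervals em ℝ V groupLike using (measure)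
  open Existence em ℝ V groupLike using (full; maximal; ultrahomogeneous; clopenValues≐V)
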